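{- There exists a constant $0<c<1$ such that the following holds for all $\delta,\varepsilon>0$, $0<s\le w$ and $$p\le p(w,s):=\frac{c\,\delta^{s/2w}}{(w^3\log(1/\varepsilon))^2}.$$ For any width-$w$ DNF formula $f:\{0,1\}^n\to\{0,1\}$ and $\rho\leftarrow\mathcal D$ with $\mathcal D\in\mathcal D_p(w)$, with probability at least $1-\delta^{s/4}-\varepsilon$ there exist width-$w/2$ DNF formulae $f_\rho^\ell,f_\rho^u:\{0,1\}^{L(\rho)}\to\{0,1\}$ that are $\varepsilon$-sandwiching approximators for $f_\rho$.
   Context: A DNF formula is an OR of terms, each term being an AND of literals; it has width $v$ if every term has at most $v$ literals. Functions $g_\ell,g_u$ are $\varepsilon$-sandwiching approximators for a Boolean function $g$ if $g_\ell\le g\le g_u$ pointwise and each of $g_\ell,g_u$ differs from $g$ with probability at most $\varepsilon$ on a uniformly random input. Restrictions: for $L\subseteq[n]$ and $x\in\{0,1\}^{[n]\setminus L}$, the restriction $\rho=\rho_{L,x}\in\{*,0,1\}^n$ has $\rho_i=*$ if $i\in L$ and $\rho_i=x_i$ otherwise; $L(\rho)=L$ is the set of live variables. For $f:\{0,1\}^n\to\{0,1\}$, the function $f_\rho:\{0,1\}^{L(\rho)}\to\{0,1\}$ is $f_\rho(y)=f(z)$ with $z_i=y_i$ for $i\in L(\rho)$ and $z_i=\rho_i$ otherwise. For a distribution $\mathcal D$ on $2^{[n]}$ (the subsets of $[n]$), $\rho\leftarrow\mathcal D$ means $\rho=\rho_{L,x}$ with $L\leftarrow\mathcal D$ and $x$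 uniform in $\{0,1\}^{[n]\setminus L}$. $\mathcal D$ is $p$-regular if $\Pr_{L\leftarrow\mathcal D}[i\in L]=p$ for each $i\in[n]$. For $k\le n$, $\mathcal D_p(k)$ denotes the class of $p$-regular distributions $\mathcal D$ on $2^{[n]}$ such that $\Pr_{L\leftarrow\mathcal D}[I\subseteq L]\le 2p^{|I|}$ for all $I\subseteq[n]$ with $|I|\le k$.
   Formalization: In the bound on p, log(1/ε) is read as max(1, log₂(1/ε)), since with the bare logarithm the claim fails for ε close to 1 (the bound would then admit p = 1); for ε ≤ 1/2 it is the plain logarithm. -}

module Defs where

open import Data.Bool using (Bool; true; false; T; if_then_else_; not; _xor_)
import Data.Bool as Bool
open import Data.Bool.ListAction using (all; any)
open import Data.Fin using (Fin; zero; suc)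
open import Data.Fin.Subset using (Subset; inside; outside; _∈_; ∁; ∣_∣)
open import Data.Fin.Subset.Properties using (_∈?_; _⊆?_)
open import Data.Integer using (+_)
open import Data.List using (List; []; _∷_; map; _++_; foldr; filterᵇ; length)
open import Data.List.Relation.Unary.All using (All)
open import Data.Maybe using (Maybe; just; nothing; is-nothing)
open import Data.Nat as ℕ using (ℕ; zero; suc)
import Data.Nat.Properties as ℕ
open import Data.Product using (∃; Σ-syntax; _×_; _,_)
open import Data.Rational as ℚ using (ℚ; 0ℚ; 1ℚ)
import Data.Rational.Properties as ℚ
open import Data.Vec as Vec using (Vec; []; _∷_)
open import Relation.Nullary using (does; yes; no)

------------------------------------------------------------------------
-- Real numbers
--
-- A real is a Cauchy sequence of rationals. The operations act termwise on
-- arbitrary sequences, so that they need no side conditions; applied to Cauchy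
-- sequences inside the domain of the operation in question (a nonzero divisor,
-- a positive argument of ln) they give sequences converging to the usual value.

Seq : Set
Seq = ℕ → ℚ

Cauchy : Seq → Set
Cauchy x = ∀ q → 0ℚ ℚ.< q → ∃ λ N → ∀ m n → N ℕ.≤ m → N ℕ.≤ n → ℚ.∣ x m ℚ.- x n ∣ ℚ.≤ q

record ℝ : Set where
  field
    seq    : Seq
    cauchy : Cauchy seq

open ℝ public

infix 4 _≤_ _<_ _≃_

_≤_ : Seq → Seq → Set
x ≤ y = ∀ q → 0ℚ ℚ.< q → ∃ λ N → ∀ n → N ℕ.≤ n → x n ℚ.≤ y n ℚ.+ q

_<_ : Seq → Seq → Set
x < y = ∃ λ q → 0ℚ ℚ.< q × ∃ λ N → ∀ n → N ℕ.≤ n → x n ℚ.+ q ℚ.≤ y n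

_≃_ : Seq → Seq → Set
x ≃ y = x ≤ y × y ≤ x

fromℚ : ℚ → Seq
fromℚ q _ = q

fromℕ : ℕ → Seq
fromℕ k = fromℚ (+ k ℚ./ 1)

invℚ : ℚ → ℚ
invℚ q with q ℚ.≟ 0ℚ
... | yes _  = 0ℚ
... | no q≢0 = ℚ.1/_ q {{ℚ.≢-nonZero q≢0}}

powℚ : ℚ → ℕ → ℚ
powℚ q zero    = 1ℚ
powℚ q (suc k) = q ℚ.* powℚ q k

infixl 6 _+_ _-_
infixl 7 _*_ _/_
infixr 8 _^_ _^ᴿ_

_+_ _-_ _*_ _/_ _⊔_ : Seq → Seq → Seq
(x + y) n = x n ℚ.+ y n
(x - y) n = x n ℚ.- y n
(x * y) n = x n ℚ.* y n
(x / y) n = x n ℚ.* invℚ (y n)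
(x ⊔ y) n = x n ℚ.⊔ y n

_^_ : Seq → ℕ → Seq
(x ^ k) n = powℚ (x n) k

1/!_ : ℕ → ℚ
1/! zero  = 1ℚ
1/! suc k = 1/! k ℚ.* (+ 1 ℚ./ suc k)

-- ∑_{k ≤ n} q^k / k!
expℚ : ℕ → ℚ → ℚ
expℚ zero    q = 1ℚ
expℚ (suc k) q = expℚ k q ℚ.+ powℚ q (suc k) ℚ.* (1/! suc k)

-- ∑_{k ≤ n} z^(2k+1) / (2k+1)
artanhℚ : ℕ → ℚ → ℚ
artanhℚ zero    z = z
artanhℚ (suc k) z = artanhℚ k z ℚ.+ powℚ z (suc (2 ℕ.* suc k)) ℚ.* (+ 1 ℚ./ suc (2 ℕ.* suc k))

exp : Seq → Seq
exp x n = expℚ n (x n)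

-- ln x = 2 artanh ((x - 1) / (x + 1)), valid for every x > 0
ln : Seq → Seq
ln x n = (+ 2 ℚ./ 1) ℚ.* artanhℚ n (((x - fromℕ 1) / (x + fromℕ 1)) n)

log₂ : Seq → Seq
log₂ x = ln x / ln (fromℕ 2)

_^ᴿ_ : Seq → Seq → Seq
x ^ᴿ t = exp (t * ln x)

sum : List Seq → Seq
sum = foldr _+_ (fromℕ 0)

------------------------------------------------------------------------
-- DNF formulae over a set V of variables; (v , true) is the literal v and
-- (v , false) its negation.

Literal Term DNF : Set → Set
Literal V = V × Bool
Term V    = List (Literal V)
DNF V     = List (Term V)

evalLiteral : {V : Set} → (V → Bool) → Literal V → Bool
evalLiteral a (v , b) = if b then a v else not (a v)

eval : {V : Set} → DNF V → (V → Bool) → Bool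
eval φ a = any (all (evalLiteral a)) φ

-- The bound is rational so that "width w/2" also makes sense for odd w.
HasWidth : {V : Set} → ℚ → DNF V → Set
HasWidth v φ = All (λ t → + length t ℚ./ 1 ℚ.≤ v) φ

------------------------------------------------------------------------
-- Cube L is {0,1}^L.

data Cube : ∀ {n} → Subset n → Set where
  []   : Cube []
  _∷_  : ∀ {n} {L : Subset n} → Bool → Cube L → Cube (inside ∷ L)
  skip : ∀ {n} {L : Subset n} → Cube L → Cube (outside ∷ L)

Var : ∀ {n} → Subset n → Set
Var L = ∃ λ i → i ∈ L

coord : ∀ {n} {L : Subset n} → Cube L → Var L → Bool
coord (b ∷ y)  (zero  , _)             = b
coord (b ∷ y)  (suc i , Vec.there i∈L) = coord y (i , i∈L)
coord (skip y) (suc i , Vec.there i∈L) = coord y (i , i∈L)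

points : ∀ {n} (L : Subset n) → List (Cube L)
points []            = [] ∷ []
points (inside ∷ L)  = map (false ∷_) (points L) ++ map (true ∷_) (points L)
points (outside ∷ L) = map skip (points L)

-- Pr_{y uniform in {0,1}^L} [ P y ]
uniformPr : ∀ {n} (L : Subset n) → (Cube L → Bool) → ℚ
uniformPr L P = ℚ._/_ (+ length (filterᵇ P (points L))) (2 ℕ.^ ∣ L ∣) {{ℕ.m^n≢0 2 ∣ L ∣}}

record Sandwiching {n} {L : Subset n} (ε : Seq) (gˡ gᵘ g : Cube L → Bool) : Set where
  field
    lower    : ∀ y → gˡ y Bool.≤ g y
    upper    : ∀ y → g y Bool.≤ gᵘ y
    lowerErr : fromℚ (uniformPr L (λ y → gˡ y xor g y)) ≤ ε
    upperErr : fromℚ (uniformPr L (λ y → gᵘ y xor g y)) ≤ ε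

------------------------------------------------------------------------
-- Restrictions: elements of {*,0,1}^n, with nothing for *.

Restriction : ℕ → Set
Restriction n = Vec (Maybe Bool) n

live : ∀ {n} → Restriction n → Subset n
live = Vec.map is-nothing

restriction : ∀ {n} (L : Subset n) → Cube (∁ L) → Restriction n
restriction []            []       = []
restriction (inside ∷ L)  (skip x) = nothing ∷ restriction L x
restriction (outside ∷ L) (b ∷ x)  = just b ∷ restriction L x

fill : ∀ {n} (ρ : Restriction n) → Cube (live ρ) → Vec Bool n
fill []            []       = []
fill (nothing ∷ ρ) (b ∷ y)  = b ∷ fill ρ y
fill (just b ∷ ρ)  (skip y) = b ∷ fill ρ y

_↾_ : ∀ {n} → (Vec Bool n → Bool) → (ρ : Restriction n) → Cube (live ρ) → Bool
(f ↾ ρ) y = f (fill ρ y)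

------------------------------------------------------------------------
-- Distributions on the subsets of [n]

subsets : ∀ n → List (Subset n)
subsets zero    = [] ∷ []
subsets (suc n) = map (outside ∷_) (subsets n) ++ map (inside ∷_) (subsets n)

record Distribution (n : ℕ) : Set where
  field
    weight : Subset n → ℝ
    nonneg : ∀ L → fromℕ 0 ≤ seq (weight L)
    total  : sum (map (λ L → seq (weight L)) (subsets n)) ≃ fromℕ 1

open Distribution public

-- Pr_{L ← D} [ P L ]
Pr : ∀ {n} → Distribution n → (Subset n → Bool) → Seq
Pr {n} D P = sum (map (λ L → seq (weight D L)) (filterᵇ P (subsets n)))

Regular : ∀ {n} → Seq → Distribution n → Set
Regular p D = ∀ i → Pr D (λ L → does (i ∈? L)) ≃ p

-- D ∈ 𝒟_p(k)
record InClass {n} (p : Seq) (k : ℕ) (D : Distribution n) : Set where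
  field
    k≤n     : k ℕ.≤ n
    regular : Regular p D
    bounded : ∀ I → ∣ I ∣ ℕ.≤ k → Pr D (λ L → does (I ⊆? L)) ≤ fromℕ 2 * p ^ ∣ I ∣

-- Pr_{ρ ← D} [ G ρ ]
restrictionPr : ∀ {n} → Distribution n → (Restriction n → Bool) → Seq
restrictionPr {n} D G =
  sum (map (λ L → seq (weight D L) * fromℚ (uniformPr (∁ L) (λ x → G (restriction L x)))) (subsets n))

-- Pr_{ρ ← D} [ E ρ ] ≥ β for an event E that need not be decidable (comparing a
-- probability with a real ε is not): E contains a decidable event of
-- probability at least β. For decidable E this is the usual inequality.
ProbAtLeast : ∀ {n} → Distribution n → (Restriction n → Set) → Seq → Set
ProbAtLeast {n} D E β =
  Σ[ G ∈ (Restriction n → Bool) ] (∀ ρ → T (G ρ) → E ρ) × β ≤ restrictionPr D G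

------------------------------------------------------------------------

-- log(1/ε), with the usual convention that such a factor is at least 1: for
-- ε ≤ 1/2 it is the plain logarithm. Without the truncation the bound on p
-- degenerates as ε → 1 (it would admit p = 1, i.e. no restriction at all).
log1/ : Seq → Seq
log1/ ε = fromℕ 1 ⊔ log₂ (fromℕ 1 / ε)

-- c δ^(s/2w) / (w³ log(1/ε))²
pBound : (c δ ε s : Seq) (w : ℕ) → Seq
pBound c δ ε s w =
  c * δ ^ᴿ (s / fromℕ (2 ℕ.* w)) / (fromℕ w ^ 3 * log1/ ε) ^ 2

HasSandwich : ∀ {n} → Seq → ℚ → (Vec Bool n → Bool) → Restriction n → Set
HasSandwich ε v f ρ =
  Σ[ φˡ ∈ DNF (Var (live ρ)) ] Σ[ φᵘ ∈ DNF (Var (live ρ)) ]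
    HasWidth v φˡ × HasWidth v φᵘ ×
    Sandwiching ε (λ y → eval φˡ (coord y)) (λ y → eval φᵘ (coord y)) (f ↾ ρ)

{-# OPTIONS --safe #-}
module Submission where

-- Sparsify f from below and from above: as long as there are more than (C w³ j)^w terms, some partial
-- assignment Y is the kernel of a quasi-sunflower, i.e. given Y it is extremely likely that one of the
-- many terms containing Y is satisfied; one such term is deleted (lower approximator), or all of them
-- are replaced by Y (upper approximator). Quasi-sunflowers come from a second-moment bound for the
-- terms around a maximal heavy Y, boosted to exponentially small error by a random colouring of the
-- variables, whose colour classes give independent trials. Both approximators then have at most
-- (C w³ log(1/ε))^w terms, so a union bound over the sets of more than w/2 variables of a term shows
-- that a restriction leaves all terms of width ≤ w/2, except with probability
-- (C w³ log(1/ε))^w p^(w/2) ≤ δ^(s/4), while by Markov's inequality the error stays at most ε for all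
-- but an ε fraction of the restrictions.

open import Data.Bool using (Bool; true; false; T; if_then_else_; _∧_; _∨_; not; _xor_)
import Data.Bool as Bool
open import Data.Bool.ListAction using (any; all)
import Data.Bool.Properties as Bool
open import Data.Empty using (⊥; ⊥-elim)
open import Data.Fin as Fin using (Fin; zero; suc; fromℕ<)
import Data.Fin.Properties as Fin
open import Data.Fin.Subset using (Subset; inside; outside; ∁; _⊆_) renaming (∣_∣ to ∥_∥)
open import Data.Fin.Subset.Properties using (_∈?_; _⊆?_; s⊆s; out⊆)
import Data.Integer as ℤ
import Data.Integer.Properties as ℤ
open import Data.List using (List; []; _∷_; length; filterᵇ; map; mapMaybe; concatMap; _++_)
open import Data.List.Properties using (length-map; length-++)
open import Data.List.Relation.Unary.All using (All; []; _∷_)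
import Data.List.Relation.Unary.All as All
import Data.List.Relation.Unary.All.Properties as All
open import Data.List.Relation.Unary.Any using (Any; here; there)
import Data.List.Relation.Unary.Any as Any
import Data.List.Relation.Unary.Any.Properties as Any
open import Data.Maybe as Maybe using (Maybe; just; nothing; _>>=_)
open import Data.Nat as ℕ using (ℕ; zero; suc)
import Data.Nat.DivMod as ℕ
import Data.Nat.Properties as ℕ
open import Data.Nat.Tactic.RingSolver using () renaming (solve-∀ to ℕ-solve-∀)
open import Data.Product using (∃; Σ-syntax; _×_; _,_; proj₁; proj₂)
import Data.Rational as ℚ
import Data.Rational.Properties as ℚ
import Data.Rational.Unnormalised as ℚᵘ
import Data.Rational.Unnormalised.Properties as ℚᵘ
open import Data.Sum using (_⊎_; inj₁; inj₂; [_,_]′)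
open import Data.Unit using (⊤)
open import Data.Vec as Vec using (Vec; []; _∷_; lookup)
open import Function using (_∘_)
open import Level using (0ℓ)
open import Relation.Binary using (tri<; tri≈; tri>)
open import Relation.Binary.PropositionalEquality using (_≡_; _≢_; refl; sym; trans; cong; cong₂; subst; subst₂; module ≡-Reasoning)
open import Relation.Nullary using (¬_; Dec; yes; no; does)
open import Relation.Nullary.Decidable using (_×-dec_; dec-true)
open import Tactic.RingSolver using (solve-∀)
open import Tactic.RingSolver.Core.AlmostCommutativeRing using (AlmostCommutativeRing; fromCommutativeRing)
import Defs
open Defs using (Seq; ℝ; seq; cauchy; fromℚ; fromℕ; powℚ; invℚ; 1/!_; expℚ; artanhℚ; log1/; pBound)
open Defs using (Term; DNF; evalLiteral; eval; HasWidth; Cube; []; _∷_; skip; Var; coord; points; uniformPr)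
open Defs using (Restriction; live; restriction; fill; subsets; Distribution; weight; nonneg; total; Pr; InClass; restrictionPr; ProbAtLeast; HasSandwich)

-- Terms are deleted one at a time, so the error of a deletion must stay below the reciprocal of
-- their number, while a second moment gives only a constant. Hence the boost to 2^(-Q); it takes 2Q
-- colours and puts a factor Q into the sparsity threshold 64 w Q. A DNF may have any number of
-- terms, so the deletions are grouped into phases whose precision grows with the current size.
-- Their errors form a geometric series in which the initial size disappears. With at most (C w³ (j
-- + 1))^w terms, Q must be of order w² j, and together with the factor w of the threshold this is
-- the origin of w³. Reals are Cauchy sequences whose order cannot be decided. All estimates are
-- therefore made on the rational entries at one large index, with a tolerance that is divided up
-- beforehand. In the essential case, where δ^(s/4w) is at most 1, it is represented by a rational x
-- in [0,1] such that x² is close to the factor in the bound on p and x^w is close to δ^(s/4). Of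
-- the analytic functions only the product law of the truncated exponential and crude bounds on the
-- truncated logarithm enter.

module Rationals where
  open import Data.Rational using (ℚ; 0ℚ; 1ℚ; ½; _+_; _*_; _-_; -_; _≤_; _<_; ∣_∣; _⊓_)

  0≟ : ∀ x → Maybe (0ℚ ≡ x)
  0≟ x with 0ℚ ℚ.≟ x
  ... | yes p = just p
  ... | no _  = nothing

  ring : AlmostCommutativeRing 0ℓ 0ℓ
  ring = fromCommutativeRing ℚ.+-*-commutativeRing 0≟

  ≤⇒0≤- : ∀ {a b} → a ≤ b → 0ℚ ≤ b - a
  ≤⇒0≤- {a} {b} a≤b = subst (_≤ b - a) (ℚ.+-inverseʳ a) (ℚ.+-monoˡ-≤ (- a) a≤b)

  0≤-⇒≤ : ∀ {a b} → 0ℚ ≤ b - a → a ≤ b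
  0≤-⇒≤ {a} {b} h = subst₂ _≤_ (ℚ.+-identityˡ a) (eq a b) (ℚ.+-monoˡ-≤ a h)
    where
    eq : ∀ a b → (b - a) + a ≡ b
    eq = solve-∀ ring

  -- The pattern of most inequalities below: `c` is a certificate, a sum of products of nonnegative
  -- quantities, and the ring solver checks that it equals the difference of the two sides.
  ≤-by : ∀ {a b c} → 0ℚ ≤ c → b - a ≡ c → a ≤ b
  ≤-by h eq = 0≤-⇒≤ (subst (0ℚ ≤_) (sym eq) h)

  0≤+ : ∀ {a b} → 0ℚ ≤ a → 0ℚ ≤ b → 0ℚ ≤ a + b
  0≤+ = ℚ.+-mono-≤

  *-monoˡ-≤ : ∀ {a b c} → 0ℚ ≤ c → a ≤ b → c * a ≤ c * b
  *-monoˡ-≤ {c = c} 0≤c = ℚ.*-monoˡ-≤-nonNeg c {{ℚ.nonNegative 0≤c}}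

  *-monoʳ-≤ : ∀ {a b c} → 0ℚ ≤ c → a ≤ b → a * c ≤ b * c
  *-monoʳ-≤ {c = c} 0≤c = ℚ.*-monoʳ-≤-nonNeg c {{ℚ.nonNegative 0≤c}}

  0≤* : ∀ {a b} → 0ℚ ≤ a → 0ℚ ≤ b → 0ℚ ≤ a * b
  0≤* {a} {b} 0≤a 0≤b = subst (_≤ a * b) (ℚ.*-zeroʳ a) (*-monoˡ-≤ 0≤a 0≤b)

  *-mono-≤ : ∀ {a b c d} → 0ℚ ≤ b → 0ℚ ≤ c → a ≤ b → c ≤ d → a * c ≤ b * d
  *-mono-≤ 0≤b 0≤c a≤b c≤d = ℚ.≤-trans (*-monoʳ-≤ 0≤c a≤b) (*-monoˡ-≤ 0≤b c≤d)

  0<* : ∀ {a b} → 0ℚ < a → 0ℚ < b → 0ℚ < a * b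
  0<* {a} {b} 0<a 0<b = ℚ.positive⁻¹ (a * b) {{ℚ.pos*pos⇒pos a {{ℚ.positive 0<a}} b {{ℚ.positive 0<b}}}}

  0<+ : ∀ {a b} → 0ℚ < a → 0ℚ ≤ b → 0ℚ < a + b
  0<+ = ℚ.+-mono-<-≤

  0≤sq : ∀ a → 0ℚ ≤ a * a
  0≤sq a with ℚ.≤-total 0ℚ a
  ... | inj₁ 0≤a = 0≤* 0≤a 0≤a
  ... | inj₂ a≤0 = subst (0ℚ ≤_) (eq a) (0≤* 0≤-a 0≤-a)
    where
    0≤-a : 0ℚ ≤ - a
    0≤-a = ℚ.neg-antimono-≤ a≤0
    eq : ∀ a → - a * - a ≡ a * a
    eq = solve-∀ ring

  *-cancelʳ-≤ : ∀ {a b c} → 0ℚ < c → a * c ≤ b * c → a ≤ b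
  *-cancelʳ-≤ {c = c} 0<c = ℚ.*-cancelʳ-≤-pos c {{ℚ.positive 0<c}}

  *-cancelʳ-≡ : ∀ {a b c} → 0ℚ < c → a * c ≡ b * c → a ≡ b
  *-cancelʳ-≡ 0<c eq = ℚ.≤-antisym (*-cancelʳ-≤ 0<c (ℚ.≤-reflexive eq)) (*-cancelʳ-≤ 0<c (ℚ.≤-reflexive (sym eq)))

  0<½ : 0ℚ < ½
  0<½ = ℚ.positive⁻¹ ½

  0≤½ : 0ℚ ≤ ½
  0≤½ = ℚ.<⇒≤ 0<½

  0<1 : 0ℚ < 1ℚ
  0<1 = ℚ.positive⁻¹ 1ℚ

  0≤1 : 0ℚ ≤ 1ℚ
  0≤1 = ℚ.<⇒≤ 0<1

  abstract
    -- Abstract, since the gcd normalisation inside `ℚ./` would otherwise unfold on symbolic or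
    -- large arguments. `ι-def` is the way back to the literals of the definitions and of the ring
    -- solver.
    ι : ℕ → ℚ
    ι n = ℤ.+ n ℚ./ 1

    ι-def : ∀ n → ι n ≡ ℤ.+ n ℚ./ 1
    ι-def n = refl

  ι-0 : ι 0 ≡ 0ℚ
  ι-0 = ι-def 0

  ι-1 : ι 1 ≡ 1ℚ
  ι-1 = ι-def 1

  toℚᵘ-ι : ∀ n → ℚ.toℚᵘ (ι n) ℚᵘ.≃ ℚᵘ.mkℚᵘ (ℤ.+ n) 0
  toℚᵘ-ι n = subst (λ q → ℚ.toℚᵘ q ℚᵘ.≃ ℚᵘ.mkℚᵘ (ℤ.+ n) 0) (sym (ι-def n)) (ℚ.toℚᵘ-fromℚᵘ (ℚᵘ.mkℚᵘ (ℤ.+ n) 0))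

  /-*-cancel : ∀ a n .{{_ : ℕ.NonZero n}} → (ℤ.+ a ℚ./ n) * ι n ≡ ι a
  /-*-cancel a n@(suc n-1) = ℚ.toℚᵘ-injective (begin
    ℚ.toℚᵘ ((ℤ.+ a ℚ./ n) * ι n)  ≈⟨ ℚ.toℚᵘ-homo-* (ℤ.+ a ℚ./ n) (ι n) ⟩
    ℚ.toℚᵘ (ℤ.+ a ℚ./ n) ℚᵘ.* ℚ.toℚᵘ (ι n)  ≈⟨ ℚᵘ.*-cong (ℚ.toℚᵘ-fromℚᵘ (ℚᵘ.mkℚᵘ (ℤ.+ a) n-1)) (toℚᵘ-ι n) ⟩
    ℚᵘ.mkℚᵘ (ℤ.+ a) n-1 ℚᵘ.* ℚᵘ.mkℚᵘ (ℤ.+ n) 0  ≈⟨ ℚᵘ.*≡* eq ⟩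
    ℚᵘ.mkℚᵘ (ℤ.+ a) 0  ≈⟨ ℚᵘ.≃-sym (toℚᵘ-ι a) ⟩
    ℚ.toℚᵘ (ι a)  ∎)
    where
    open ℚᵘ.≃-Reasoning
    eq : (ℤ.+ a ℤ.* ℤ.+ n) ℤ.* ℤ.+ 1 ≡ ℤ.+ a ℤ.* (ℤ.+ (n ℕ.* 1))
    eq = trans (ℤ.*-identityʳ (ℤ.+ a ℤ.* ℤ.+ n)) (cong (λ k → ℤ.+ a ℤ.* ℤ.+ k) (sym (ℕ.*-identityʳ n)))

  ι-+ : ∀ m n → ι (m ℕ.+ n) ≡ ι m + ι n
  ι-+ m n = ℚ.toℚᵘ-injective (begin
    ℚ.toℚᵘ (ι (m ℕ.+ n))  ≈⟨ toℚᵘ-ι (m ℕ.+ n) ⟩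
    ℚᵘ.mkℚᵘ (ℤ.+ (m ℕ.+ n)) 0  ≈⟨ ℚᵘ.*≡* (cong (ℤ._* ℤ.+ 1) (sym (cong₂ ℤ._+_ (ℤ.*-identityʳ (ℤ.+ m)) (ℤ.*-identityʳ (ℤ.+ n))))) ⟩
    ℚᵘ.mkℚᵘ (ℤ.+ m) 0 ℚᵘ.+ ℚᵘ.mkℚᵘ (ℤ.+ n) 0 ≈⟨ ℚᵘ.≃-sym (ℚᵘ.+-cong (toℚᵘ-ι m) (toℚᵘ-ι n)) ⟩
    ℚ.toℚᵘ (ι m) ℚᵘ.+ ℚ.toℚᵘ (ι n)  ≈⟨ ℚᵘ.≃-sym (ℚ.toℚᵘ-homo-+ (ι m) (ι n)) ⟩
    ℚ.toℚᵘ (ι m + ι n)  ∎)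
    where open ℚᵘ.≃-Reasoning

  ι-* : ∀ m n → ι (m ℕ.* n) ≡ ι m * ι n
  ι-* m n = ℚ.toℚᵘ-injective (begin
    ℚ.toℚᵘ (ι (m ℕ.* n))  ≈⟨ toℚᵘ-ι (m ℕ.* n) ⟩
    ℚᵘ.mkℚᵘ (ℤ.+ (m ℕ.* n)) 0  ≈⟨ ℚᵘ.*≡* (cong (ℤ._* ℤ.+ 1) (ℤ.pos-* m n)) ⟩
    ℚᵘ.mkℚᵘ (ℤ.+ m) 0 ℚᵘ.* ℚᵘ.mkℚᵘ (ℤ.+ n) 0 ≈⟨ ℚᵘ.≃-sym (ℚᵘ.*-cong (toℚᵘ-ι m) (toℚᵘ-ι n)) ⟩
    ℚ.toℚᵘ (ι m) ℚᵘ.* ℚ.toℚᵘ (ι n)  ≈⟨ ℚᵘ.≃-sym (ℚ.toℚᵘ-homo-* (ι m) (ι n)) ⟩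
    ℚ.toℚᵘ (ι m * ι n)  ∎)
    where open ℚᵘ.≃-Reasoning

  ι-mono : ∀ {m n} → m ℕ.≤ n → ι m ≤ ι n
  ι-mono {m} {n} m≤n = ℚ.toℚᵘ-cancel-≤ (ℚᵘ.≤-respˡ-≃ (ℚᵘ.≃-sym (toℚᵘ-ι m)) (ℚᵘ.≤-respʳ-≃ (ℚᵘ.≃-sym (toℚᵘ-ι n))
    (ℚᵘ.*≤* (ℤ.*-monoʳ-≤-nonNeg (ℤ.+ 1) (ℤ.+≤+ m≤n)))))

  ι-cancel : ∀ {m n} → ι m ≤ ι n → m ℕ.≤ n
  ι-cancel {m} {n} h with ℚᵘ.≤-respˡ-≃ (toℚᵘ-ι m) (ℚᵘ.≤-respʳ-≃ (toℚᵘ-ι n) (ℚ.toℚᵘ-mono-≤ h))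
  ... | ℚᵘ.*≤* le = ℤ.drop‿+≤+ (subst₂ ℤ._≤_ (ℤ.*-identityʳ (ℤ.+ m)) (ℤ.*-identityʳ (ℤ.+ n)) le)

  0≤ι : ∀ n → 0ℚ ≤ ι n
  0≤ι n = subst (_≤ ι n) ι-0 (ι-mono ℕ.z≤n)

  1≤ι : ∀ n .{{_ : ℕ.NonZero n}} → 1ℚ ≤ ι n
  1≤ι (suc n) = subst (_≤ ι (suc n)) ι-1 (ι-mono (ℕ.s≤s ℕ.z≤n))

  0<ι : ∀ n .{{_ : ℕ.NonZero n}} → 0ℚ < ι n
  0<ι n = ℚ.<-≤-trans 0<1 (1≤ι n)

  ι-suc : ∀ n → ι (suc n) ≡ 1ℚ + ι n
  ι-suc n = trans (ι-+ 1 n) (cong (_+ ι n) ι-1)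

  pow-≥0 : ∀ {a} k → 0ℚ ≤ a → 0ℚ ≤ powℚ a k
  pow-≥0 zero    0≤a = 0≤1
  pow-≥0 (suc k) 0≤a = 0≤* 0≤a (pow-≥0 k 0≤a)

  pow->0 : ∀ {a} k → 0ℚ < a → 0ℚ < powℚ a k
  pow->0 zero    0<a = 0<1
  pow->0 (suc k) 0<a = 0<* 0<a (pow->0 k 0<a)

  pow-mono : ∀ {a b} k → 0ℚ ≤ a → a ≤ b → powℚ a k ≤ powℚ b k
  pow-mono zero    0≤a a≤b = ℚ.≤-refl
  pow-mono (suc k) 0≤a a≤b = *-mono-≤ (ℚ.≤-trans 0≤a a≤b) (pow-≥0 k 0≤a) a≤b (pow-mono k 0≤a a≤b)

  pow-+ : ∀ a j k → powℚ a (j ℕ.+ k) ≡ powℚ a j * powℚ a k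
  pow-+ a zero    k = sym (ℚ.*-identityˡ _)
  pow-+ a (suc j) k = trans (cong (a *_) (pow-+ a j k)) (sym (ℚ.*-assoc a (powℚ a j) (powℚ a k)))

  pow-* : ∀ a b k → powℚ (a * b) k ≡ powℚ a k * powℚ b k
  pow-* a b zero    = refl
  pow-* a b (suc k) = trans (cong (a * b *_) (pow-* a b k)) (eq a b (powℚ a k) (powℚ b k))
    where
    eq : ∀ a b x y → a * b * (x * y) ≡ a * x * (b * y)
    eq = solve-∀ ring

  pow-1 : ∀ k → powℚ 1ℚ k ≡ 1ℚ
  pow-1 zero    = refl
  pow-1 (suc k) = trans (ℚ.*-identityˡ _) (pow-1 k)

  pow-≤1 : ∀ {a} k → 0ℚ ≤ a → a ≤ 1ℚ → powℚ a k ≤ 1ℚ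
  pow-≤1 {a} k 0≤a a≤1 = subst (powℚ a k ≤_) (pow-1 k) (pow-mono k 0≤a a≤1)

  pow-≥1 : ∀ {a} k → 1ℚ ≤ a → 1ℚ ≤ powℚ a k
  pow-≥1 {a} k 1≤a = subst (_≤ powℚ a k) (pow-1 k) (pow-mono k 0≤1 1≤a)

  pow-anti : ∀ {a j k} → 0ℚ ≤ a → a ≤ 1ℚ → j ℕ.≤ k → powℚ a k ≤ powℚ a j
  pow-anti {a} {j} {k} 0≤a a≤1 j≤k = subst (λ m → powℚ a m ≤ powℚ a j) (ℕ.m+[n∸m]≡n j≤k)
    (subst₂ _≤_ (sym (pow-+ a j (k ℕ.∸ j))) (ℚ.*-identityʳ _) (*-monoˡ-≤ (pow-≥0 j 0≤a) (pow-≤1 (k ℕ.∸ j) 0≤a a≤1)))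

  pow-grow : ∀ {a j k} → 1ℚ ≤ a → j ℕ.≤ k → powℚ a j ≤ powℚ a k
  pow-grow {a} {j} {k} 1≤a j≤k = subst (λ m → powℚ a j ≤ powℚ a m) (ℕ.m+[n∸m]≡n j≤k)
    (subst₂ _≤_ (ℚ.*-identityʳ _) (sym (pow-+ a j (k ℕ.∸ j))) (*-monoˡ-≤ (pow-≥0 j (ℚ.≤-trans 0≤1 1≤a)) (pow-≥1 (k ℕ.∸ j) 1≤a)))

  ι-^ : ∀ n k → ι (n ℕ.^ k) ≡ powℚ (ι n) k
  ι-^ n zero    = ι-1
  ι-^ n (suc k) = trans (ι-* n (n ℕ.^ k)) (cong (ι n *_) (ι-^ n k))

  inv-*ʳ : ∀ {q} → 0ℚ < q → q * invℚ q ≡ 1ℚ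
  inv-*ʳ {q} 0<q with q ℚ.≟ 0ℚ
  ... | yes q≡0 = ⊥-elim (ℚ.<⇒≢ 0<q (sym q≡0))
  ... | no q≢0  = ℚ.*-inverseʳ q {{ℚ.≢-nonZero q≢0}}

  inv-≥0 : ∀ {q} → 0ℚ < q → 0ℚ ≤ invℚ q
  inv-≥0 {q} 0<q = *-cancelʳ-≤ 0<q (subst₂ _≤_ (sym (ℚ.*-zeroˡ q)) (sym (trans (ℚ.*-comm (invℚ q) q) (inv-*ʳ 0<q))) 0≤1)

  inv->0 : ∀ {q} → 0ℚ < q → 0ℚ < invℚ q
  inv->0 {q} 0<q with ℚ.<-cmp 0ℚ (invℚ q)
  ... | tri< h _ _ = h
  ... | tri≈ _ h _ = ⊥-elim (ℚ.<⇒≢ 0<1 (trans (sym (ℚ.*-zeroʳ q)) (trans (cong (q *_) h) (inv-*ʳ 0<q))))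
  ... | tri> _ _ h = ⊥-elim (ℚ.<-irrefl refl (ℚ.<-≤-trans h (inv-≥0 0<q)))

  ≤*inv : ∀ {a b c} → 0ℚ < c → a * c ≤ b → a ≤ b * invℚ c
  ≤*inv {a} {b} {c} 0<c h = *-cancelʳ-≤ 0<c (subst (a * c ≤_) (sym (trans (eq b (invℚ c) c) (trans (cong (b *_) (inv-*ʳ 0<c)) (ℚ.*-identityʳ b)))) h)
    where
    eq : ∀ b i c → b * i * c ≡ b * (c * i)
    eq = solve-∀ ring

  *inv≤ : ∀ {a b c} → 0ℚ < c → b ≤ a * c → b * invℚ c ≤ a
  *inv≤ {a} {b} {c} 0<c h = *-cancelʳ-≤ 0<c (subst (_≤ a * c) (sym (trans (eq b (invℚ c) c) (trans (cong (b *_) (inv-*ʳ 0<c)) (ℚ.*-identityʳ b)))) h)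
    where
    eq : ∀ b i c → b * i * c ≡ b * (c * i)
    eq = solve-∀ ring

  ≤∣∣ : ∀ a → a ≤ ∣ a ∣
  ≤∣∣ a with ℚ.≤-total 0ℚ a
  ... | inj₁ 0≤a = ℚ.≤-reflexive (sym (ℚ.0≤p⇒∣p∣≡p 0≤a))
  ... | inj₂ a≤0 = ℚ.≤-trans a≤0 (ℚ.0≤∣p∣ a)

  -≤∣∣ : ∀ a → - a ≤ ∣ a ∣
  -≤∣∣ a = subst (- a ≤_) (ℚ.∣-p∣≡∣p∣ a) (≤∣∣ (- a))

  ∣∣≤ : ∀ {a b} → a ≤ b → - a ≤ b → ∣ a ∣ ≤ b
  ∣∣≤ {a} {b} h₁ h₂ with ℚ.∣p∣≡p∨∣p∣≡-p a
  ... | inj₁ eq = subst (_≤ b) (sym eq) h₁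
  ... | inj₂ eq = subst (_≤ b) (sym eq) h₂

  ∣-∣-sym : ∀ a b → ∣ a - b ∣ ≡ ∣ b - a ∣
  ∣-∣-sym a b = trans (sym (ℚ.∣-p∣≡∣p∣ (a - b))) (cong ∣_∣ (eq a b))
    where
    eq : ∀ a b → - (a - b) ≡ b - a
    eq = solve-∀ ring

  ∣-∣-triangle : ∀ a b c → ∣ a - c ∣ ≤ ∣ a - b ∣ + ∣ b - c ∣
  ∣-∣-triangle a b c = subst (λ t → ∣ t ∣ ≤ ∣ a - b ∣ + ∣ b - c ∣) (eq a b c) (ℚ.∣p+q∣≤∣p∣+∣q∣ (a - b) (b - c))
    where
    eq : ∀ a b c → (a - b) + (b - c) ≡ a - c
    eq = solve-∀ ring

  ∣pow∣ : ∀ a k → ∣ powℚ a k ∣ ≡ powℚ ∣ a ∣ k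
  ∣pow∣ a zero    = refl
  ∣pow∣ a (suc k) = trans (ℚ.∣p*q∣≡∣p∣*∣q∣ a (powℚ a k)) (cong (∣ a ∣ *_) (∣pow∣ a k))

-- Expectations over finite probability spaces

module Averages where
  open import Data.Rational using (ℚ; 0ℚ; 1ℚ; ½; _+_; _*_; _-_; -_; _≤_; _<_; ∣_∣; _⊓_)
  open Rationals

  private variable
    A B : Set

  ind : Bool → ℚ
  ind true  = 1ℚ
  ind false = 0ℚ

  0≤ind : ∀ b → 0ℚ ≤ ind b
  0≤ind true  = 0≤1
  0≤ind false = ℚ.≤-refl

  ind≤1 : ∀ b → ind b ≤ 1ℚ
  ind≤1 true  = ℚ.≤-refl
  ind≤1 false = 0≤1

  ind-∧ : ∀ a b → ind (a ∧ b) ≡ ind a * ind b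
  ind-∧ true  b = sym (ℚ.*-identityˡ (ind b))
  ind-∧ false b = sym (ℚ.*-zeroˡ (ind b))

  ind-xor-triangle : ∀ a b c → ind (a xor c) ≤ ind (a xor b) + ind (b xor c)
  ind-xor-triangle true  true  true  = ℚ.≤-refl
  ind-xor-triangle true  true  false = ℚ.≤-refl
  ind-xor-triangle true  false true  = ℚ.<⇒≤ (ℚ.positive⁻¹ _)
  ind-xor-triangle true  false false = ℚ.≤-refl
  ind-xor-triangle false true  true  = ℚ.≤-refl
  ind-xor-triangle false true  false = ℚ.<⇒≤ (ℚ.positive⁻¹ _)
  ind-xor-triangle false false true  = ℚ.≤-refl
  ind-xor-triangle false false false = ℚ.≤-refl

  ΣL : (A → ℚ) → List A → ℚ
  ΣL f []  = 0ℚ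
  ΣL f (x ∷ xs) = f x + ΣL f xs

  ΣL-cong : ∀ {f g : A → ℚ} → (∀ x → f x ≡ g x) → ∀ xs → ΣL f xs ≡ ΣL g xs
  ΣL-cong h []  = refl
  ΣL-cong h (x ∷ xs) = cong₂ _+_ (h x) (ΣL-cong h xs)

  ΣL-mono : ∀ {f g : A → ℚ} → (∀ x → f x ≤ g x) → ∀ xs → ΣL f xs ≤ ΣL g xs
  ΣL-mono h []  = ℚ.≤-refl
  ΣL-mono h (x ∷ xs) = ℚ.+-mono-≤ (h x) (ΣL-mono h xs)

  ΣL-+ : ∀ (f g : A → ℚ) xs → ΣL (λ x → f x + g x) xs ≡ ΣL f xs + ΣL g xs
  ΣL-+ f g []  = refl
  ΣL-+ f g (x ∷ xs) = trans (cong (f x + g x +_) (ΣL-+ f g xs)) (eq (f x) (g x) (ΣL f xs) (ΣL g xs))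
    where
    eq : ∀ a b c d → a + b + (c + d) ≡ a + c + (b + d)
    eq = solve-∀ ring

  ΣL-*ˡ : ∀ c (f : A → ℚ) xs → ΣL (λ x → c * f x) xs ≡ c * ΣL f xs
  ΣL-*ˡ c f []  = sym (ℚ.*-zeroʳ c)
  ΣL-*ˡ c f (x ∷ xs) = trans (cong (c * f x +_) (ΣL-*ˡ c f xs)) (sym (ℚ.*-distribˡ-+ c (f x) (ΣL f xs)))

  ΣL-const : ∀ c (xs : List A) → ΣL (λ _ → c) xs ≡ ι (length xs) * c
  ΣL-const c []  = sym (trans (cong (_* c) ι-0) (ℚ.*-zeroˡ c))
  ΣL-const c (x ∷ xs) = trans (cong (c +_) (ΣL-const c xs)) (sym (trans (cong (_* c) (ι-suc (length xs))) (eq c (ι (length xs)))))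
    where
    eq : ∀ c l → (1ℚ + l) * c ≡ c + l * c
    eq = solve-∀ ring

  ΣL-≥0 : ∀ {f : A → ℚ} → (∀ x → 0ℚ ≤ f x) → ∀ xs → 0ℚ ≤ ΣL f xs
  ΣL-≥0 h []  = ℚ.≤-refl
  ΣL-≥0 h (x ∷ xs) = 0≤+ (h x) (ΣL-≥0 h xs)

  ΣL-swap : ∀ (f : A → B → ℚ) xs ys → ΣL (λ x → ΣL (f x) ys) xs ≡ ΣL (λ y → ΣL (λ x → f x y) xs) ys
  ΣL-swap f []  ys = sym (trans (ΣL-const 0ℚ ys) (ℚ.*-zeroʳ (ι (length ys))))
  ΣL-swap f (x ∷ xs) ys = trans (cong (ΣL (f x) ys +_) (ΣL-swap f xs ys)) (sym (ΣL-+ (f x) (λ y → ΣL (λ x → f x y) xs) ys))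

  ΣL-ind : ∀ (p : A → Bool) xs → ΣL (λ x → ind (p x)) xs ≡ ι (length (filterᵇ p xs))
  ΣL-ind p []  = sym ι-0
  ΣL-ind p (x ∷ xs) with p x
  ... | true  = trans (cong (1ℚ +_) (ΣL-ind p xs)) (sym (ι-suc (length (filterᵇ p xs))))
  ... | false = trans (ℚ.+-identityˡ _) (ΣL-ind p xs)

  -- An expectation given by its properties instead of a sum, so that products, images and subcubes
  -- need no counting. `pick` is the probabilistic method: some outcome is no worse than the mean.
  record Average (A : Set) : Set where
    field
      avg   : (A → ℚ) → ℚ
      mono  : ∀ {f g} → (∀ x → f x ≤ g x) → avg f ≤ avg g
      add   : ∀ f g → avg (λ x → f x + g x) ≡ avg f + avg g
      scale : ∀ c f → avg (λ x → c * f x) ≡ c * avg f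
      const : ∀ c → avg (λ _ → c) ≡ c
      pick  : ∀ f → ∃ λ x → f x ≤ avg f

    avg-cong : ∀ {f g} → (∀ x → f x ≡ g x) → avg f ≡ avg g
    avg-cong h = ℚ.≤-antisym (mono (ℚ.≤-reflexive ∘ h)) (mono (ℚ.≤-reflexive ∘ sym ∘ h))

    avg-≥0 : ∀ {f} → (∀ x → 0ℚ ≤ f x) → 0ℚ ≤ avg f
    avg-≥0 {f} h = subst (_≤ avg f) (const 0ℚ) (mono h)

    avg-≤1 : ∀ {f} → (∀ x → f x ≤ 1ℚ) → avg f ≤ 1ℚ
    avg-≤1 {f} h = subst (avg f ≤_) (const 1ℚ) (mono h)

    avg-ΣL : ∀ (f : A → B → ℚ) xs → avg (λ a → ΣL (f a) xs) ≡ ΣL (λ b → avg (λ a → f a b)) xs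
    avg-ΣL f []  = const 0ℚ
    avg-ΣL f (x ∷ xs) = trans (add (λ a → f a x) (λ a → ΣL (f a) xs)) (cong (avg (λ a → f a x) +_) (avg-ΣL f xs))

  open Average

  product : Average A → Average B → Average (A × B)
  product 𝒜 ℬ = record
    { avg   = λ f → avg 𝒜 (λ a → avg ℬ (λ b → f (a , b)))
    ; mono  = λ h → mono 𝒜 (λ a → mono ℬ (λ b → h (a , b)))
    ; add   = λ f g → trans (avg-cong 𝒜 (λ a → add ℬ _ _)) (add 𝒜 _ _)
    ; scale = λ c f → trans (avg-cong 𝒜 (λ a → scale ℬ c _)) (scale 𝒜 c _)
    ; const = λ c → trans (avg-cong 𝒜 (λ a → const ℬ c)) (const 𝒜 c)
    ; pick  = λ f → let (a , pa) = pick 𝒜 _ ; (b , pb) = pick ℬ _ in (a , b) , ℚ.≤-trans pb pa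
    }

  point : ∀ {A : Set} → A → Average A
  point a = record
    { avg   = λ f → f a
    ; mono  = λ h → h a
    ; add   = λ f g → refl
    ; scale = λ c f → refl
    ; const = λ c → refl
    ; pick  = λ f → a , ℚ.≤-refl
    }

  transport : (A → B) → Average A → Average B
  transport h 𝒜 = record
    { avg   = λ f → avg 𝒜 (f ∘ h)
    ; mono  = λ k → mono 𝒜 (k ∘ h)
    ; add   = λ f g → add 𝒜 (f ∘ h) (g ∘ h)
    ; scale = λ c f → scale 𝒜 c (f ∘ h)
    ; const = const 𝒜
    ; pick  = λ f → let (a , p) = pick 𝒜 (f ∘ h) in h a , p
    }

  vec : Average A → ∀ n → Average (Vec A n)
  vec 𝒜 zero    = point []
  vec 𝒜 (suc n) = transport (λ (a , v) → a ∷ v) (product 𝒜 (vec 𝒜 n))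

  avg-factor : ∀ (𝒜 : Average A) (ℬ : Average B) f g →
               avg (product 𝒜 ℬ) (λ (a , b) → f a * g b) ≡ avg 𝒜 f * avg ℬ g
  avg-factor 𝒜 ℬ f g = trans (avg-cong 𝒜 (λ a → trans (scale ℬ (f a) g) (ℚ.*-comm (f a) _))) (trans (scale 𝒜 (avg ℬ g) f) (ℚ.*-comm (avg ℬ g) (avg 𝒜 f)))

  ½-split : ∀ a → ½ * (a + a) ≡ a
  ½-split = solve-∀ ring

  bit : Average Bool
  bit = record
    { avg   = λ f → ½ * (f false + f true)
    ; mono  = λ h → *-monoˡ-≤ 0≤½ (ℚ.+-mono-≤ (h false) (h true))
    ; add   = λ f g → eq₁ (f false) (f true) (g false) (g true)
    ; scale = λ c f → eq₂ c (f false) (f true)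
    ; const = ½-split
    ; pick  = λ f → lemma (f false) (f true) f refl refl
    }
    where
    eq₁ : ∀ a b c d → ½ * (a + c + (b + d)) ≡ ½ * (a + b) + ½ * (c + d)
    eq₁ = solve-∀ ring
    eq₂ : ∀ c a b → ½ * (c * a + c * b) ≡ c * (½ * (a + b))
    eq₂ = solve-∀ ring
    lemma : ∀ a b (f : Bool → ℚ) → f false ≡ a → f true ≡ b → ∃ λ x → f x ≤ ½ * (f false + f true)
    lemma a b f refl refl with ℚ.≤-total a b
    ... | inj₁ a≤b = false , subst (_≤ ½ * (a + b)) (½-split a) (*-monoˡ-≤ 0≤½ (ℚ.+-monoʳ-≤ a a≤b))
    ... | inj₂ b≤a = true  , subst (_≤ ½ * (a + b)) (½-split b) (*-monoˡ-≤ 0≤½ (ℚ.+-monoˡ-≤ b b≤a))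

  cube : ∀ n → Average (Vec Bool n)
  cube = vec bit

  ΣF : ∀ {r} → (Fin r → ℚ) → ℚ
  ΣF {zero}  f = 0ℚ
  ΣF {suc r} f = f zero + ΣF (f ∘ suc)

  ΣF-mono : ∀ {r} {f g : Fin r → ℚ} → (∀ x → f x ≤ g x) → ΣF f ≤ ΣF g
  ΣF-mono {zero}  h = ℚ.≤-refl
  ΣF-mono {suc r} h = ℚ.+-mono-≤ (h zero) (ΣF-mono (h ∘ suc))

  ΣF-+ : ∀ {r} (f g : Fin r → ℚ) → ΣF (λ x → f x + g x) ≡ ΣF f + ΣF g
  ΣF-+ {zero}  f g = refl
  ΣF-+ {suc r} f g = trans (cong (f zero + g zero +_) (ΣF-+ (f ∘ suc) (g ∘ suc))) (eq (f zero) (g zero) (ΣF (f ∘ suc)) (ΣF (g ∘ suc)))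
    where
    eq : ∀ a b c d → a + b + (c + d) ≡ a + c + (b + d)
    eq = solve-∀ ring

  ΣF-*ˡ : ∀ {r} c (f : Fin r → ℚ) → ΣF (λ x → c * f x) ≡ c * ΣF f
  ΣF-*ˡ {zero}  c f = sym (ℚ.*-zeroʳ c)
  ΣF-*ˡ {suc r} c f = trans (cong (c * f zero +_) (ΣF-*ˡ c (f ∘ suc))) (sym (ℚ.*-distribˡ-+ c (f zero) (ΣF (f ∘ suc))))

  ΣF-const : ∀ {r} c → ΣF {r} (λ _ → c) ≡ ι r * c
  ΣF-const {zero}  c = sym (trans (cong (_* c) ι-0) (ℚ.*-zeroˡ c))
  ΣF-const {suc r} c = trans (cong (c +_) (ΣF-const {r} c)) (sym (trans (cong (_* c) (ι-suc r)) (eq c (ι r))))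
    where
    eq : ∀ c l → (1ℚ + l) * c ≡ c + l * c
    eq = solve-∀ ring

  -- If the first value exceeds `a`, removing it leaves values whose mean is still at most `a`.
  ΣF-pick : ∀ {r} a (f : Fin (suc r) → ℚ) → ΣF f ≤ ι (suc r) * a → ∃ λ x → f x ≤ a
  ΣF-pick {zero}  a f h = zero , subst₂ _≤_ (ℚ.+-identityʳ (f zero)) (trans (cong (_* a) ι-1) (ℚ.*-identityˡ a)) h
  ΣF-pick {suc r} a f h with f zero ℚ.≤? a
  ... | yes f₀≤a = zero , f₀≤a
  ... | no  f₀≰a = let (x , p) = ΣF-pick a (f ∘ suc) rest in suc x , p
    where
    s : ℚ
    s = ΣF (f ∘ suc)
    eq : ∀ x a s l → l * a - s ≡ ((1ℚ + l) * a - (x + s)) + (x - a)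
    eq = solve-∀ ring
    rest : s ≤ ι (suc r) * a
    rest = ≤-by (0≤+ (≤⇒0≤- (subst (λ t → f zero + s ≤ t * a) (ι-suc (suc r)) h)) (≤⇒0≤- (ℚ.<⇒≤ (ℚ.≰⇒> f₀≰a))))
                (eq (f zero) a s (ι (suc r)))

  module _ (r : ℕ) where
    1/colours : ℚ
    1/colours = invℚ (ι (suc r))

    1/colours-inv : ι (suc r) * 1/colours ≡ 1ℚ
    1/colours-inv = inv-*ʳ (0<ι (suc r))

    0≤1/colours : 0ℚ ≤ 1/colours
    0≤1/colours = inv-≥0 (0<ι (suc r))

    colour : Average (Fin (suc r))
    colour = record
      { avg   = λ f → 1/colours * ΣF f
      ; mono  = λ h → *-monoˡ-≤ 0≤1/colours (ΣF-mono h)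
      ; add   = λ f g → trans (cong (1/colours *_) (ΣF-+ f g)) (ℚ.*-distribˡ-+ 1/colours (ΣF f) (ΣF g))
      ; scale = λ c f → trans (cong (1/colours *_) (ΣF-*ˡ c f)) (comm c 1/colours (ΣF f))
      ; const = λ c → trans (cong (1/colours *_) (ΣF-const c)) (cancel c)
      ; pick  = λ f → ΣF-pick (1/colours * ΣF f) f (ℚ.≤-reflexive (sym (cancel′ (ΣF f))))
      }
      where
      comm : ∀ c i x → i * (c * x) ≡ c * (i * x)
      comm = solve-∀ ring
      assoc : ∀ c l i → i * (l * c) ≡ (l * i) * c
      assoc = solve-∀ ring
      assoc′ : ∀ c l i → l * (i * c) ≡ (l * i) * c
      assoc′ = solve-∀ ring
      cancel : ∀ c → 1/colours * (ι (suc r) * c) ≡ c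
      cancel c = trans (assoc c (ι (suc r)) 1/colours) (trans (cong (_* c) 1/colours-inv) (ℚ.*-identityˡ c))
      cancel′ : ∀ c → ι (suc r) * (1/colours * c) ≡ c
      cancel′ c = trans (assoc′ c (ι (suc r)) 1/colours) (trans (cong (_* c) 1/colours-inv) (ℚ.*-identityˡ c))

  ΣF-hit : ∀ {r} (j : Fin r) c → ΣF (λ i → if does (i Fin.≟ j) then c else 0ℚ) ≡ c
  ΣF-hit {suc r} zero    c = trans (cong (c +_) (trans (ΣF-const {r} 0ℚ) (ℚ.*-zeroʳ (ι r)))) (ℚ.+-identityʳ c)
  ΣF-hit {suc r} (suc j) c = trans (ℚ.+-identityˡ _) (ΣF-hit j c)

-- First and second moments of randomly coloured terms

module SecondMoment where
  open import Data.Rational using (ℚ; 0ℚ; 1ℚ; ½; _+_; _*_; _-_; -_; _≤_; _<_; ∣_∣; _⊓_)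
  open Rationals
  open Averages
  open Average

  -- A term without contradictory or repeated literals.
  PTerm : ℕ → Set
  PTerm n = Vec (Maybe Bool) n

  size : ∀ {n} → PTerm n → ℕ
  size []  = 0
  size (nothing ∷ T) = size T
  size (just _ ∷ T)  = suc (size T)

  agree : Bool → Bool → Bool
  agree false b = not b
  agree true  b = b

  sat : ∀ {n} → PTerm n → Vec Bool n → Bool
  sat []  []  = true
  sat (nothing ∷ T) (_ ∷ x) = sat T x
  sat (just a ∷ T)  (b ∷ x) = agree a b ∧ sat T x

  within : Maybe Bool → Maybe Bool → Bool
  within nothing  _  = true
  within (just a) nothing  = false
  within (just a) (just b) = agree a b

  infix 4 _⊆ᵇ_
  _⊆ᵇ_ : ∀ {n} → PTerm n → PTerm n → Bool
  []  ⊆ᵇ []  = true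
  (s ∷ S) ⊆ᵇ (t ∷ T) = within s t ∧ (S ⊆ᵇ T)

  -- A sum over all sub-terms of `T`: every literal is either dropped or kept.
  ΣZ : ∀ {n} → PTerm n → (PTerm n → ℚ) → ℚ
  ΣZ []  f = f []
  ΣZ (nothing ∷ T) f = ΣZ T (f ∘ (nothing ∷_))
  ΣZ (just a ∷ T)  f = ΣZ T (f ∘ (nothing ∷_)) + ΣZ T (f ∘ (just a ∷_))

  ΣZ-mono : ∀ {n} (T : PTerm n) {f g} → (∀ Z → f Z ≤ g Z) → ΣZ T f ≤ ΣZ T g
  ΣZ-mono []  h = h []
  ΣZ-mono (nothing ∷ T) h = ΣZ-mono T (h ∘ (nothing ∷_))
  ΣZ-mono (just a ∷ T)  h = ℚ.+-mono-≤ (ΣZ-mono T (h ∘ (nothing ∷_))) (ΣZ-mono T (h ∘ (just a ∷_)))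

  ΣZ-cong : ∀ {n} (T : PTerm n) {f g} → (∀ Z → f Z ≡ g Z) → ΣZ T f ≡ ΣZ T g
  ΣZ-cong T h = ℚ.≤-antisym (ΣZ-mono T (ℚ.≤-reflexive ∘ h)) (ΣZ-mono T (ℚ.≤-reflexive ∘ sym ∘ h))

  ΣZ-*ˡ : ∀ {n} (T : PTerm n) c f → ΣZ T (λ Z → c * f Z) ≡ c * ΣZ T f
  ΣZ-*ˡ []  c f = refl
  ΣZ-*ˡ (nothing ∷ T) c f = ΣZ-*ˡ T c (f ∘ (nothing ∷_))
  ΣZ-*ˡ (just a ∷ T)  c f = trans (cong₂ _+_ (ΣZ-*ˡ T c (f ∘ (nothing ∷_))) (ΣZ-*ˡ T c (f ∘ (just a ∷_)))) (sym (ℚ.*-distribˡ-+ c _ _))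

  ΣZ-≥0 : ∀ {n} (T : PTerm n) {f} → (∀ Z → 0ℚ ≤ f Z) → 0ℚ ≤ ΣZ T f
  ΣZ-≥0 []  h = h []
  ΣZ-≥0 (nothing ∷ T) h = ΣZ-≥0 T (h ∘ (nothing ∷_))
  ΣZ-≥0 (just a ∷ T)  h = 0≤+ (ΣZ-≥0 T (h ∘ (nothing ∷_))) (ΣZ-≥0 T (h ∘ (just a ∷_)))

  ΣL-ΣZ : ∀ {n} {A : Set} (T : PTerm n) (f : A → PTerm n → ℚ) xs →
          ΣL (λ x → ΣZ T (f x)) xs ≡ ΣZ T (λ Z → ΣL (λ x → f x Z) xs)
  ΣL-ΣZ []  f xs = refl
  ΣL-ΣZ (nothing ∷ T) f xs = ΣL-ΣZ T (λ x → f x ∘ (nothing ∷_)) xs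
  ΣL-ΣZ (just a ∷ T)  f xs = trans (ΣL-+ _ _ xs) (cong₂ _+_ (ΣL-ΣZ T (λ x → f x ∘ (nothing ∷_)) xs) (ΣL-ΣZ T (λ x → f x ∘ (just a ∷_)) xs))

  -- The binomial theorem: a dropped literal contributes 1 and a kept one contributes `y`.
  ΣZ-pow : ∀ {n} (T : PTerm n) y → ΣZ T (λ Z → powℚ y (size Z)) ≡ powℚ (1ℚ + y) (size T)
  ΣZ-pow []  y = refl
  ΣZ-pow (nothing ∷ T) y = ΣZ-pow T y
  ΣZ-pow (just a ∷ T)  y =
    trans (cong₂ _+_ (ΣZ-pow T y) (trans (ΣZ-*ˡ T y (λ Z → powℚ y (size Z))) (cong (y *_) (ΣZ-pow T y))))
          (eq y (powℚ (1ℚ + y) (size T)))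
    where
    eq : ∀ y p → p + y * p ≡ (1ℚ + y) * p
    eq = solve-∀ ring

  Mask : ℕ → Set
  Mask n = Vec Bool n

  -- All variables of the term have to lie in the mask. The value then depends on the masked bits
  -- alone, which makes the events of different colour classes independent.
  satIn : ∀ {n} → PTerm n → Mask n → Vec Bool n → Bool
  satIn []  []  []  = true
  satIn (nothing ∷ T) (_ ∷ S) (_ ∷ x) = satIn T S x
  satIn (just a ∷ T)  (s ∷ S) (b ∷ x) = (s ∧ agree a b) ∧ satIn T S x

  module Moments (r : ℕ) where

    -- 1 / base is the probability that a literal is satisfied and its variable has a given colour.
    base : ℚ
    base = ι (suc r) + ι (suc r)

    0≤base : 0ℚ ≤ base
    0≤base = 0≤+ (0≤ι (suc r)) (0≤ι (suc r))

    -- Normalised to mean 1 over a random colour and bit. Hence `mass` is the inverse of the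
    -- probability of `satIn` on that event and 0 off it, so a sum of masses has the number of terms
    -- as its mean.
    factor : Maybe Bool → Bool → Bool → ℚ
    factor nothing  s b = 1ℚ
    factor (just a) s b = base * ind (s ∧ agree a b)

    0≤factor : ∀ t s b → 0ℚ ≤ factor t s b
    0≤factor nothing  s b = 0≤1
    0≤factor (just a) s b = 0≤* 0≤base (0≤ind (s ∧ agree a b))

    mass : ∀ {n} → PTerm n → Mask n → Vec Bool n → ℚ
    mass []  []  []  = 1ℚ
    mass (t ∷ T) (s ∷ S) (b ∷ x) = factor t s b * mass T S x

    0≤mass : ∀ {n} (T : PTerm n) S x → 0ℚ ≤ mass T S x
    0≤mass []  []  []  = 0≤1
    0≤mass (t ∷ T) (s ∷ S) (b ∷ x) = 0≤* (0≤factor t s b) (0≤mass T S x)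

    mass-unsat : ∀ {n} (T : PTerm n) S x → satIn T S x ≡ false → mass T S x ≡ 0ℚ
    mass-unsat []  []  []  ()
    mass-unsat (nothing ∷ T) (s ∷ S) (b ∷ x) h = trans (ℚ.*-identityˡ _) (mass-unsat T S x h)
    mass-unsat (just a ∷ T)  (s ∷ S) (b ∷ x) h with s ∧ agree a b
    ... | true  = trans (cong (base * 1ℚ *_) (mass-unsat T S x h)) (ℚ.*-zeroʳ (base * 1ℚ))
    ... | false = trans (cong (_* mass T S x) (ℚ.*-zeroʳ base)) (ℚ.*-zeroˡ (mass T S x))

    colouring : ∀ n → Average (Vec (Fin (suc r)) n)
    colouring = vec (colour r)

    mask : ∀ {n} → Fin (suc r) → Vec (Fin (suc r)) n → Mask n
    mask j = Vec.map (λ c → does (c Fin.≟ j))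

    joint : ∀ n → Average (Vec (Fin (suc r)) n × Vec Bool n)
    joint n = product (colouring n) (cube n)

    coordinate : Average (Fin (suc r) × Bool)
    coordinate = product (colour r) bit

    -- All colours are averaged outside all bits, so a product over coordinates has to be regrouped
    -- into pairs of a colour and a bit; independence, used inside and then outside, does this.
    joint-factor : ∀ {n} (f : Fin (suc r) → Bool → ℚ) (g : Vec (Fin (suc r)) n → Vec Bool n → ℚ) →
                   avg (colouring (suc n)) (λ { (c ∷ P) → avg (cube (suc n)) (λ { (b ∷ x) → f c b * g P x }) }) ≡
                   avg coordinate (λ (c , b) → f c b) * avg (joint n) (λ (P , x) → g P x)
    joint-factor {n} f g = trans
      (avg-cong (colour r) (λ c → avg-cong (colouring n) (λ P → avg-factor bit (cube n) (f c) (g P))))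
      (avg-factor (colour r) (colouring n) (λ c → avg bit (f c)) (λ P → avg (cube n) (g P)))

    colour-hit : ∀ j a → avg (colour r) (λ c → a * ind (does (c Fin.≟ j))) ≡ 1/colours r * a
    colour-hit j a = cong (1/colours r *_) (trans (ΣF-cong (λ c → ind-if (does (c Fin.≟ j)))) (ΣF-hit j a))
      where
      ind-if : ∀ b → a * ind b ≡ (if b then a else 0ℚ)
      ind-if true  = ℚ.*-identityʳ a
      ind-if false = ℚ.*-zeroʳ a
      ΣF-cong : ∀ {r} {f g : Fin r → ℚ} → (∀ x → f x ≡ g x) → ΣF f ≡ ΣF g
      ΣF-cong h = ℚ.≤-antisym (ΣF-mono (ℚ.≤-reflexive ∘ h)) (ΣF-mono (ℚ.≤-reflexive ∘ sym ∘ h))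

    half-base : 1/colours r * (½ * base) ≡ 1ℚ
    half-base = trans (eq (1/colours r) (ι (suc r))) (1/colours-inv r)
      where
      eq : ∀ i l → i * (½ * (l + l)) ≡ l * i
      eq = solve-∀ ring

    avg-agree : ∀ a → ½ * (ind (agree a false) + ind (agree a true)) ≡ ½
    avg-agree true  = refl
    avg-agree false = refl

    mean₁ : ∀ j t → avg coordinate (λ (c , b) → factor t (does (c Fin.≟ j)) b) ≡ 1ℚ
    mean₁ j nothing  = const coordinate 1ℚ
    mean₁ j (just a) = trans (avg-cong (colour r) λ c → inner (does (c Fin.≟ j))) (trans (colour-hit j (½ * base)) half-base)
      where
      eq : ∀ B s x y → ½ * (B * (s * x) + B * (s * y)) ≡ B * s * (½ * (x + y))
      eq = solve-∀ ring
      eq′ : ∀ B s → B * s * ½ ≡ ½ * B * s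
      eq′ = solve-∀ ring
      inner : ∀ s → avg bit (factor (just a) s) ≡ ½ * base * ind s
      inner s = trans (cong₂ (λ u v → ½ * (base * u + base * v)) (ind-∧ s (agree a false)) (ind-∧ s (agree a true)))
               (trans (eq base (ind s) (ind (agree a false)) (ind (agree a true)))
               (trans (cong (base * ind s *_) (avg-agree a)) (eq′ base (ind s))))

    -- A bound on the mixed moment of one coordinate. Opposite literals have mixed moment 0; taking
    -- 1 for them makes `common` a pure power of `base`, with the number of shared literals as
    -- exponent.
    common₁ : Maybe Bool → Maybe Bool → ℚ
    common₁ (just a) (just b) = if agree a b then base else 1ℚ
    common₁ _  _  = 1ℚ

    0≤common₁ : ∀ t u → 0ℚ ≤ common₁ t u
    0≤common₁ nothing  nothing  = 0≤1
    0≤common₁ nothing  (just _) = 0≤1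
    0≤common₁ (just _) nothing  = 0≤1
    0≤common₁ (just a) (just b) with agree a b
    ... | true  = 0≤base
    ... | false = 0≤1

    common : ∀ {n} → PTerm n → PTerm n → ℚ
    common []  []  = 1ℚ
    common (t ∷ T) (u ∷ U) = common₁ t u * common T U

    0≤common : ∀ {n} (T U : PTerm n) → 0ℚ ≤ common T U
    0≤common []  []  = 0≤1
    0≤common (t ∷ T) (u ∷ U) = 0≤* (0≤common₁ t u) (0≤common T U)

    -- Two literals of one variable hold together only if they are the same literal, and then the
    -- indicator is idempotent.
    agree-prod : ∀ a a′ s b → ind (s ∧ agree a b) * ind (s ∧ agree a′ b) ≡ ind (agree a a′) * ind (s ∧ agree a b)
    agree-prod true  true  true  true  = refl
    agree-prod true  true  true  false = refl
    agree-prod true  false true  true  = refl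
    agree-prod true  false true  false = refl
    agree-prod false true  true  true  = refl
    agree-prod false true  true  false = refl
    agree-prod false false true  true  = refl
    agree-prod false false true  false = refl
    agree-prod true  true  false b  = refl
    agree-prod true  false false b  = refl
    agree-prod false true  false b  = refl
    agree-prod false false false b  = refl

    mean₂ : ∀ j t u → avg coordinate (λ (c , b) → factor t (does (c Fin.≟ j)) b * factor u (does (c Fin.≟ j)) b) ≤ common₁ t u
    mean₂ j nothing  nothing  = ℚ.≤-reflexive (const coordinate 1ℚ)
    mean₂ j nothing  (just a) = ℚ.≤-reflexive (trans (avg-cong coordinate {g = λ (c , b) → factor (just a) (does (c Fin.≟ j)) b} (λ (c , b) → ℚ.*-identityˡ _)) (mean₁ j (just a)))
    mean₂ j (just a) nothing  = ℚ.≤-reflexive (trans (avg-cong coordinate {g = λ (c , b) → factor (just a) (does (c Fin.≟ j)) b} (λ (c , b) → ℚ.*-identityʳ _)) (mean₁ j (just a)))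
    mean₂ j (just a) (just a′) = ℚ.≤-trans (ℚ.≤-reflexive step) (bound (agree a a′))
      where
      eq : ∀ B x y → B * x * (B * y) ≡ B * B * (x * y)
      eq = solve-∀ ring
      eq′ : ∀ B p x → B * B * (p * x) ≡ B * p * (B * x)
      eq′ = solve-∀ ring
      step : avg coordinate (λ (c , b) → factor (just a) (does (c Fin.≟ j)) b * factor (just a′) (does (c Fin.≟ j)) b)
             ≡ base * ind (agree a a′)
      step = trans (avg-cong coordinate λ (c , b) → let s = does (c Fin.≟ j) in
                trans (eq base (ind (s ∧ agree a b)) (ind (s ∧ agree a′ b)))
               (trans (cong (base * base *_) (agree-prod a a′ s b)) (eq′ base (ind (agree a a′)) (ind (s ∧ agree a b)))))
            (trans (scale coordinate (base * ind (agree a a′)) (λ (c , b) → factor (just a) (does (c Fin.≟ j)) b))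
            (trans (cong (base * ind (agree a a′) *_) (mean₁ j (just a))) (ℚ.*-identityʳ _)))
      bound : ∀ p → base * ind p ≤ (if p then base else 1ℚ)
      bound true  = ℚ.≤-reflexive (ℚ.*-identityʳ base)
      bound false = subst (_≤ 1ℚ) (sym (ℚ.*-zeroʳ base)) 0≤1

    moment₁ : ∀ {n} j (T : PTerm n) → avg (joint n) (λ (P , x) → mass T (mask j P) x) ≡ 1ℚ
    moment₁ j []  = refl
    moment₁ {suc n} j (t ∷ T) = trans (joint-factor (λ c b → factor t (does (c Fin.≟ j)) b) (λ P x → mass T (mask j P) x))
      (cong₂ _*_ (mean₁ j t) (moment₁ j T))

    moment₂ : ∀ {n} j (T U : PTerm n) → avg (joint n) (λ (P , x) → mass T (mask j P) x * mass U (mask j P) x) ≤ common T U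
    moment₂ j []  []  = ℚ.≤-refl
    moment₂ {suc n} j (t ∷ T) (u ∷ U) = ℚ.≤-trans (ℚ.≤-reflexive (trans
        (avg-cong (joint (suc n)) {f = λ (P , x) → mass (t ∷ T) (mask j P) x * mass (u ∷ U) (mask j P) x} {g = λ { (c ∷ P , b ∷ x) → factor t (does (c Fin.≟ j)) b * factor u (does (c Fin.≟ j)) b * (mass T (mask j P) x * mass U (mask j P) x) }} λ { (c ∷ P , b ∷ x) → eq (factor t (does (c Fin.≟ j)) b) (mass T (mask j P) x) (factor u (does (c Fin.≟ j)) b) (mass U (mask j P) x) })
        (joint-factor (λ c b → factor t (does (c Fin.≟ j)) b * factor u (does (c Fin.≟ j)) b) (λ P x → mass T (mask j P) x * mass U (mask j P) x))))
      (*-mono-≤ (0≤common₁ t u) (avg-≥0 (joint n) (λ (P , x) → 0≤* (0≤mass T (mask j P) x) (0≤mass U (mask j P) x))) (mean₂ j t u) (moment₂ j T U))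
      where
      eq : ∀ a b c d → a * b * (c * d) ≡ a * c * (b * d)
      eq = solve-∀ ring

-- From the second moment to an exponentially small failure probability

module Spread where
  open import Data.Rational using (ℚ; 0ℚ; 1ℚ; ½; _+_; _*_; _-_; -_; _≤_; _<_; ∣_∣; _⊓_)
  open Rationals
  open Averages
  open SecondMoment
  open Average

  ⅛ : ℚ
  ⅛ = ½ * ½ * ½

  ½≤1 : ½ ≤ 1ℚ
  ½≤1 = ℚ.≤ᵇ⇒≤ _

  2x/8≤x/2 : ∀ {x} → 0ℚ ≤ x → (x + x) * ⅛ ≤ ½ * x
  2x/8≤x/2 {x} 0≤x = ≤-by (0≤* (0≤* 0≤½ 0≤½) 0≤x) (eq x)
    where
    eq : ∀ x → ½ * x - (x + x) * ⅛ ≡ ½ * ½ * x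
    eq = solve-∀ ring

  module _ {A : Set} (𝒜 : Average A) where

    -- The variance is at most `θ m²`, and on `N` the squared deviation from the mean equals `m²`.
    chebyshev : ∀ (X : A → ℚ) (N : A → Bool) m θ → 0ℚ < m → (∀ a → N a ≡ true → X a ≡ 0ℚ) →
                avg 𝒜 X ≡ m → avg 𝒜 (λ a → X a * X a) ≤ m * (m * (1ℚ + θ)) → avg 𝒜 (ind ∘ N) ≤ θ
    chebyshev X N m θ 0<m zeroOn mean second = *-cancelʳ-≤ (0<* 0<m 0<m) (subst (_≤ θ * (m * m)) (scaled m (avg 𝒜 (ind ∘ N)))
        (≤-by (0≤+ (≤⇒0≤- (mono 𝒜 pointwise)) (≤⇒0≤- second)) eq))
      where
      scaled : ∀ m p → m * m * p ≡ p * (m * m)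
      scaled = solve-∀ ring
      square : ∀ x → X x * X x + (m * m - (m + m) * X x) ≡ (X x - m) * (X x - m)
      square x = id (X x) m
        where
        id : ∀ x m → x * x + (m * m - (m + m) * x) ≡ (x - m) * (x - m)
        id = solve-∀ ring
      pointwise : ∀ a → m * m * ind (N a) ≤ X a * X a + (m * m - (m + m) * X a)
      pointwise a with N a in h
      ... | false = subst₂ _≤_ (sym (ℚ.*-zeroʳ (m * m))) (sym (square a)) (0≤sq (X a - m))
      ... | true  = ℚ.≤-reflexive (trans (id₁ m) (cong (λ x → x * x + (m * m - (m + m) * x)) (sym (zeroOn a h))))
        where
        id₁ : ∀ m → m * m * 1ℚ ≡ 0ℚ * 0ℚ + (m * m - (m + m) * 0ℚ)
        id₁ = solve-∀ ring
      p s t : ℚ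
      p = avg 𝒜 (ind ∘ N)
      s = avg 𝒜 (λ a → X a * X a)
      t = m * (m * (1ℚ + θ))
      rhs : avg 𝒜 (λ a → X a * X a + (m * m - (m + m) * X a)) ≡ s + (m * m - (m + m) * m)
      rhs = trans (add 𝒜 _ _) (cong (s +_) (trans (add 𝒜 _ _) (cong₂ _+_ (const 𝒜 (m * m))
              (trans (avg-cong 𝒜 (λ a → neg (m + m) (X a))) (trans (scale 𝒜 (- (m + m)) X) (trans (cong (- (m + m) *_) mean) (sym (neg (m + m) m))))))))
        where
        neg : ∀ a b → - (a * b) ≡ - a * b
        neg = solve-∀ ring
      eq : θ * (m * m) - m * m * p ≡ (avg 𝒜 (λ a → X a * X a + (m * m - (m + m) * X a)) - avg 𝒜 (λ a → m * m * ind (N a))) + (t - s)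
      eq = trans (id θ m p s) (sym (cong₂ (λ u v → (u - v) + (t - s)) rhs (scale 𝒜 (m * m) (ind ∘ N))))
        where
        id : ∀ θ m p s → θ * (m * m) - m * m * p ≡ ((s + (m * m - (m + m) * m)) - m * m * p) + (m * (m * (1ℚ + θ)) - s)
        id = solve-∀ ring

  AgreeOn : ∀ {n} → Mask n → Vec Bool n → Vec Bool n → Set
  AgreeOn []  []  []  = ⊤
  AgreeOn (s ∷ S) (a ∷ x) (b ∷ y) = (s ≡ true → a ≡ b) × AgreeOn S x y

  Respects : ∀ {n} → Mask n → (Vec Bool n → ℚ) → Set
  Respects S f = ∀ x y → AgreeOn S x y → f x ≡ f y

  agreeOn-refl : ∀ {n} (S : Mask n) x → AgreeOn S x x
  agreeOn-refl []  []  = _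
  agreeOn-refl (s ∷ S) (a ∷ x) = (λ _ → refl) , agreeOn-refl S x

  -- At every coordinate one of the two functions ignores the bit, so its two branches have equal
  -- averages and the mean of the two products factors.
  independent : ∀ {n} (S : Mask n) f g → Respects S f → Respects (Vec.map not S) g →
                avg (cube n) (λ x → f x * g x) ≡ avg (cube n) f * avg (cube n) g
  independent []  f g _  _  = refl
  independent {suc n} (s ∷ S) f g rf rg = trans (cong₂ (λ u v → ½ * (u + v)) (ih false) (ih true)) (combine s refl)
    where
    F G : Bool → ℚ
    F b = avg (cube n) (λ x → f (b ∷ x))
    G b = avg (cube n) (λ x → g (b ∷ x))
    ih : ∀ b → avg (cube n) (λ x → f (b ∷ x) * g (b ∷ x)) ≡ F b * G b
    ih b = independent S (λ x → f (b ∷ x)) (λ x → g (b ∷ x))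
      (λ x y h → rf (b ∷ x) (b ∷ y) ((λ _ → refl) , h)) (λ x y h → rg (b ∷ x) (b ∷ y) ((λ _ → refl) , h))
    id₁ : ∀ a b c → ½ * (a * c + b * c) ≡ ½ * (a + b) * (½ * (c + c))
    id₁ = solve-∀ ring
    id₂ : ∀ a c d → ½ * (a * c + a * d) ≡ ½ * (a + a) * (½ * (c + d))
    id₂ = solve-∀ ring
    combine : ∀ b → b ≡ s → ½ * (F false * G false + F true * G true) ≡ ½ * (F false + F true) * (½ * (G false + G true))
    combine true  refl = subst (λ t → ½ * (F false * G false + F true * t) ≡ ½ * (F false + F true) * (½ * (G false + t)))
      (avg-cong (cube n) (λ x → rg (false ∷ x) (true ∷ x) ((λ ()) , agreeOn-refl (Vec.map not S) x)))
      (id₁ (F false) (F true) (G false))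
    combine false refl = subst (λ t → ½ * (F false * G false + t * G true) ≡ ½ * (F false + t) * (½ * (G false + G true)))
      (avg-cong (cube n) (λ x → rf (false ∷ x) (true ∷ x) ((λ ()) , agreeOn-refl S x)))
      (id₂ (F false) (G false) (G true))

  ΠF : ∀ {k} → (Fin k → ℚ) → ℚ
  ΠF {zero}  f = 1ℚ
  ΠF {suc k} f = f zero * ΠF (f ∘ suc)

  ΠF-cong : ∀ {k} {f g : Fin k → ℚ} → (∀ i → f i ≡ g i) → ΠF f ≡ ΠF g
  ΠF-cong {zero}  h = refl
  ΠF-cong {suc k} h = cong₂ _*_ (h zero) (ΠF-cong (h ∘ suc))

  ΠF-≥0 : ∀ {k} {f : Fin k → ℚ} → (∀ i → 0ℚ ≤ f i) → 0ℚ ≤ ΠF f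
  ΠF-≥0 {zero}  h = 0≤1
  ΠF-≥0 {suc k} h = 0≤* (h zero) (ΠF-≥0 (h ∘ suc))

  ΠF-1 : ∀ {k} {f : Fin k → ℚ} → (∀ i → f i ≡ 1ℚ) → ΠF f ≡ 1ℚ
  ΠF-1 {zero}  h = refl
  ΠF-1 {suc k} h = cong₂ _*_ (h zero) (ΠF-1 (h ∘ suc))

  -- At most 2 Σ f of the factors exceed ½.
  ΠF-bound : ∀ {k} (f : Fin k → ℚ) → (∀ i → 0ℚ ≤ f i) → (∀ i → f i ≤ 1ℚ) →
             ∃ λ b → ½ * ι b ≤ ΣF f × b ℕ.≤ k × ΠF f ≤ powℚ ½ (k ℕ.∸ b)
  ΠF-bound {zero}  f lo hi = 0 , ℚ.≤-reflexive (trans (cong (½ *_) ι-0) (ℚ.*-zeroʳ ½)) , ℕ.z≤n , ℚ.≤-refl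
  ΠF-bound {suc k} f lo hi with ΠF-bound (f ∘ suc) (lo ∘ suc) (hi ∘ suc) | f zero ℚ.≤? ½
  ... | b , sum , b≤k , prod | yes f₀≤½ = b
      , subst (_≤ f zero + ΣF (f ∘ suc)) (ℚ.+-identityˡ _) (ℚ.+-mono-≤ (lo zero) sum)
      , ℕ.m≤n⇒m≤1+n b≤k
      , subst (λ e → f zero * ΠF (f ∘ suc) ≤ powℚ ½ e) (sym (ℕ.+-∸-assoc 1 b≤k)) (*-mono-≤ 0≤½ (ΠF-≥0 (lo ∘ suc)) f₀≤½ prod)
  ... | b , sum , b≤k , prod | no f₀≰½ = suc b
      , ℚ.≤-trans (ℚ.≤-reflexive (trans (cong (½ *_) (ι-suc b)) (eq (ι b)))) (ℚ.+-mono-≤ (ℚ.<⇒≤ (ℚ.≰⇒> f₀≰½)) sum)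
      , ℕ.s≤s b≤k
      , ℚ.≤-trans (*-mono-≤ 0≤1 (ΠF-≥0 (lo ∘ suc)) (hi zero) prod) (ℚ.≤-reflexive (ℚ.*-identityˡ _))
    where
    eq : ∀ x → ½ * (1ℚ + x) ≡ ½ + ½ * x
    eq = solve-∀ ring

  none : ∀ {n} → List (PTerm n) → Vec Bool n → Bool
  none G x = all (λ T → not (sat T x)) G

  noneIn : ∀ {n} → List (PTerm n) → Mask n → Vec Bool n → Bool
  noneIn G S x = all (λ T → not (satIn T S x)) G

  satIn-agree : ∀ {n} (T : PTerm n) S x y → AgreeOn S x y → satIn T S x ≡ satIn T S y
  satIn-agree []  []  []  []  _  = refl
  satIn-agree (nothing ∷ T) (s ∷ S)  (a ∷ x) (b ∷ y) (_ , h) = satIn-agree T S x y h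
  satIn-agree (just c ∷ T)  (false ∷ S) (a ∷ x) (b ∷ y) (e , h) = refl
  satIn-agree (just c ∷ T)  (true ∷ S)  (a ∷ x) (b ∷ y) (e , h) = cong₂ _∧_ (cong (agree c) (e refl)) (satIn-agree T S x y h)

  noneIn-agree : ∀ {n} (G : List (PTerm n)) S x y → AgreeOn S x y → noneIn G S x ≡ noneIn G S y
  noneIn-agree []  S x y h = refl
  noneIn-agree (T ∷ G) S x y h = cong₂ (λ a b → not a ∧ b) (satIn-agree T S x y h) (noneIn-agree G S x y h)

  satIn⇒sat : ∀ {n} (T : PTerm n) S x → sat T x ≡ false → satIn T S x ≡ false
  satIn⇒sat []  []  []  ()
  satIn⇒sat (nothing ∷ T) (s ∷ S)  (b ∷ x) h = satIn⇒sat T S x h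
  satIn⇒sat (just a ∷ T)  (false ∷ S) (b ∷ x) h = refl
  satIn⇒sat (just a ∷ T)  (true ∷ S)  (b ∷ x) h with agree a b
  ... | true  = satIn⇒sat T S x h
  ... | false = refl

  none⇒noneIn : ∀ {n} (G : List (PTerm n)) S x → none G x ≡ true → noneIn G S x ≡ true
  none⇒noneIn []  S x h = refl
  none⇒noneIn (T ∷ G) S x h with sat T x in eq
  ... | false rewrite satIn⇒sat T S x eq = none⇒noneIn G S x h

  module Boost (r : ℕ) where
    open Moments r

    -- Distinct colour classes are disjoint, so the complement of one contains the other.
    mask-outside : ∀ {n} (P : Vec (Fin (suc r)) n) {i j} → i ≢ j → ∀ x y → AgreeOn (Vec.map not (mask j P)) x y → AgreeOn (mask i P) x y
    mask-outside []  i≢j []  []  _  = _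
    mask-outside (c ∷ P) {i} {j} i≢j (a ∷ x) (b ∷ y) (e , h) = head (c Fin.≟ i) (c Fin.≟ j) e , mask-outside P i≢j x y h
      where
      head : (d : Dec (c ≡ i)) (d′ : Dec (c ≡ j)) → (not (does d′) ≡ true → a ≡ b) → does d ≡ true → a ≡ b
      head (yes c≡i) (yes c≡j) _ _ = ⊥-elim (i≢j (trans (sym c≡i) c≡j))
      head (yes _)   (no _)    e _ = e refl
      head (no _)    _  e ()

    module _ {n} (G : List (PTerm n)) (P : Vec (Fin (suc r)) n) where

      miss : Fin (suc r) → Vec Bool n → ℚ
      miss j x = ind (noneIn G (mask j P) x)

      -- Quantified over injections `σ` into the colours so that the induction can peel off one
      -- class: injectivity keeps it disjoint from all the remaining ones.
      miss-product : ∀ {k} (σ : Fin k → Fin (suc r)) → (∀ {a b} → σ a ≡ σ b → a ≡ b) →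
                     avg (cube n) (λ x → ΠF (λ i → miss (σ i) x)) ≡ ΠF (λ i → avg (cube n) (miss (σ i)))
      miss-product {zero}  σ inj = const (cube n) 1ℚ
      miss-product {suc k} σ inj = trans
        (independent (mask (σ zero) P) (miss (σ zero)) (λ x → ΠF (λ i → miss (σ (suc i)) x))
          (λ x y h → cong ind (noneIn-agree G (mask (σ zero) P) x y h))
          (λ x y h → ΠF-cong (λ i → cong ind (noneIn-agree G (mask (σ (suc i)) P) x y
                       (mask-outside P (λ e → suc≢zero (inj e)) x y h)))))
        (cong (avg (cube n) (miss (σ zero)) *_) (miss-product (σ ∘ suc) (λ e → Fin.suc-injective (inj e))))
        where
        suc≢zero : ∀ {k} {i : Fin k} → suc i ≢ zero
        suc≢zero ()

      -- An input that misses every term also misses, in every class, the terms lying inside that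
      -- class.
      none≤product : avg (cube n) (ind ∘ none G) ≤ ΠF (λ j → avg (cube n) (miss j))
      none≤product = subst (avg (cube n) (ind ∘ none G) ≤_) (miss-product (λ j → j) (λ e → e)) (mono (cube n) pointwise)
        where
        pointwise : ∀ x → ind (none G x) ≤ ΠF (λ j → miss j x)
        pointwise x with none G x in h
        ... | true  = ℚ.≤-reflexive (sym (ΠF-1 (λ j → cong ind (none⇒noneIn G (mask j P) x h))))
        ... | false = ΠF-≥0 (λ j → 0≤ind (noneIn G (mask j P) x))

    -- The set `Z` of literals shared by `T` and `U` is one of the summands and alone contributes
    -- the left side; all others are nonnegative.
    common-bound : ∀ {n} (T U : PTerm n) → common T U ≤ ΣZ T (λ Z → powℚ base (size Z) * ind (Z ⊆ᵇ U))
    common-bound []  []  = ℚ.≤-refl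
    common-bound (nothing ∷ T) (u ∷ U) = ℚ.≤-trans (ℚ.≤-reflexive (ℚ.*-identityˡ _)) (common-bound T U)
    common-bound (just a ∷ T)  (u ∷ U) = step u
      where
      f : PTerm _ → ℚ
      f Z = powℚ base (size Z) * ind (Z ⊆ᵇ U)
      0≤f : ∀ Z → 0ℚ ≤ f Z
      0≤f Z = 0≤* (pow-≥0 (size Z) 0≤base) (0≤ind (Z ⊆ᵇ U))
      S : ℚ
      S = ΣZ T f
      0≤S : 0ℚ ≤ S
      0≤S = ΣZ-≥0 T 0≤f
      ≤S+ : ∀ {x y} → x ≤ S → 0ℚ ≤ y → x ≤ S + y
      ≤S+ {x} x≤S 0≤y = subst (_≤ _) (ℚ.+-identityʳ x) (ℚ.+-mono-≤ x≤S 0≤y)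
      rest≥0 : ∀ v → 0ℚ ≤ ΣZ T (λ Z → base * powℚ base (size Z) * ind (v ∧ (Z ⊆ᵇ U)))
      rest≥0 v = ΣZ-≥0 T (λ Z → 0≤* (0≤* 0≤base (pow-≥0 (size Z) 0≤base)) (0≤ind (v ∧ (Z ⊆ᵇ U))))
      step : ∀ u → common₁ (just a) u * common T U ≤ S + ΣZ T (λ Z → base * powℚ base (size Z) * ind (within (just a) u ∧ (Z ⊆ᵇ U)))
      step nothing  = ≤S+ (ℚ.≤-trans (ℚ.≤-reflexive (ℚ.*-identityˡ _)) (common-bound T U)) (rest≥0 false)
      step (just b) with agree a b
      ... | false = ≤S+ (ℚ.≤-trans (ℚ.≤-reflexive (ℚ.*-identityˡ _)) (common-bound T U)) (rest≥0 false)
      ... | true  = ℚ.≤-trans (*-monoˡ-≤ 0≤base (common-bound T U))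
                   (subst₂ _≤_ (ℚ.+-identityˡ (base * S)) (cong (S +_) (trans (sym (ΣZ-*ˡ T base f)) (ΣZ-cong T (λ Z → sym (ℚ.*-assoc base (powℚ base (size Z)) (ind (Z ⊆ᵇ U)))))))
                     (ℚ.+-monoˡ-≤ (base * S) 0≤S))

    module _ {n} (G : List (PTerm n)) (w : ℕ) (y : ℚ) (0≤y : 0ℚ ≤ y)
             (width : All (λ T → size T ℕ.≤ w) G)
             (nonempty : 0ℚ < ι (length G))
             (spread : ∀ Z → powℚ base (size Z) * ι (length (filterᵇ (Z ⊆ᵇ_) G)) ≤ ι (length G) * powℚ y (size Z))
             (small : powℚ (1ℚ + y) w ≤ 1ℚ + ⅛)
      where

      m : ℚ
      m = ι (length G)

      1≤1+y : 1ℚ ≤ 1ℚ + y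
      1≤1+y = subst (_≤ 1ℚ + y) (ℚ.+-identityʳ 1ℚ) (ℚ.+-monoʳ-≤ 1ℚ 0≤y)

      -- Exchanging the sums leaves, for each sub-term `Z`, the number of terms containing it.
      -- `spread` turns `base ^ size Z` times that number into `m y ^ size Z`, and the binomial
      -- theorem adds these up to `m (1 + y) ^ size T`.
      common-sum : ∀ T → size T ℕ.≤ w → ΣL (common T) G ≤ m * (1ℚ + ⅛)
      common-sum T T≤w = begin
        ΣL (common T) G  ≤⟨ ΣL-mono (common-bound T) G ⟩
        ΣL (λ U → ΣZ T (λ Z → powℚ base (size Z) * ind (Z ⊆ᵇ U))) G  ≡⟨ ΣL-ΣZ T (λ U Z → powℚ base (size Z) * ind (Z ⊆ᵇ U)) G ⟩
        ΣZ T (λ Z → ΣL (λ U → powℚ base (size Z) * ind (Z ⊆ᵇ U)) G)  ≡⟨ ΣZ-cong T (λ Z → trans (ΣL-*ˡ (powℚ base (size Z)) (λ U → ind (Z ⊆ᵇ U)) G) (cong (powℚ base (size Z) *_) (ΣL-ind (Z ⊆ᵇ_) G))) ⟩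
        ΣZ T (λ Z → powℚ base (size Z) * ι (length (filterᵇ (Z ⊆ᵇ_) G)))  ≤⟨ ΣZ-mono T spread ⟩
        ΣZ T (λ Z → m * powℚ y (size Z))  ≡⟨ trans (ΣZ-*ˡ T m _) (cong (m *_) (ΣZ-pow T y)) ⟩
        m * powℚ (1ℚ + y) (size T)  ≤⟨ *-monoˡ-≤ (ℚ.<⇒≤ nonempty) (ℚ.≤-trans (pow-grow 1≤1+y T≤w) small) ⟩
        m * (1ℚ + ⅛)  ∎
        where open ℚ.≤-Reasoning

      count : Fin (suc r) → Vec (Fin (suc r)) n × Vec Bool n → ℚ
      count j (P , x) = ΣL (λ T → mass T (mask j P) x) G

      count-zero : ∀ (H : List (PTerm n)) S x → noneIn H S x ≡ true → ΣL (λ T → mass T S x) H ≡ 0ℚ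
      count-zero []  S x h = refl
      count-zero (T ∷ H) S x h with satIn T S x in eq
      ... | false = cong₂ _+_ (mass-unsat T S x eq) (count-zero H S x h)

      count-mean : ∀ j → avg (joint n) (count j) ≡ m
      count-mean j = trans (avg-ΣL (joint n) (λ (P , x) T → mass T (mask j P) x) G)
        (trans (ΣL-cong (moment₁ j) G) (trans (ΣL-const 1ℚ G) (ℚ.*-identityʳ m)))

      ΣL-All : ∀ {f : PTerm n → ℚ} {c} {p : PTerm n → Set} → (∀ T → p T → f T ≤ c) → ∀ H → All p H → ΣL f H ≤ ι (length H) * c
      ΣL-All {c = c} h [] [] = ℚ.≤-reflexive (ΣL-const {A = PTerm n} c [])
      ΣL-All {c = c} h (T ∷ H) (p ∷ ps) = ℚ.≤-trans (ℚ.+-mono-≤ (h T p) (ΣL-All h H ps))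
        (ℚ.≤-reflexive (trans (cong (c +_) (sym (ΣL-const c H))) (ΣL-const c (T ∷ H))))

      count-second : ∀ j → avg (joint n) (λ a → count j a * count j a) ≤ m * (m * (1ℚ + ⅛))
      count-second j = ℚ.≤-trans (ℚ.≤-reflexive expand)
        (ℚ.≤-trans (ΣL-mono (λ T → ΣL-mono (moment₂ j T) G) G) (ΣL-All common-sum G width))
        where
        wt : PTerm n → Vec (Fin (suc r)) n × Vec Bool n → ℚ
        wt T (P , x) = mass T (mask j P) x
        square : ∀ a → count j a * count j a ≡ ΣL (λ T → ΣL (λ U → wt T a * wt U a) G) G
        square a = trans (sym (ΣL-*ˡ (count j a) (λ T → wt T a) G))
          (ΣL-cong (λ T → trans (ℚ.*-comm (count j a) (wt T a)) (sym (ΣL-*ˡ (wt T a) (λ U → wt U a) G))) G)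
        expand : avg (joint n) (λ a → count j a * count j a) ≡ ΣL (λ T → ΣL (λ U → avg (joint n) (λ a → wt T a * wt U a)) G) G
        expand = trans (avg-cong (joint n) {f = λ a → count j a * count j a} {g = λ a → ΣL (λ T → ΣL (λ U → wt T a * wt U a) G) G} square)
          (trans (avg-ΣL (joint n) (λ a T → ΣL (λ U → wt T a * wt U a) G) G)
                 (ΣL-cong (λ T → avg-ΣL (joint n) (λ a U → wt T a * wt U a) G) G))

      miss-mean : ∀ j → avg (colouring n) (λ P → avg (cube n) (miss G P j)) ≤ ⅛
      miss-mean j = chebyshev (joint n) (count j) (λ (P , x) → noneIn G (mask j P) x) m ⅛ nonempty
        (λ (P , x) h → count-zero G (mask j P) x h) (count-mean j) (count-second j)

      ΣF-avg : ∀ {k} (f : Fin k → Vec (Fin (suc r)) n → ℚ) → avg (colouring n) (λ P → ΣF (λ j → f j P)) ≡ ΣF (λ j → avg (colouring n) (f j))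
      ΣF-avg {zero}  f = const (colouring n) 0ℚ
      ΣF-avg {suc k} f = trans (add (colouring n) (f zero) (λ P → ΣF (λ j → f (suc j) P))) (cong (avg (colouring n) (f zero) +_) (ΣF-avg (f ∘ suc)))

      good-colouring : ∃ λ P → ΣF (λ j → avg (cube n) (miss G P j)) ≤ ι (suc r) * ⅛
      good-colouring = let (P , h) = pick (colouring n) (λ P → ΣF (λ j → avg (cube n) (miss G P j))) in
        P , ℚ.≤-trans h (ℚ.≤-trans (ℚ.≤-reflexive (ΣF-avg (λ j P → avg (cube n) (miss G P j))))
              (ℚ.≤-trans (ΣF-mono miss-mean) (ℚ.≤-reflexive (ΣF-const {suc r} ⅛))))

      -- The miss probabilities of the `2Q` classes add up to at most `2Q/8`, so no more than `Q` of
      -- them exceed ½, and the other classes contribute `½ ^ Q`.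
      none-rare : ∀ Q → suc r ≡ Q ℕ.+ Q → avg (cube n) (ind ∘ none G) ≤ powℚ ½ Q
      none-rare Q r≡2Q = ℚ.≤-trans (none≤product G P) (ℚ.≤-trans prod
          (pow-anti 0≤½ ½≤1 (ℕ.m+n≤o⇒m≤o∸n Q (subst (Q ℕ.+ b ℕ.≤_) (sym r≡2Q) (ℕ.+-monoʳ-≤ Q b≤Q)))))
        where
        P = proj₁ good-colouring
        bounded = ΠF-bound (λ j → avg (cube n) (miss G P j))
          (λ j → avg-≥0 (cube n) (λ x → 0≤ind (noneIn G (mask j P) x)))
          (λ j → avg-≤1 (cube n) (λ x → ind≤1 (noneIn G (mask j P) x)))
        b = proj₁ bounded
        prod = proj₂ (proj₂ (proj₂ bounded))
        2Q≡ : ι (suc r) ≡ ι Q + ι Q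
        2Q≡ = trans (cong ι r≡2Q) (ι-+ Q Q)
        ½b≤½Q : ½ * ι b ≤ ½ * ι Q
        ½b≤½Q = ℚ.≤-trans (proj₁ (proj₂ bounded)) (ℚ.≤-trans (proj₂ good-colouring)
          (subst (λ t → t * ⅛ ≤ ½ * ι Q) (sym 2Q≡) (2x/8≤x/2 (0≤ι Q))))
        b≤Q : b ℕ.≤ Q
        b≤Q = ι-cancel (ℚ.*-cancelˡ-≤-pos ½ ½b≤½Q)

-- Quasi-sunflowers around a maximal heavy assignment

module Sunflower where
  open import Data.Rational using (ℚ; 0ℚ; 1ℚ; ½; _+_; _*_; _-_; -_; _≤_; _<_; ∣_∣; _⊓_)
  open Rationals
  open Averages
  open SecondMoment
  open Spread
  open Average

  _∖_ : ∀ {n} → PTerm n → PTerm n → PTerm n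
  []  ∖ []  = []
  (t ∷ T) ∖ (nothing ∷ Y) = t ∷ (T ∖ Y)
  (t ∷ T) ∖ (just _ ∷ Y)  = nothing ∷ (T ∖ Y)

  _∪_ : ∀ {n} → PTerm n → PTerm n → PTerm n
  []  ∪ []  = []
  (nothing ∷ Y) ∪ (z ∷ Z) = z ∷ (Y ∪ Z)
  (just a ∷ Y)  ∪ (z ∷ Z) = just a ∷ (Y ∪ Z)

  ∅ : ∀ {n} → PTerm n
  ∅ = Vec.replicate _ nothing

  ∅⊆ : ∀ {n} (T : PTerm n) → (∅ ⊆ᵇ T) ≡ true
  ∅⊆ []  = refl
  ∅⊆ (t ∷ T) = ∅⊆ T

  size-∅ : ∀ n → size (∅ {n}) ≡ 0
  size-∅ zero    = refl
  size-∅ (suc n) = size-∅ n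

  size-≤ : ∀ {n} (T : PTerm n) → size T ℕ.≤ n
  size-≤ []  = ℕ.z≤n
  size-≤ (nothing ∷ T) = ℕ.m≤n⇒m≤1+n (size-≤ T)
  size-≤ (just _ ∷ T)  = ℕ.s≤s (size-≤ T)

  ∧-trueˡ : ∀ {a b} → a ∧ b ≡ true → a ≡ true
  ∧-trueˡ {true} _ = refl

  ∧-trueʳ : ∀ {a b} → a ∧ b ≡ true → b ≡ true
  ∧-trueʳ {true} h = h

  ∧-intro : ∀ {a b} → a ≡ true → b ≡ true → a ∧ b ≡ true
  ∧-intro refl refl = refl

  agree⇒≡ : ∀ {a b} → agree a b ≡ true → a ≡ b
  agree⇒≡ {true}  {true}  _ = refl
  agree⇒≡ {false} {false} _ = refl

  ⊆-size : ∀ {n} (S T : PTerm n) → (S ⊆ᵇ T) ≡ true → size S ℕ.≤ size T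
  ⊆-size []  []  _ = ℕ.z≤n
  ⊆-size (nothing ∷ S) (nothing ∷ T) h = ⊆-size S T h
  ⊆-size (nothing ∷ S) (just _ ∷ T)  h = ℕ.m≤n⇒m≤1+n (⊆-size S T h)
  ⊆-size (just a ∷ S)  (just b ∷ T)  h = ℕ.s≤s (⊆-size S T (∧-trueʳ {agree a b} h))

  ⊆-sat : ∀ {n} (S T : PTerm n) x → (S ⊆ᵇ T) ≡ true → sat T x ≡ true → sat S x ≡ true
  ⊆-sat []  []  []  _ _ = refl
  ⊆-sat (nothing ∷ S) (nothing ∷ T) (b ∷ x) h k = ⊆-sat S T x h k
  ⊆-sat (nothing ∷ S) (just c ∷ T)  (b ∷ x) h k = ⊆-sat S T x h (∧-trueʳ {agree c b} k)
  ⊆-sat (just a ∷ S)  (just c ∷ T)  (b ∷ x) h k with agree⇒≡ {a} {c} (∧-trueˡ h)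
  ... | refl = ∧-intro (∧-trueˡ k) (⊆-sat S T x (∧-trueʳ {agree a c} h) (∧-trueʳ {agree a b} k))

  sat-∖ : ∀ {n} (Y T : PTerm n) x → (Y ⊆ᵇ T) ≡ true → sat Y x ≡ true → sat (T ∖ Y) x ≡ true → sat T x ≡ true
  sat-∖ []  []  []  _ _ _ = refl
  sat-∖ (nothing ∷ Y) (nothing ∷ T) (b ∷ x) h k l = sat-∖ Y T x h k l
  sat-∖ (nothing ∷ Y) (just c ∷ T)  (b ∷ x) h k l = ∧-intro (∧-trueˡ l) (sat-∖ Y T x h k (∧-trueʳ {agree c b} l))
  sat-∖ (just a ∷ Y)  (just c ∷ T)  (b ∷ x) h k l with agree⇒≡ {a} {c} (∧-trueˡ h)
  ... | refl = ∧-intro (∧-trueˡ k) (sat-∖ Y T x (∧-trueʳ {agree a c} h) (∧-trueʳ {agree a b} k) l)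

  ∪-⊆ : ∀ {n} (Y Z T : PTerm n) → (Y ⊆ᵇ T) ≡ true → (Z ⊆ᵇ (T ∖ Y)) ≡ true → ((Y ∪ Z) ⊆ᵇ T) ≡ true
  ∪-⊆ []  []  []  _ _ = refl
  ∪-⊆ (nothing ∷ Y) (z ∷ Z)  (t ∷ T) h k = ∧-intro (∧-trueˡ k) (∪-⊆ Y Z T h (∧-trueʳ {within z t} k))
  ∪-⊆ (just a ∷ Y)  (nothing ∷ Z) (t ∷ T) h k = ∧-intro (∧-trueˡ h) (∪-⊆ Y Z T (∧-trueʳ {within (just a) t} h) k)

  -- The term `T` witnesses that `Z` avoids the variables of `Y`, so no literal is counted twice.
  ∪-size : ∀ {n} (Y Z T : PTerm n) → (Z ⊆ᵇ (T ∖ Y)) ≡ true → size (Y ∪ Z) ≡ size Y ℕ.+ size Z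
  ∪-size []  []  []  _ = refl
  ∪-size (nothing ∷ Y) (nothing ∷ Z) (t ∷ T) k = ∪-size Y Z T k
  ∪-size (nothing ∷ Y) (just a ∷ Z)  (t ∷ T) k = trans (cong suc (∪-size Y Z T (∧-trueʳ {within (just a) t} k))) (sym (ℕ.+-suc (size Y) (size Z)))
  ∪-size (just a ∷ Y)  (nothing ∷ Z) (t ∷ T) k = cong suc (∪-size Y Z T k)

  ⊆-∪ : ∀ {n} (Y Z : PTerm n) → (Y ⊆ᵇ (Y ∪ Z)) ≡ true
  ⊆-∪ []  []  = refl
  ⊆-∪ (nothing ∷ Y) (z ∷ Z) = ⊆-∪ Y Z
  ⊆-∪ (just a ∷ Y)  (z ∷ Z) = ∧-intro (agree-refl a) (⊆-∪ Y Z)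
    where
    agree-refl : ∀ a → agree a a ≡ true
    agree-refl true  = refl
    agree-refl false = refl

  ∖-size : ∀ {n} (Y T : PTerm n) → size (T ∖ Y) ℕ.≤ size T
  ∖-size []  []  = ℕ.z≤n
  ∖-size (nothing ∷ Y) (nothing ∷ T) = ∖-size Y T
  ∖-size (nothing ∷ Y) (just _ ∷ T)  = ℕ.s≤s (∖-size Y T)
  ∖-size (just _ ∷ Y)  (nothing ∷ T) = ∖-size Y T
  ∖-size (just _ ∷ Y)  (just _ ∷ T)  = ℕ.m≤n⇒m≤1+n (∖-size Y T)

  ∃? : ∀ {n} {P : PTerm n → Set} → (∀ Y → Dec (P Y)) → Dec (∃ P)
  ∃? {zero} P? with P? []
  ... | yes p = yes ([] , p)
  ... | no ¬p = no λ { ([] , p) → ¬p p }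
  ∃? {suc n} P? with ∃? (P? ∘ (nothing ∷_)) | ∃? (P? ∘ (just false ∷_)) | ∃? (P? ∘ (just true ∷_))
  ... | yes (Y , p) | _  | _  = yes (nothing ∷ Y , p)
  ... | no _  | yes (Y , p) | _  = yes (just false ∷ Y , p)
  ... | no _  | no _  | yes (Y , p) = yes (just true ∷ Y , p)
  ... | no ¬1  | no ¬2  | no ¬3  = no λ { (nothing ∷ Y , p) → ¬1 (Y , p) ; (just false ∷ Y , p) → ¬2 (Y , p) ; (just true ∷ Y , p) → ¬3 (Y , p) }

  module _ {A : Set} where

    filter-All : ∀ {P : A → Set} p {xs : List A} → All P xs → All (λ x → P x × p x ≡ true) (filterᵇ p xs)
    filter-All p []  = []
    filter-All p {x ∷ xs} (px ∷ pxs) with p x in eq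
    ... | true  = (px , eq) ∷ filter-All p pxs
    ... | false = filter-All p pxs

    filter-length : ∀ p (xs : List A) → length (filterᵇ p xs) ℕ.≤ length xs
    filter-length p []  = ℕ.z≤n
    filter-length p (x ∷ xs) with p x
    ... | true  = ℕ.s≤s (filter-length p xs)
    ... | false = ℕ.m≤n⇒m≤1+n (filter-length p xs)

    filter-filter : ∀ p q s → (∀ x → p x ≡ true → q x ≡ true → s x ≡ true) → ∀ (xs : List A) →
                    length (filterᵇ q (filterᵇ p xs)) ℕ.≤ length (filterᵇ s xs)
    filter-filter p q s h []  = ℕ.z≤n
    filter-filter p q s h (x ∷ xs) with p x in ep
    ... | false with s x
    ...   | true  = ℕ.m≤n⇒m≤1+n (filter-filter p q s h xs)
    ...   | false = filter-filter p q s h xs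
    filter-filter p q s h (x ∷ xs) | true with q x in eq
    ...   | true rewrite h x ep eq = ℕ.s≤s (filter-filter p q s h xs)
    ...   | false with s x
    ...  | true  = ℕ.m≤n⇒m≤1+n (filter-filter p q s h xs)
    ...  | false = filter-filter p q s h xs

    filter-witness : ∀ {P : A → Set} p {xs : List A} → All P xs → length (filterᵇ p xs) ≡ 0 ⊎ ∃ λ x → P x × p x ≡ true
    filter-witness p []  = inj₁ refl
    filter-witness p {x ∷ xs} (px ∷ pxs) with p x in eq
    ... | true  = inj₂ (x , px , eq)
    ... | false = filter-witness p pxs

    filter-complement : ∀ p (xs : List A) → length (filterᵇ p xs) ℕ.+ length (filterᵇ (not ∘ p) xs) ≡ length xs
    filter-complement p []  = refl
    filter-complement p (x ∷ xs) with p x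
    ... | true  = cong suc (filter-complement p xs)
    ... | false = trans (ℕ.+-suc _ _) (cong suc (filter-complement p xs))

    filter-map : ∀ {B : Set} (q : B → Bool) (f : A → B) xs → length (filterᵇ q (map f xs)) ≡ length (filterᵇ (q ∘ f) xs)
    filter-map q f []  = refl
    filter-map q f (x ∷ xs) with q (f x)
    ... | true  = cong suc (filter-map q f xs)
    ... | false = filter-map q f xs

    -- Lists may contain a term several times, so a deletion is recorded by its position and not by
    -- comparing terms.
    data Remove (x : A) : List A → List A → Set where
      here  : ∀ {xs} → Remove x (x ∷ xs) xs
      there : ∀ {y xs ys} → Remove x xs ys → Remove x (y ∷ xs) (y ∷ ys)

    remove-length : ∀ {x xs ys} → Remove x xs ys → length xs ≡ suc (length ys)
    remove-length here  = refl
    remove-length (there r) = cong suc (remove-length r)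

    remove-All : ∀ {P : A → Set} {x xs ys} → Remove x xs ys → All P xs → P x × All P ys
    remove-All here  (p ∷ ps) = p , ps
    remove-All (there r) (p ∷ ps) = let (q , qs) = remove-All r ps in q , p ∷ qs

    remove-filter : ∀ p (xs : List A) → 1 ℕ.≤ length (filterᵇ p xs) →
                    ∃ λ x → ∃ λ ys → Remove x xs ys × p x ≡ true × filterᵇ p xs ≡ x ∷ filterᵇ p ys
    remove-filter p (x ∷ xs) h with p x in eq
    ... | true  = x , xs , here , eq , refl
    ... | false with remove-filter p xs h
    ...   | y , ys , r , py , e = y , x ∷ ys , there r , py , trans e (cong (y ∷_) (sym (filter-skip eq)))
      where
      filter-skip : ∀ {x ys} → p x ≡ false → filterᵇ p (x ∷ ys) ≡ filterᵇ p ys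
      filter-skip {x} h with p x
      filter-skip refl | false = refl

  holds : ∀ {n} → List (PTerm n) → Vec Bool n → Bool
  holds F x = any (λ T → sat T x) F

  Narrow : ∀ {n} → ℕ → List (PTerm n) → Set
  Narrow w = All (λ T → size T ℕ.≤ w)

  module _ (w Q : ℕ) .{{_ : ℕ.NonZero w}} .{{_ : ℕ.NonZero Q}} where

    -- The quotient of `base = 4Q` (2Q colours and two values of a bit) by `y = 1/(16w)`. This `y`
    -- makes `(1 + y) ^ w ≤ 9/8`, as the second moment bound requires.
    threshold : ℕ
    threshold = 64 ℕ.* (w ℕ.* Q)

    private
      16w : ℕ
      16w = 16 ℕ.* w

      instance
        16w≢0 : ℕ.NonZero 16w
        16w≢0 = ℕ.m*n≢0 16 w

        wQ≢0 : ℕ.NonZero (w ℕ.* Q)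
        wQ≢0 = ℕ.m*n≢0 w Q

        threshold≢0 : ℕ.NonZero threshold
        threshold≢0 = ℕ.m*n≢0 64 (w ℕ.* Q)

      y : ℚ
      y = invℚ (ι 16w)

      0≤y : 0ℚ ≤ y
      0≤y = inv-≥0 (0<ι 16w)

      16wy≡1 : ι 16w * y ≡ 1ℚ
      16wy≡1 = inv-*ʳ (0<ι 16w)

      -- A Bernoulli inequality in reverse. The induction works because `2ky ≤ 1` in the whole range
      -- `k ≤ w`.
      1+y-pow : ∀ k → k ℕ.≤ w → powℚ (1ℚ + y) k ≤ 1ℚ + (ι k + ι k) * y
      1+y-pow zero    _ = ℚ.≤-reflexive (sym (trans (cong (λ t → 1ℚ + (t + t) * y) ι-0) (trans (cong (1ℚ +_) (ℚ.*-zeroˡ y)) refl)))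
      1+y-pow (suc k) k<w = ℚ.≤-trans (*-monoˡ-≤ (0≤+ 0≤1 0≤y) (1+y-pow k (ℕ.<⇒≤ k<w)))
          (≤-by (0≤* 0≤y (≤⇒0≤- 2ky≤1)) (trans (cong (λ t → 1ℚ + (t + t) * y - (1ℚ + y) * (1ℚ + (ι k + ι k) * y)) (ι-suc k)) (eq (ι k) y)))
        where
        eq : ∀ k y → 1ℚ + (1ℚ + k + (1ℚ + k)) * y - (1ℚ + y) * (1ℚ + (k + k) * y) ≡ y * (1ℚ - (k + k) * y)
        eq = solve-∀ ring
        2k≤16w : k ℕ.+ k ℕ.≤ 16w
        2k≤16w = ℕ.≤-trans (ℕ.+-mono-≤ (ℕ.<⇒≤ k<w) (ℕ.<⇒≤ k<w)) (ℕ.≤-trans (ℕ.≤-reflexive (cong (w ℕ.+_) (sym (ℕ.+-identityʳ w)))) (ℕ.*-monoˡ-≤ w {2} {16} (ℕ.s≤s (ℕ.s≤s ℕ.z≤n))))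
        2ky≤1 : (ι k + ι k) * y ≤ 1ℚ
        2ky≤1 = subst₂ _≤_ (cong (_* y) (ι-+ k k)) 16wy≡1 (*-monoʳ-≤ 0≤y (ι-mono 2k≤16w))

      small : powℚ (1ℚ + y) w ≤ 1ℚ + ⅛
      small = ℚ.≤-trans (1+y-pow w ℕ.≤-refl) (ℚ.+-monoʳ-≤ 1ℚ (ℚ.≤-reflexive 2wy≡⅛))
        where
        eq : ∀ a y → (a + a) * y ≡ ⅛ * ((ℤ.+ 16 ℚ./ 1) * a * y)
        eq = solve-∀ ring
        2wy≡⅛ : (ι w + ι w) * y ≡ ⅛
        2wy≡⅛ = trans (eq (ι w) y) (trans (cong (λ t → ⅛ * (t * y)) (trans (cong (_* ι w) (sym (ι-def 16))) (sym (ι-* 16 w))))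
          (trans (cong (⅛ *_) 16wy≡1) (ℚ.*-identityʳ ⅛)))

    module _ {n} (F : List (PTerm n)) (narrow : Narrow w F) where

      degree : PTerm n → ℕ
      degree Y = length (filterᵇ (Y ⊆ᵇ_) F)

      -- The bound falls by a factor `threshold` per literal. For `∅` heaviness says exactly that
      -- the list is too long, so the search for a maximal assignment starts there.
      Heavy : PTerm n → Set
      Heavy Y = threshold ℕ.^ (w ℕ.∸ size Y) ℕ.< degree Y

      Maximal : PTerm n → Set
      Maximal Y = ∀ Y′ → (Y ⊆ᵇ Y′) ≡ true → size Y ℕ.< size Y′ → degree Y′ ℕ.≤ threshold ℕ.^ (w ℕ.∸ size Y′)

      -- A heavy extension is strictly larger and no assignment has more than `n` literals, so `d`
      -- bounds the number of extensions still to come.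
      maximal-above : ∀ d Y → n ℕ.≤ size Y ℕ.+ d → Heavy Y → ∃ λ Y → Heavy Y × Maximal Y
      maximal-above d Y fuel heavy
        with ∃? (λ Y′ → ((Y ⊆ᵇ Y′) Bool.≟ true) ×-dec (size Y ℕ.<? size Y′) ×-dec (threshold ℕ.^ (w ℕ.∸ size Y′) ℕ.<? degree Y′))
      ... | no ¬∃ = Y , heavy , λ Y′ sub lt → ℕ.≮⇒≥ (λ h → ¬∃ (Y′ , sub , lt , h))
      maximal-above zero    Y fuel heavy | yes (Y′ , _ , lt , _) =
        ⊥-elim (ℕ.<-irrefl refl (ℕ.<-≤-trans lt (ℕ.≤-trans (size-≤ Y′) (subst (n ℕ.≤_) (ℕ.+-identityʳ (size Y)) fuel))))
      maximal-above (suc d) Y fuel heavy | yes (Y′ , _ , lt , h) =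
        maximal-above d Y′ (ℕ.≤-trans fuel (ℕ.≤-trans (ℕ.≤-reflexive (ℕ.+-suc (size Y) d)) (ℕ.+-monoˡ-≤ d lt))) h

      degree-∅ : degree ∅ ≡ length F
      degree-∅ = go F
        where
        go : ∀ H → length (filterᵇ (∅ ⊆ᵇ_) H) ≡ length H
        go []  = refl
        go (T ∷ H) rewrite ∅⊆ T = cong suc (go H)

      exists-maximal : threshold ℕ.^ w ℕ.< length F → ∃ λ Y → Heavy Y × Maximal Y
      exists-maximal large = maximal-above n ∅ (ℕ.m≤n+m n (size (∅ {n})))
        (subst₂ ℕ._<_ (cong (λ k → threshold ℕ.^ (w ℕ.∸ k)) (sym (size-∅ n))) (sym degree-∅) large)

      -- Serves both approximators. The lower one deletes `petal`, so `quasi` speaks of the terms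
      -- left in `rest`. The upper one replaces all terms above the kernel by the kernel, and
      -- `nonempty` guarantees that there are at least two of them, so that the list gets shorter.
      record QuasiSunflower : Set where
        field
          kernel  : PTerm n
          petal  : PTerm n
          rest  : List (PTerm n)
          removed  : Remove petal F rest
          kernel⊆petal  : (kernel ⊆ᵇ petal) ≡ true
          nonempty  : 1 ℕ.≤ length (filterᵇ (kernel ⊆ᵇ_) rest)
          quasi  : avg (cube n) (λ x → ind (sat kernel x ∧ none (filterᵇ (kernel ⊆ᵇ_) rest) x)) ≤ powℚ ½ Q

      -- Since Y is heavy with a strict inequality, dropping one term of F containing Y leaves at
      -- least threshold ^ (w ∸ size Y) of them, and maximality makes the rest spread around Y.
      module Link (Y : PTerm n) (heavy : Heavy Y) (maximal : Maximal Y) where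

        p : PTerm n → Bool
        p = Y ⊆ᵇ_

        split : ∃ λ T → ∃ λ F′ → Remove T F F′ × p T ≡ true × filterᵇ p F ≡ T ∷ filterᵇ p F′
        split = remove-filter p F (ℕ.≤-trans (ℕ.s≤s ℕ.z≤n) heavy)

        T₀ : PTerm n
        T₀ = proj₁ split

        F′ G link : List (PTerm n)
        F′ = proj₁ (proj₂ split)
        G = filterᵇ p F′
        link = map (_∖ Y) G

        F↝F′ : Remove T₀ F F′
        F↝F′ = proj₁ (proj₂ (proj₂ split))

        filter≡ : filterᵇ p F ≡ T₀ ∷ G
        filter≡ = proj₂ (proj₂ (proj₂ (proj₂ split)))

        G-big : threshold ℕ.^ (w ℕ.∸ size Y) ℕ.≤ length G
        G-big = ℕ.≤-pred (subst (λ l → suc (threshold ℕ.^ (w ℕ.∸ size Y)) ℕ.≤ l) (cong length filter≡) heavy)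

        1≤G : 1 ℕ.≤ length G
        1≤G = ℕ.≤-trans (ℕ.m^n>0 threshold (w ℕ.∸ size Y)) G-big

        G-All : All (λ T → size T ℕ.≤ w × (Y ⊆ᵇ T) ≡ true) G
        G-All = filter-All p (proj₂ (remove-All F↝F′ narrow))

        link-narrow : Narrow w link
        link-narrow = go G-All
          where
          go : ∀ {H} → All (λ T → size T ℕ.≤ w × (Y ⊆ᵇ T) ≡ true) H → Narrow w (map (_∖ Y) H)
          go []  = []
          go {T ∷ _} ((h , _) ∷ hs) = ℕ.≤-trans (∖-size Y T) h ∷ go hs

        link-length : length link ≡ length G
        link-length = length-map (_∖ Y) G

        codegree : PTerm n → ℕ
        codegree Z = length (filterᵇ (Z ⊆ᵇ_) link)

        codegree≡ : ∀ Z → codegree Z ≡ length (filterᵇ (λ T → Z ⊆ᵇ (T ∖ Y)) G)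
        codegree≡ Z = filter-map (Z ⊆ᵇ_) (_∖ Y) G

        codegree≤degree : ∀ Z → codegree Z ℕ.≤ degree (Y ∪ Z)
        codegree≤degree Z = begin
          codegree Z  ≡⟨ codegree≡ Z ⟩
          length (filterᵇ q G)  ≤⟨ grow ⟩
          length (filterᵇ q (T₀ ∷ G))  ≡⟨ cong (length ∘ filterᵇ q) (sym filter≡) ⟩
          length (filterᵇ q (filterᵇ p F))  ≤⟨ filter-filter p q ((Y ∪ Z) ⊆ᵇ_) (λ T → ∪-⊆ Y Z T) F ⟩
          degree (Y ∪ Z)  ∎
          where
          open ℕ.≤-Reasoning
          q : PTerm n → Bool
          q T = Z ⊆ᵇ (T ∖ Y)
          grow : length (filterᵇ q G) ℕ.≤ length (filterᵇ q (T₀ ∷ G))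
          grow with q T₀
          ... | true  = ℕ.n≤1+n _
          ... | false = ℕ.≤-refl

        spreadℕ : ∀ Z → threshold ℕ.^ size Z ℕ.* codegree Z ℕ.≤ length link
        spreadℕ Z with size Z in sz
        ... | zero  = ℕ.≤-trans (ℕ.≤-reflexive (ℕ.*-identityˡ _)) (filter-length (Z ⊆ᵇ_) link)
        -- A term containing both `Y` and `Z` bounds `size (Y ∪ Z)` by `w`, so the truncated
        -- differences in the exponents are exact. If there is no such term, the codegree vanishes.
        ... | suc k with filter-witness (λ T → Z ⊆ᵇ (T ∖ Y)) G-All
        ...   | inj₁ none₀ = ℕ.≤-trans (ℕ.≤-reflexive (trans (cong (threshold ℕ.^ suc k ℕ.*_) (trans (codegree≡ Z) none₀)) (ℕ.*-zeroʳ (threshold ℕ.^ suc k)))) ℕ.z≤n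
        ...   | inj₂ (T , (T≤w , Y⊆T) , Z⊆) = begin
          threshold ℕ.^ suc k ℕ.* codegree Z  ≤⟨ ℕ.*-monoʳ-≤ (threshold ℕ.^ suc k) (ℕ.≤-trans (codegree≤degree Z) (maximal (Y ∪ Z) (⊆-∪ Y Z) larger)) ⟩
          threshold ℕ.^ suc k ℕ.* threshold ℕ.^ (w ℕ.∸ size (Y ∪ Z))  ≡⟨ sym (ℕ.^-distribˡ-+-* threshold (suc k) (w ℕ.∸ size (Y ∪ Z))) ⟩
          threshold ℕ.^ (suc k ℕ.+ (w ℕ.∸ size (Y ∪ Z)))  ≡⟨ cong (threshold ℕ.^_) exponent ⟩
          threshold ℕ.^ (w ℕ.∸ size Y)  ≤⟨ G-big ⟩
          length G  ≡⟨ sym link-length ⟩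
          length link  ∎
          where
          open ℕ.≤-Reasoning
          size≡ : size (Y ∪ Z) ≡ size Y ℕ.+ suc k
          size≡ = trans (∪-size Y Z T Z⊆) (cong (size Y ℕ.+_) sz)
          larger : size Y ℕ.< size (Y ∪ Z)
          larger = subst (size Y ℕ.<_) (sym size≡) (ℕ.m<m+n (size Y) (ℕ.s≤s ℕ.z≤n))
          Y+k≤w : size Y ℕ.+ suc k ℕ.≤ w
          Y+k≤w = subst (ℕ._≤ w) size≡ (ℕ.≤-trans (⊆-size (Y ∪ Z) T (∪-⊆ Y Z T Y⊆T Z⊆)) T≤w)
          exponent : suc k ℕ.+ (w ℕ.∸ size (Y ∪ Z)) ≡ w ℕ.∸ size Y
          exponent = trans (cong (λ l → suc k ℕ.+ (w ℕ.∸ l)) (trans size≡ (ℕ.+-comm (size Y) (suc k))))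
                    (trans (sym (ℕ.+-∸-assoc (suc k) (subst (ℕ._≤ w) (ℕ.+-comm (size Y) (suc k)) Y+k≤w))) (ℕ.[m+n]∸[m+o]≡n∸o (suc k) w (size Y)))

        r : ℕ
        r = ℕ.pred (Q ℕ.+ Q)

        suc-r : suc r ≡ Q ℕ.+ Q
        suc-r = ℕ.suc-pred (Q ℕ.+ Q) {{ℕ.>-nonZero (ℕ.<-≤-trans (ℕ.>-nonZero⁻¹ Q) (ℕ.m≤m+n Q Q))}}

        open Moments r using (base)

        base≡ : base ≡ ι threshold * y
        base≡ = trans (cong (λ k → ι k + ι k) suc-r) (trans (cong₂ _+_ (ι-+ Q Q) (ι-+ Q Q))
          (trans (eq (ι Q)) (sym (trans (cong (_* y) (trans (cong ι nat) (ι-* (4 ℕ.* Q) 16w)))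
            (trans (ℚ.*-assoc (ι (4 ℕ.* Q)) (ι 16w) y) (trans (cong (ι (4 ℕ.* Q) *_) 16wy≡1) (trans (ℚ.*-identityʳ _) (trans (ι-* 4 Q) (cong (_* ι Q) (ι-def 4))))))))))
          where
          eq : ∀ q → q + q + (q + q) ≡ (ℤ.+ 4 ℚ./ 1) * q
          eq = solve-∀ ring
          nat : 64 ℕ.* (w ℕ.* Q) ≡ 4 ℕ.* Q ℕ.* (16 ℕ.* w)
          nat = natring w Q
            where
            natring : ∀ w Q → 64 ℕ.* (w ℕ.* Q) ≡ 4 ℕ.* Q ℕ.* (16 ℕ.* w)
            natring = ℕ-solve-∀

        spread : ∀ Z → powℚ base (size Z) * ι (codegree Z) ≤ ι (length link) * powℚ y (size Z)
        spread Z = subst (_≤ ι (length link) * powℚ y (size Z)) (sym rearrange)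
            (*-monoʳ-≤ (pow-≥0 (size Z) 0≤y) (subst (_≤ ι (length link)) (ι-* (threshold ℕ.^ size Z) (codegree Z)) (ι-mono (spreadℕ Z))))
          where
          eq : ∀ a b c → a * b * c ≡ a * c * b
          eq = solve-∀ ring
          rearrange : powℚ base (size Z) * ι (codegree Z) ≡ ι (threshold ℕ.^ size Z) * ι (codegree Z) * powℚ y (size Z)
          rearrange = trans (cong (_* ι (codegree Z)) (trans (cong (λ b → powℚ b (size Z)) base≡) (trans (pow-* (ι threshold) y (size Z)) (cong (_* powℚ y (size Z)) (sym (ι-^ threshold (size Z)))))))
            (eq (ι (threshold ℕ.^ size Z)) (powℚ y (size Z)) (ι (codegree Z)))

        link-none : ∀ x → sat Y x ≡ true → ∀ {H} → All (λ T → size T ℕ.≤ w × (Y ⊆ᵇ T) ≡ true) H → none H x ≡ true → none (map (_∖ Y) H) x ≡ true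
        link-none x satY []  h = refl
        link-none x satY {T ∷ H} ((_ , Y⊆T) ∷ hs) h with sat T x in eq | sat (T ∖ Y) x in eq′
        ... | false | false = link-none x satY hs h
        ... | false | true  with trans (sym eq) (sat-∖ Y T x Y⊆T satY eq′)
        ...   | ()

        -- Given `sat Y x`, satisfying a term of the link satisfies the term it comes from. The
        -- event is thus contained in missing the whole link, and no conditional probability
        -- appears.
        rare : avg (cube n) (λ x → ind (sat Y x ∧ none G x)) ≤ powℚ ½ Q
        rare = ℚ.≤-trans (mono (cube n) pointwise)
          (Boost.none-rare r link w y 0≤y link-narrow (0<ι (length link) {{ℕ.>-nonZero (subst (1 ℕ.≤_) (sym link-length) 1≤G)}}) spread small Q suc-r)
          where
          pointwise : ∀ x → ind (sat Y x ∧ none G x) ≤ ind (none link x)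
          pointwise x with sat Y x in e₁ | none G x in e₂
          ... | false | _  = 0≤ind (none link x)
          ... | true  | false = 0≤ind (none link x)
          ... | true  | true  = ℚ.≤-reflexive (cong ind (sym (link-none x e₁ G-All e₂)))

        quasiSunflower : QuasiSunflower
        quasiSunflower = record
          { kernel = Y ; petal = T₀ ; rest = F′ ; removed = F↝F′ ; kernel⊆petal = proj₁ (proj₂ (proj₂ (proj₂ split)))
          ; nonempty = 1≤G ; quasi = rare }

      abstract
        -- Abstract, so that later type checking never unfolds the search for a maximal assignment.
        sunflower : threshold ℕ.^ w ℕ.< length F → QuasiSunflower
        sunflower large = let (Y , heavy , maximal) = exists-maximal large in Link.quasiSunflower Y heavy maximal

-- Sparsification of a DNF from below and from above

module Sparsify where
  open import Data.Rational using (ℚ; 0ℚ; 1ℚ; ½; _+_; _*_; _-_; -_; _≤_; _<_; ∣_∣; _⊓_)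
  open Rationals
  open Averages
  open SecondMoment
  open Spread
  open Sunflower
  open Average

  _implies_ : ∀ {n} → List (PTerm n) → List (PTerm n) → Set
  F implies F′ = ∀ x → holds F x ≡ true → holds F′ x ≡ true

  error : ∀ {n} → List (PTerm n) → List (PTerm n) → ℚ
  error {n} F F′ = avg (cube n) (λ x → ind (holds F′ x xor holds F x))

  error-self : ∀ {n} (F : List (PTerm n)) → error F F ≡ 0ℚ
  error-self {n} F = trans (avg-cong (cube n) (λ x → cong ind (Bool.xor-same (holds F x)))) (const (cube n) 0ℚ)

  error-triangle : ∀ {n} (F₁ F₂ F₃ : List (PTerm n)) → error F₁ F₃ ≤ error F₁ F₂ + error F₂ F₃
  error-triangle {n} F₁ F₂ F₃ = ℚ.≤-trans (mono (cube n) (λ x → ind-xor-triangle (holds F₃ x) (holds F₂ x) (holds F₁ x)))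
    (ℚ.≤-reflexive (trans (add (cube n) _ _) (ℚ.+-comm (error F₂ F₃) (error F₁ F₂))))

  remove-holds : ∀ {n} {T : PTerm n} {F F′} → Remove T F F′ → ∀ x → holds F x ≡ sat T x ∨ holds F′ x
  remove-holds here  x = refl
  remove-holds {T = T} (there {y = U} {ys = F′} r) x = trans (cong (sat U x ∨_) (remove-holds r x)) (swap (sat U x) (sat T x) (holds F′ x))
    where
    swap : ∀ a b c → a ∨ (b ∨ c) ≡ b ∨ (a ∨ c)
    swap true  true  c = refl
    swap true  false c = refl
    swap false b  c = refl

  ¬holds⇒none : ∀ {n} p (F : List (PTerm n)) x → holds F x ≡ false → none (filterᵇ p F) x ≡ true
  ¬holds⇒none p []  x h = refl
  ¬holds⇒none p (T ∷ F) x h with p T | sat T x in e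
  ... | false | false = ¬holds⇒none p F x h
  ... | true  | false rewrite e = ¬holds⇒none p F x h

  filter-holds : ∀ {n} p (F : List (PTerm n)) x → holds F x ≡ false → holds (filterᵇ p F) x ≡ false
  filter-holds p []  x h = refl
  filter-holds p (T ∷ F) x h with p T | sat T x in e
  ... | false | false = filter-holds p F x h
  ... | true  | false rewrite e = filter-holds p F x h

  module _ {n w : ℕ} .{{_ : ℕ.NonZero w}} where

    -- The direction of the approximation is a parameter, so that both approximators share the
    -- descent below.
    Step : (List (PTerm n) → List (PTerm n) → Set) → Set
    Step _⊑_ = ∀ Q .{{_ : ℕ.NonZero Q}} (F : List (PTerm n)) → Narrow w F → threshold w Q ℕ.^ w ℕ.< length F →
      ∃ λ F′ → Narrow w F′ × length F′ ℕ.< length F × F ⊑ F′ × error F F′ ≤ powℚ ½ Q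

    -- Deleting `petal` matters only for inputs that satisfy it and nothing in `rest`; such an input
    -- satisfies the kernel and misses all other terms containing it.
    lower-step : Step (λ F F′ → F′ implies F)
    lower-step Q F narrow large = rest , proj₂ (remove-All removed narrow) , ℕ.≤-reflexive (sym (remove-length removed)) ,
        (λ x h → trans (remove-holds removed x) (trans (cong (sat petal x ∨_) h) (Bool.∨-zeroʳ (sat petal x)))) ,
        ℚ.≤-trans (mono (cube n) pointwise) quasi
      where
      open QuasiSunflower (sunflower w Q F narrow large)
      pointwise : ∀ x → ind (holds rest x xor holds F x) ≤ ind (sat kernel x ∧ none (filterᵇ (kernel ⊆ᵇ_) rest) x)
      pointwise x = go (holds rest x) (sat petal x) refl refl
        where
        B = sat kernel x ∧ none (filterᵇ (kernel ⊆ᵇ_) rest) x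
        go : ∀ a b → holds rest x ≡ a → sat petal x ≡ b → ind (holds rest x xor holds F x) ≤ ind B
        go true  b  ea eb = subst (λ t → ind t ≤ ind B) (sym (cong₂ _xor_ ea (trans (remove-holds removed x) (trans (cong (sat petal x ∨_) ea) (Bool.∨-zeroʳ (sat petal x)))))) (0≤ind B)
        go false false ea eb = subst (λ t → ind t ≤ ind B) (sym (cong₂ _xor_ ea (trans (remove-holds removed x) (cong₂ _∨_ eb ea)))) (0≤ind B)
        go false true  ea eb = subst (λ t → ind (holds rest x xor holds F x) ≤ ind t)
          (sym (∧-intro (⊆-sat kernel petal x kernel⊆petal eb) (¬holds⇒none (kernel ⊆ᵇ_) rest x ea))) (ind≤1 (holds rest x xor holds F x))

    -- The kernel is weaker than the terms it replaces, so the function can only grow, and it does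
    -- so only on inputs that satisfy the kernel but no term of the list.
    upper-step : Step _implies_
    upper-step Q F narrow large = F′ , narrow′ , shorter , implied , ℚ.≤-trans (mono (cube n) pointwise) quasi
      where
      open QuasiSunflower (sunflower w Q F narrow large)
      p : PTerm n → Bool
      p = kernel ⊆ᵇ_
      F′ : List (PTerm n)
      F′ = kernel ∷ filterᵇ (not ∘ p) F
      narrow′ : Narrow w F′
      narrow′ = ℕ.≤-trans (⊆-size kernel petal kernel⊆petal) (proj₁ (remove-All removed narrow)) ∷ All.map proj₁ (filter-All (not ∘ p) narrow)
      two : ∀ {F rest} → Remove petal F rest → suc (length (filterᵇ p rest)) ℕ.≤ length (filterᵇ p F)
      two here rewrite kernel⊆petal = ℕ.≤-refl
      two (there {y = U} r) with p U
      ... | true  = ℕ.s≤s (two r)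
      ... | false = two r
      shorter : length F′ ℕ.< length F
      shorter = subst (suc (length F′) ℕ.≤_) (filter-complement p F) (ℕ.+-monoˡ-≤ (length (filterᵇ (not ∘ p) F)) (ℕ.≤-trans (ℕ.s≤s nonempty) (two removed)))
      implied : F implies F′
      implied x = go F
        where
        go : ∀ H → holds H x ≡ true → sat kernel x ∨ holds (filterᵇ (not ∘ p) H) x ≡ true
        go (T ∷ H) h with sat T x in eT | p T in ep
        ... | true  | true  rewrite ⊆-sat kernel T x ep eT = refl
        ... | true  | false rewrite eT = Bool.∨-zeroʳ (sat kernel x)
        ... | false | true  = go H h
        ... | false | false rewrite eT = go H h
      pointwise : ∀ x → ind (holds F′ x xor holds F x) ≤ ind (sat kernel x ∧ none (filterᵇ p rest) x)
      pointwise x = go (holds F x) (sat kernel x) refl refl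
        where
        B = sat kernel x ∧ none (filterᵇ p rest) x
        rest-false : holds F x ≡ false → holds rest x ≡ false
        rest-false h with holds rest x in e
        ... | false = refl
        ... | true  with trans (sym h) (trans (remove-holds removed x) (trans (cong (sat petal x ∨_) e) (Bool.∨-zeroʳ (sat petal x))))
        ...   | ()
        go : ∀ a b → holds F x ≡ a → sat kernel x ≡ b → ind (holds F′ x xor holds F x) ≤ ind B
        go true  b  ea eb = subst (λ t → ind t ≤ ind B) (sym (cong₂ _xor_ (implied x ea) ea)) (0≤ind B)
        go false false ea eb = subst (λ t → ind t ≤ ind B) (sym (cong₂ _xor_ (cong₂ _∨_ eb (filter-holds (not ∘ p) F x ea)) ea)) (0≤ind B)
        go false true  ea eb = subst (λ t → ind (holds F′ x xor holds F x) ≤ ind t)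
          (sym (∧-intro eb (¬holds⇒none p rest x (rest-false ea)))) (ind≤1 (holds F′ x xor holds F x))

  -- Phase j reduces the number of terms from cap w (j + 1) to cap w j, with error 2^(- rounds w j) per
  -- step, hence 2^(- j) altogether.
  rounds : ℕ → ℕ → ℕ
  rounds w j = 16 ℕ.* (w ℕ.* w) ℕ.* j

  cap : ℕ → ℕ → ℕ
  cap w j = (64 ℕ.* (w ℕ.* rounds w j)) ℕ.^ w

  n≤2^n : ∀ n → n ℕ.≤ 2 ℕ.^ n
  n≤2^n n = ℕ.<⇒≤ (go n)
    where
    go : ∀ n → n ℕ.< 2 ℕ.^ n
    go zero    = ℕ.s≤s ℕ.z≤n
    go (suc n) = subst (suc (suc n) ℕ.≤_) (cong (2 ℕ.^ n ℕ.+_) (sym (ℕ.+-identityʳ (2 ℕ.^ n)))) (ℕ.+-mono-≤ (ℕ.m^n>0 2 n) (go n))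

  -- The origin of the constant 16 in `rounds`. With `a = w j` each of `w` and `j + 1` is at most
  -- `2^a`, so the base `2^10 w³ (j + 1)` of the cap is at most `2^(14a)`. Its power `w` takes
  -- `14 w² j` bits, and the factor `2^j` at most `w² j` more.
  cap-bound : ∀ w j .{{_ : ℕ.NonZero w}} .{{_ : ℕ.NonZero j}} → cap w (suc j) ℕ.* 2 ℕ.^ j ℕ.≤ 2 ℕ.^ rounds w j
  cap-bound w j = begin
    (64 ℕ.* (w ℕ.* (16 ℕ.* (w ℕ.* w) ℕ.* suc j))) ℕ.^ w ℕ.* 2 ℕ.^ j  ≡⟨ cong (λ t → t ℕ.^ w ℕ.* 2 ℕ.^ j) (eq₁ w (suc j)) ⟩
    (2 ℕ.^ 10 ℕ.* (w ℕ.* w ℕ.* w ℕ.* suc j)) ℕ.^ w ℕ.* 2 ℕ.^ j  ≤⟨ ℕ.*-mono-≤ (ℕ.^-monoˡ-≤ w inner) (ℕ.^-monoʳ-≤ 2 j≤wwj) ⟩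
    (2 ℕ.^ (14 ℕ.* (w ℕ.* j))) ℕ.^ w ℕ.* 2 ℕ.^ (w ℕ.* (w ℕ.* j))  ≡⟨ cong (ℕ._* 2 ℕ.^ (w ℕ.* (w ℕ.* j))) (ℕ.^-*-assoc 2 (14 ℕ.* (w ℕ.* j)) w) ⟩
    2 ℕ.^ (14 ℕ.* (w ℕ.* j) ℕ.* w) ℕ.* 2 ℕ.^ (w ℕ.* (w ℕ.* j))  ≡⟨ sym (ℕ.^-distribˡ-+-* 2 (14 ℕ.* (w ℕ.* j) ℕ.* w) (w ℕ.* (w ℕ.* j))) ⟩
    2 ℕ.^ (14 ℕ.* (w ℕ.* j) ℕ.* w ℕ.+ w ℕ.* (w ℕ.* j))  ≤⟨ ℕ.^-monoʳ-≤ 2 (ℕ.≤-trans (ℕ.≤-reflexive (eq₂ w j)) (ℕ.≤-trans (ℕ.m≤m+n _ (w ℕ.* w ℕ.* j)) (ℕ.≤-reflexive (eq₃ w j)))) ⟩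
    2 ℕ.^ rounds w j  ∎
    where
    open ℕ.≤-Reasoning
    eq₁ : ∀ w s → 64 ℕ.* (w ℕ.* (16 ℕ.* (w ℕ.* w) ℕ.* s)) ≡ 1024 ℕ.* (w ℕ.* w ℕ.* w ℕ.* s)
    eq₁ = ℕ-solve-∀
    eq₂ : ∀ w j → 14 ℕ.* (w ℕ.* j) ℕ.* w ℕ.+ w ℕ.* (w ℕ.* j) ≡ 15 ℕ.* (w ℕ.* w ℕ.* j)
    eq₂ = ℕ-solve-∀
    eq₃ : ∀ w j → 15 ℕ.* (w ℕ.* w ℕ.* j) ℕ.+ w ℕ.* w ℕ.* j ≡ 16 ℕ.* (w ℕ.* w) ℕ.* j
    eq₃ = ℕ-solve-∀
    instance
      wj≢0 : ℕ.NonZero (w ℕ.* j)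
      wj≢0 = ℕ.m*n≢0 w j
    a : ℕ
    a = w ℕ.* j
    j≤wwj : j ℕ.≤ w ℕ.* (w ℕ.* j)
    j≤wwj = ℕ.≤-trans (ℕ.m≤n*m j w) (ℕ.m≤n*m (w ℕ.* j) w)
    w≤ : w ℕ.≤ 2 ℕ.^ a
    w≤ = ℕ.≤-trans (ℕ.m≤m*n w j) (n≤2^n a)
    j+1≤ : suc j ℕ.≤ 2 ℕ.^ a
    j+1≤ = ℕ.≤-trans (1+n≤2^n j) (ℕ.^-monoʳ-≤ 2 (ℕ.m≤n*m j w))
      where
      1+n≤2^n : ∀ n → suc n ℕ.≤ 2 ℕ.^ n
      1+n≤2^n zero    = ℕ.≤-refl
      1+n≤2^n (suc n) = subst (suc (suc n) ℕ.≤_) (cong (2 ℕ.^ n ℕ.+_) (sym (ℕ.+-identityʳ (2 ℕ.^ n)))) (ℕ.+-mono-≤ (ℕ.m^n>0 2 n) (1+n≤2^n n))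
    2^10≤ : 2 ℕ.^ 10 ℕ.≤ 2 ℕ.^ (10 ℕ.* a)
    2^10≤ = ℕ.^-monoʳ-≤ 2 (ℕ.m≤m*n 10 a)
    inner : 2 ℕ.^ 10 ℕ.* (w ℕ.* w ℕ.* w ℕ.* suc j) ℕ.≤ 2 ℕ.^ (14 ℕ.* a)
    inner = ℕ.≤-trans (ℕ.*-mono-≤ 2^10≤ (ℕ.*-mono-≤ (ℕ.*-mono-≤ (ℕ.*-mono-≤ w≤ w≤) w≤) j+1≤)) (ℕ.≤-reflexive (trans
        (cong (λ t → 2 ℕ.^ (10 ℕ.* a) ℕ.* t) (trans (cong (ℕ._* 2 ℕ.^ a) (trans (cong (ℕ._* 2 ℕ.^ a) (sym (ℕ.^-distribˡ-+-* 2 a a))) (sym (ℕ.^-distribˡ-+-* 2 (a ℕ.+ a) a)))) (sym (ℕ.^-distribˡ-+-* 2 (a ℕ.+ a ℕ.+ a) a))))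
        (trans (sym (ℕ.^-distribˡ-+-* 2 (10 ℕ.* a) (a ℕ.+ a ℕ.+ a ℕ.+ a))) (cong (2 ℕ.^_) (eq₄ a)))))
      where
      eq₄ : ∀ a → 10 ℕ.* a ℕ.+ (a ℕ.+ a ℕ.+ a ℕ.+ a) ≡ 14 ℕ.* a
      eq₄ = ℕ-solve-∀

  pow½-2^ : ∀ k → powℚ ½ k * ι (2 ℕ.^ k) ≡ 1ℚ
  pow½-2^ k = trans (cong (powℚ ½ k *_) (ι-^ 2 k)) (trans (sym (pow-* ½ (ι 2) k)) (trans (cong (λ t → powℚ (½ * t) k) (ι-def 2)) (pow-1 k)))

  cap-boundℚ : ∀ w j .{{_ : ℕ.NonZero w}} .{{_ : ℕ.NonZero j}} → ι (cap w (suc j)) * powℚ ½ (rounds w j) ≤ powℚ ½ j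
  cap-boundℚ w j = *-cancelʳ-≤ (0<* (0<ι (2 ℕ.^ j) {{ℕ.m^n≢0 2 j}}) (0<ι (2 ℕ.^ rounds w j) {{ℕ.m^n≢0 2 (rounds w j)}}))
    (subst₂ _≤_ (sym left) (sym right) (subst (_≤ ι (2 ℕ.^ rounds w j)) (ι-* (cap w (suc j)) (2 ℕ.^ j)) (ι-mono (cap-bound w j))))
    where
    H = powℚ ½ (rounds w j)
    A = ι (cap w (suc j))
    C = ι (2 ℕ.^ rounds w j)
    D = ι (2 ℕ.^ j)
    e₁ : ∀ A H D C → A * H * (D * C) ≡ A * D * (H * C)
    e₁ = solve-∀ ring
    e₂ : ∀ h D C → h * (D * C) ≡ C * (h * D)
    e₂ = solve-∀ ring
    left : A * H * (D * C) ≡ A * D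
    left = trans (e₁ A H D C) (trans (cong (A * D *_) (pow½-2^ (rounds w j))) (ℚ.*-identityʳ (A * D)))
    right : powℚ ½ j * (D * C) ≡ C
    right = trans (e₂ (powℚ ½ j) D C) (trans (cong (C *_) (pow½-2^ j)) (ℚ.*-identityʳ C))

  -- The caps are unbounded, so a list of any length fits under one of them and the descent has a
  -- starting point.
  j≤cap : ∀ w j .{{_ : ℕ.NonZero w}} → j ℕ.≤ cap w j
  j≤cap w zero    = ℕ.z≤n
  j≤cap w@(suc w-1) j@(suc _) = ℕ.≤-trans j≤base (ℕ.m≤m*n b (b ℕ.^ w-1) {{ℕ.m^n≢0 b w-1}})
    where
    b : ℕ
    b = 64 ℕ.* (w ℕ.* rounds w j)
    instance
      ww≢0 : ℕ.NonZero (16 ℕ.* (w ℕ.* w))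
      ww≢0 = ℕ.m*n≢0 16 (w ℕ.* w)
      r≢0 : ℕ.NonZero (rounds w j)
      r≢0 = ℕ.m*n≢0 (16 ℕ.* (w ℕ.* w)) j
      wr≢0 : ℕ.NonZero (w ℕ.* rounds w j)
      wr≢0 = ℕ.m*n≢0 w (rounds w j)
      b≢0 : ℕ.NonZero b
      b≢0 = ℕ.m*n≢0 64 (w ℕ.* rounds w j)
    j≤base : j ℕ.≤ b
    j≤base = ℕ.≤-trans (ℕ.m≤n*m j (16 ℕ.* (w ℕ.* w))) (ℕ.≤-trans (ℕ.m≤n*m (rounds w j) w) (ℕ.m≤n*m (w ℕ.* rounds w j) 64))

  module _ {n w : ℕ} .{{_ : ℕ.NonZero w}} (_⊑_ : List (PTerm n) → List (PTerm n) → Set)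
           (⊑-refl : ∀ F → F ⊑ F) (⊑-trans : ∀ {F₁ F₂ F₃} → F₁ ⊑ F₂ → F₂ ⊑ F₃ → F₁ ⊑ F₃)
           (step : Step {n} {w} _⊑_) where

    Sparse : List (PTerm n) → ℕ → ℚ → Set
    Sparse F M e = ∃ λ F′ → Narrow w F′ × length F′ ℕ.≤ M × F ⊑ F′ × error F F′ ≤ e

    stay : ∀ F {M e} → Narrow w F → length F ℕ.≤ M → 0ℚ ≤ e → Sparse F M e
    stay F {e = e} narrow short 0≤e = F , narrow , short , ⊑-refl F , subst (_≤ e) (sym (error-self F)) 0≤e

    compose : ∀ {F F₁ M e₁ e₂} → F ⊑ F₁ → error F F₁ ≤ e₁ → Sparse F₁ M e₂ → Sparse F M (e₁ + e₂)
    compose {F} {F₁} F⊑ err (F₂ , narrow , short , F₁⊑ , err′) =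
      F₂ , narrow , short , ⊑-trans F⊑ F₁⊑ , ℚ.≤-trans (error-triangle F F₁ F₂) (ℚ.+-mono-≤ err err′)

    weaken : ∀ {F M e e′} → e ≤ e′ → Sparse F M e → Sparse F M e′
    weaken e≤e′ (F′ , narrow , short , F⊑ , err) = F′ , narrow , short , F⊑ , ℚ.≤-trans err e≤e′

    -- `k` bounds the length and hence the number of steps, each of which costs `½ ^ Q` and shortens
    -- the list.
    phase : ∀ Q .{{_ : ℕ.NonZero Q}} k F → Narrow w F → length F ℕ.≤ k → Sparse F (threshold w Q ℕ.^ w) (ι k * powℚ ½ Q)
    phase Q k F narrow short with length F ℕ.≤? threshold w Q ℕ.^ w
    ... | yes le = stay F narrow le (0≤* (0≤ι k) (pow-≥0 Q 0≤½))
    phase Q zero    F narrow short | no ≰ = stay F narrow (ℕ.≤-trans short ℕ.z≤n) (0≤* (0≤ι 0) (pow-≥0 Q 0≤½))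
    phase Q (suc k) F narrow short | no ≰ =
      let (F₁ , narrow₁ , shorter , F⊑F₁ , err) = step Q F narrow (ℕ.≰⇒> ≰) in
      weaken (ℚ.≤-reflexive (trans (eq (ι k) (powℚ ½ Q)) (cong (_* powℚ ½ Q) (sym (ι-suc k)))))
        (compose F⊑F₁ err (phase Q k F₁ narrow₁ (ℕ.≤-pred (ℕ.≤-trans shorter short))))
      where
      eq : ∀ k h → h + k * h ≡ (1ℚ + k) * h
      eq = solve-∀ ring

    -- Phase `j` costs at most `½ ^ j`. The difference in the bound is the sum of these costs for
    -- `J < j ≤ J + d`, which stays below `½ ^ J` for every `d`.
    descend : ∀ J d F → Narrow w F → length F ℕ.≤ cap w (suc (J ℕ.+ d)) → Sparse F (cap w (suc J)) (powℚ ½ J - powℚ ½ (J ℕ.+ d))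
    descend J zero    F narrow short = stay F narrow (subst (λ i → length F ℕ.≤ cap w (suc i)) (ℕ.+-identityʳ J) short)
      (ℚ.≤-reflexive (sym (trans (cong (λ i → powℚ ½ J - powℚ ½ i) (ℕ.+-identityʳ J)) (ℚ.+-inverseʳ (powℚ ½ J)))))
    descend J (suc d) F narrow short =
      let (F₁ , narrow₁ , short₁ , F⊑F₁ , err) = phase (rounds w j) (cap w (suc j)) F narrow (subst (λ i → length F ℕ.≤ cap w (suc i)) (ℕ.+-suc J d) short) in
      weaken (ℚ.≤-reflexive (trans (eq (powℚ ½ J) (powℚ ½ (J ℕ.+ d))) (cong (λ i → powℚ ½ J - powℚ ½ i) (sym (ℕ.+-suc J d)))))
        (compose F⊑F₁ (ℚ.≤-trans err (cap-boundℚ w j)) (descend J d F₁ narrow₁ short₁))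
      where
      j : ℕ
      j = suc (J ℕ.+ d)
      instance
        ww≢0 : ℕ.NonZero (w ℕ.* w)
        ww≢0 = ℕ.m*n≢0 w w
        16ww≢0 : ℕ.NonZero (16 ℕ.* (w ℕ.* w))
        16ww≢0 = ℕ.m*n≢0 16 (w ℕ.* w)
        r≢0 : ℕ.NonZero (rounds w j)
        r≢0 = ℕ.m*n≢0 (16 ℕ.* (w ℕ.* w)) j
      eq : ∀ a h → ½ * h + (a - h) ≡ a - ½ * h
      eq = solve-∀ ring

    sparsify : ∀ J F → Narrow w F → Sparse F (cap w (suc J)) (powℚ ½ J)
    sparsify J F narrow = weaken (≤-by (pow-≥0 (J ℕ.+ length F) 0≤½) (eq (powℚ ½ J) (powℚ ½ (J ℕ.+ length F))))
      (descend J (length F) F narrow (ℕ.≤-trans (ℕ.m≤n⇒m≤1+n (ℕ.m≤n+m (length F) J)) (j≤cap w (suc (J ℕ.+ length F)))))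
      where
      eq : ∀ a h → a - (a - h) ≡ h
      eq = solve-∀ ring

  module _ {n w : ℕ} .{{_ : ℕ.NonZero w}} (J : ℕ) (F : List (PTerm n)) (narrow : Narrow w F) where

    abstract
      sparse-lower : ∃ λ F′ → Narrow w F′ × length F′ ℕ.≤ cap w (suc J) × F′ implies F × error F F′ ≤ powℚ ½ J
      sparse-lower = sparsify (λ F F′ → F′ implies F) (λ F x h → h) (λ f g x h → f x (g x h)) lower-step J F narrow

      sparse-upper : ∃ λ F′ → Narrow w F′ × length F′ ℕ.≤ cap w (suc J) × F implies F′ × error F F′ ≤ powℚ ½ J
      sparse-upper = sparsify _implies_ (λ F x h → h) (λ f g x h → g x (f x h)) upper-step J F narrow

-- Normalised terms, restrictions and live variables

module Restrict where
  open import Data.Rational using (ℚ; 0ℚ; 1ℚ; ½; _+_; _*_; _-_; -_; _≤_; _<_; ∣_∣; _⊓_)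
  open Rationals
  open Averages
  open SecondMoment
  open Spread
  open Sunflower
  open Sparsify
  open Average

  assign : ∀ {n} → Fin n → Bool → PTerm n → Maybe (PTerm n)
  assign zero    b (nothing ∷ T) = just (just b ∷ T)
  assign zero    b (just a ∷ T)  = if agree a b then just (just a ∷ T) else nothing
  assign (suc i) b (t ∷ T)  = Maybe.map (t ∷_) (assign i b T)

  -- Repeated literals are merged, and `nothing` stands for a contradictory term. Such a term is
  -- never satisfied, so `normalise` may drop it.
  consistent : ∀ {n} → Term (Fin n) → Maybe (PTerm n)
  consistent []  = just ∅
  consistent ((v , b) ∷ t) = consistent t >>= assign v b

  satM : ∀ {n} → Maybe (PTerm n) → Vec Bool n → Bool
  satM nothing  x = false
  satM (just T) x = sat T x

  sat-∅ : ∀ {n} (x : Vec Bool n) → sat ∅ x ≡ true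
  sat-∅ []  = refl
  sat-∅ (b ∷ x) = sat-∅ x

  assign-sat : ∀ {n} (v : Fin n) b T x → satM (assign v b T) x ≡ evalLiteral (lookup x) (v , b) ∧ sat T x
  assign-sat zero true  (nothing ∷ T)    (c ∷ x)  = refl
  assign-sat zero false (nothing ∷ T)    (c ∷ x)  = refl
  assign-sat zero true  (just true ∷ T)  (true ∷ x)  = refl
  assign-sat zero true  (just true ∷ T)  (false ∷ x) = refl
  assign-sat zero true  (just false ∷ T) (true ∷ x)  = refl
  assign-sat zero true  (just false ∷ T) (false ∷ x) = refl
  assign-sat zero false (just true ∷ T)  (true ∷ x)  = refl
  assign-sat zero false (just true ∷ T)  (false ∷ x) = refl
  assign-sat zero false (just false ∷ T) (true ∷ x)  = refl
  assign-sat zero false (just false ∷ T) (false ∷ x) = refl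
  assign-sat (suc v) b (t ∷ T) (c ∷ x) = trans (step t (assign v b T)) (trans (cong (head t ∧_) (assign-sat v b T x)) (swap t (evalLiteral (lookup x) (v , b))))
    where
    head : Maybe Bool → Bool
    head nothing  = true
    head (just a) = agree a c
    step : ∀ t m → satM (Maybe.map (t ∷_) m) (c ∷ x) ≡ head t ∧ satM m x
    step nothing  nothing  = refl
    step (just a) nothing  = sym (Bool.∧-zeroʳ (agree a c))
    step nothing  (just U) = refl
    step (just a) (just U) = refl
    swap : ∀ t l → head t ∧ (l ∧ sat T x) ≡ l ∧ sat (t ∷ T) (c ∷ x)
    swap nothing  l = refl
    swap (just a) l with agree a c | l
    ... | true  | _  = refl
    ... | false | true  = refl
    ... | false | false = refl

  consistent-sat : ∀ {n} (t : Term (Fin n)) x → satM (consistent t) x ≡ all (evalLiteral (lookup x)) t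
  consistent-sat []  x = sat-∅ x
  consistent-sat ((v , b) ∷ t) x with consistent t | consistent-sat t x
  ... | just T  | ih = trans (assign-sat v b T x) (cong (evalLiteral (lookup x) (v , b) ∧_) ih)
  ... | nothing | ih = trans (sym (Bool.∧-zeroʳ (evalLiteral (lookup x) (v , b)))) (cong (evalLiteral (lookup x) (v , b) ∧_) ih)

  SizeM : ∀ {n} → ℕ → Maybe (PTerm n) → Set
  SizeM w m = ∀ {T} → m ≡ just T → size T ℕ.≤ w

  assign-size : ∀ {n} (v : Fin n) b T → SizeM (suc (size T)) (assign v b T)
  assign-size zero    b (nothing ∷ T) refl = ℕ.≤-refl
  assign-size zero    b (just a ∷ T)  h with agree a b
  assign-size zero    b (just a ∷ T)  refl | true = ℕ.n≤1+n _
  assign-size (suc v) b (t ∷ T)  h with assign v b T | assign-size v b T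
  assign-size (suc v) b (nothing ∷ T) refl | just U | ih = ih refl
  assign-size (suc v) b (just a ∷ T)  refl | just U | ih = ℕ.s≤s (ih refl)

  consistent-size : ∀ {n} (t : Term (Fin n)) → SizeM (length t) (consistent t)
  consistent-size {n} []  refl = ℕ.≤-reflexive (size-∅ n)
  consistent-size ((v , b) ∷ t) h with consistent t | consistent-size t
  ... | just T | ih = ℕ.≤-trans (assign-size v b T h) (ℕ.s≤s (ih refl))

  normalise : ∀ {n} → DNF (Fin n) → List (PTerm n)
  normalise = mapMaybe consistent

  normalise-holds : ∀ {n} (φ : DNF (Fin n)) x → holds (normalise φ) x ≡ eval φ (lookup x)
  normalise-holds []  x = refl
  normalise-holds (t ∷ φ) x with consistent t | consistent-sat t x
  ... | just T  | e = cong₂ _∨_ e (normalise-holds φ x)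
  ... | nothing | e = cong₂ _∨_ e (normalise-holds φ x)

  normalise-narrow : ∀ {n} w (φ : DNF (Fin n)) → HasWidth (ℤ.+ w ℚ./ 1) φ → Narrow w (normalise φ)
  normalise-narrow w []  []  = []
  normalise-narrow w (t ∷ φ) (h ∷ hs) with consistent t | consistent-size t
  ... | just T  | e = ℕ.≤-trans (e refl) (ι-cancel (subst₂ _≤_ (sym (ι-def (length t))) (sym (ι-def w)) h)) ∷ normalise-narrow w φ hs
  ... | nothing | e = normalise-narrow w φ hs

  module _ {n} (r : Maybe Bool) {ρ : Restriction n} where

    liftVar : Var (live ρ) → Var (live (r ∷ ρ))
    liftVar (i , i∈) = suc i , Vec.there i∈

    liftTerm : Term (Var (live ρ)) → Term (Var (live (r ∷ ρ)))
    liftTerm = map (λ (v , b) → liftVar v , b)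

  restrict : ∀ {n} (ρ : Restriction n) → PTerm n → Maybe (Term (Var (live ρ)))
  restrict []  []  = just []
  restrict (nothing ∷ ρ) (nothing ∷ T) = Maybe.map (liftTerm nothing) (restrict ρ T)
  restrict (nothing ∷ ρ) (just b ∷ T)  = Maybe.map (λ t → ((zero , Vec.here) , b) ∷ liftTerm nothing t) (restrict ρ T)
  restrict (just a ∷ ρ)  (nothing ∷ T) = Maybe.map (liftTerm (just a)) (restrict ρ T)
  restrict (just a ∷ ρ)  (just b ∷ T)  = if agree b a then Maybe.map (liftTerm (just a)) (restrict ρ T) else nothing

  allM : ∀ {V : Set} → (V → Bool) → Maybe (Term V) → Bool
  allM a nothing  = false
  allM a (just t) = all (evalLiteral a) t

  lift-live : ∀ {n} {ρ : Restriction n} b (y : Cube (live ρ)) t → all (evalLiteral (coord (b ∷ y))) (liftTerm nothing {ρ} t) ≡ all (evalLiteral (coord y)) t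
  lift-live b y []  = refl
  lift-live b y (((i , i∈) , c) ∷ t) = cong (evalLiteral (coord y) ((i , i∈) , c) ∧_) (lift-live b y t)

  lift-fixed : ∀ {n} {ρ : Restriction n} a (y : Cube (live ρ)) t → all (evalLiteral (coord (skip y))) (liftTerm (just a) {ρ} t) ≡ all (evalLiteral (coord y)) t
  lift-fixed a y []  = refl
  lift-fixed a y (((i , i∈) , c) ∷ t) = cong (evalLiteral (coord y) ((i , i∈) , c) ∧_) (lift-fixed a y t)

  restrict-sat : ∀ {n} (ρ : Restriction n) T y → allM (coord y) (restrict ρ T) ≡ sat T (fill ρ y)
  restrict-sat []  []  []  = refl
  restrict-sat (nothing ∷ ρ) (nothing ∷ T) (c ∷ y)  with restrict ρ T | restrict-sat ρ T y
  ... | nothing | ih = ih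
  ... | just t  | ih = trans (lift-live c y t) ih
  restrict-sat (nothing ∷ ρ) (just b ∷ T)  (c ∷ y)  with restrict ρ T | restrict-sat ρ T y
  ... | nothing | ih = trans (sym (Bool.∧-zeroʳ (agree b c))) (cong (agree b c ∧_) ih)
  ... | just t  | ih = cong₂ _∧_ (literal b) (trans (lift-live c y t) ih)
    where
    literal : ∀ b → (if b then c else not c) ≡ agree b c
    literal true  = refl
    literal false = refl
  restrict-sat (just a ∷ ρ)  (nothing ∷ T) (skip y) with restrict ρ T | restrict-sat ρ T y
  ... | nothing | ih = ih
  ... | just t  | ih = trans (lift-fixed a y t) ih
  restrict-sat (just a ∷ ρ)  (just b ∷ T)  (skip y) with agree b a
  ... | false = refl
  ... | true with restrict ρ T | restrict-sat ρ T y
  ...   | nothing | ih = ih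
  ...   | just t  | ih = trans (lift-fixed a y t) ih

  liveSize : ∀ {n} → Subset n → PTerm n → ℕ
  liveSize []  []  = 0
  liveSize (inside ∷ L)  (just _ ∷ T)  = suc (liveSize L T)
  liveSize (inside ∷ L)  (nothing ∷ T) = liveSize L T
  liveSize (outside ∷ L) (t ∷ T)  = liveSize L T

  restrict-length : ∀ {n} (ρ : Restriction n) T {t} → restrict ρ T ≡ just t → length t ℕ.≤ liveSize (live ρ) T
  restrict-length []  []  refl = ℕ.z≤n
  restrict-length (nothing ∷ ρ) (nothing ∷ T) h with restrict ρ T | restrict-length ρ T
  restrict-length (nothing ∷ ρ) (nothing ∷ T) refl | just t | ih = ℕ.≤-trans (ℕ.≤-reflexive (length-map _ t)) (ih refl)
  restrict-length (nothing ∷ ρ) (just b ∷ T)  h with restrict ρ T | restrict-length ρ T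
  restrict-length (nothing ∷ ρ) (just b ∷ T)  refl | just t | ih = ℕ.s≤s (ℕ.≤-trans (ℕ.≤-reflexive (length-map _ t)) (ih refl))
  restrict-length (just a ∷ ρ)  (nothing ∷ T) h with restrict ρ T | restrict-length ρ T
  restrict-length (just a ∷ ρ)  (nothing ∷ T) refl | just t | ih = ℕ.≤-trans (ℕ.≤-reflexive (length-map _ t)) (ih refl)
  restrict-length (just a ∷ ρ)  (just b ∷ T)  h with agree b a
  ... | true with restrict ρ T | restrict-length ρ T
  restrict-length (just a ∷ ρ)  (just b ∷ T)  refl | true | just t | ih = ℕ.≤-trans (ℕ.≤-reflexive (length-map _ t)) (ih refl)

  restrictDNF : ∀ {n} (ρ : Restriction n) → List (PTerm n) → DNF (Var (live ρ))
  restrictDNF ρ = mapMaybe (restrict ρ)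

  restrictDNF-eval : ∀ {n} (ρ : Restriction n) F y → eval (restrictDNF ρ F) (coord y) ≡ holds F (fill ρ y)
  restrictDNF-eval ρ []  y = refl
  restrictDNF-eval ρ (T ∷ F) y with restrict ρ T | restrict-sat ρ T y
  ... | just t  | e = cong₂ _∨_ e (restrictDNF-eval ρ F y)
  ... | nothing | e = cong₂ _∨_ e (restrictDNF-eval ρ F y)

  restrictDNF-lengths : ∀ {n} (ρ : Restriction n) k {F} → All (λ T → liveSize (live ρ) T ℕ.≤ k) F → All (λ t → length t ℕ.≤ k) (restrictDNF ρ F)
  restrictDNF-lengths ρ k []  = []
  restrictDNF-lengths ρ k {T ∷ F} (h ∷ hs) with restrict ρ T | restrict-length ρ T
  ... | just t  | e = ℕ.≤-trans (e refl) h ∷ restrictDNF-lengths ρ k hs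
  ... | nothing | e = restrictDNF-lengths ρ k hs

  live-restriction : ∀ {n} (L : Subset n) x → live (restriction L x) ≡ L
  live-restriction []  []  = refl
  live-restriction (inside ∷ L)  (skip x) = cong (inside ∷_) (live-restriction L x)
  live-restriction (outside ∷ L) (b ∷ x)  = cong (outside ∷_) (live-restriction L x)

  subcube : ∀ {n} (L : Subset n) → Average (Cube L)
  subcube []  = point []
  subcube (inside ∷ L)  = transport (λ (b , y) → b ∷ y) (product bit (subcube L))
  subcube (outside ∷ L) = transport skip (subcube L)

  filter-++ : ∀ {A : Set} (p : A → Bool) xs ys → length (filterᵇ p (xs ++ ys)) ≡ length (filterᵇ p xs) ℕ.+ length (filterᵇ p ys)
  filter-++ p []  ys = refl
  filter-++ p (x ∷ xs) ys with p x
  ... | true  = cong suc (filter-++ p xs ys)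
  ... | false = filter-++ p xs ys

  subcube-count : ∀ {n} (L : Subset n) P → avg (subcube L) (ind ∘ P) * ι (2 ℕ.^ ∥ L ∥) ≡ ι (length (filterᵇ P (points L)))
  subcube-count [] P with P []
  ... | true  = trans (cong (1ℚ *_) ι-1) (sym ι-1)
  ... | false = trans (ℚ.*-zeroˡ (ι 1)) (sym ι-0)
  subcube-count (outside ∷ L) P = trans (subcube-count L (P ∘ skip)) (cong ι (sym (filter-map P skip (points L))))
  subcube-count (inside ∷ L)  P = begin
    ½ * (A false + A true) * ι (2 ℕ.^ suc ∥ L ∥)  ≡⟨ cong (½ * (A false + A true) *_) (trans (ι-* 2 (2 ℕ.^ ∥ L ∥)) (cong (_* N) (ι-def 2))) ⟩
    ½ * (A false + A true) * ((ℤ.+ 2 ℚ./ 1) * N)  ≡⟨ eq (A false) (A true) N ⟩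
    A false * N + A true * N  ≡⟨ cong₂ _+_ (half false) (half true) ⟩
    ι (C false) + ι (C true)  ≡⟨ sym (ι-+ (C false) (C true)) ⟩
    ι (C false ℕ.+ C true)  ≡⟨ cong ι (sym (filter-++ P (map (false ∷_) (points L)) (map (true ∷_) (points L)))) ⟩
    ι (length (filterᵇ P (points (inside ∷ L))))  ∎
    where
    open ≡-Reasoning
    A : Bool → ℚ
    A b = avg (subcube L) (λ y → ind (P (b ∷ y)))
    N : ℚ
    N = ι (2 ℕ.^ ∥ L ∥)
    C : Bool → ℕ
    C b = length (filterᵇ P (map (b ∷_) (points L)))
    half : ∀ b → A b * N ≡ ι (C b)
    half b = trans (subcube-count L (λ y → P (b ∷ y))) (cong ι (sym (filter-map P (b ∷_) (points L))))
    eq : ∀ a b N → ½ * (a + b) * ((ℤ.+ 2 ℚ./ 1) * N) ≡ a * N + b * N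
    eq = solve-∀ ring

  uniformPr-avg : ∀ {n} (L : Subset n) P → uniformPr L P ≡ avg (subcube L) (ind ∘ P)
  uniformPr-avg L P = *-cancelʳ-≡ (0<ι N) (trans (/-*-cancel (length (filterᵇ P (points L))) N) (sym (subcube-count L P)))
    where
    N : ℕ
    N = 2 ℕ.^ ∥ L ∥
    instance
      N≢0 : ℕ.NonZero N
      N≢0 = ℕ.m^n≢0 2 ∥ L ∥

  -- Fixed bits followed by live bits make up a uniform input. Hence for every `L` the mean error
  -- after a restriction equals the error before it.
  restriction-avg : ∀ {n} (L : Subset n) (g : Vec Bool n → ℚ) →
    avg (subcube (∁ L)) (λ x → avg (subcube (live (restriction L x))) (λ y → g (fill (restriction L x) y))) ≡ avg (cube n) g
  restriction-avg []  g = refl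
  restriction-avg (outside ∷ L) g = cong₂ (λ u v → ½ * (u + v)) (restriction-avg L (λ z → g (false ∷ z))) (restriction-avg L (λ z → g (true ∷ z)))
  restriction-avg (inside ∷ L)  g = trans (scale (subcube (∁ L)) ½ _) (cong (½ *_) (trans (add (subcube (∁ L)) _ _)
    (cong₂ _+_ (restriction-avg L (λ z → g (false ∷ z))) (restriction-avg L (λ z → g (true ∷ z))))))

  -- The sets of `h` variables of the term; they are the index sets of the union bound, and their
  -- number is estimated by `2 ^ size T` instead of a binomial coefficient.
  choose : ∀ {n} → PTerm n → ℕ → List (Subset n)
  choose []  zero    = [] ∷ []
  choose []  (suc h) = []
  choose (nothing ∷ T) h  = map (outside ∷_) (choose T h)
  choose (just _ ∷ T)  zero    = map (outside ∷_) (choose T zero)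
  choose (just _ ∷ T)  (suc h) = map (inside ∷_) (choose T h) ++ map (outside ∷_) (choose T (suc h))

  choose-size : ∀ {n} (T : PTerm n) h → All (λ I → ∥ I ∥ ≡ h) (choose T h)
  choose-size []  zero    = refl ∷ []
  choose-size []  (suc h) = []
  choose-size (nothing ∷ T) h  = All.map⁺ (choose-size T h)
  choose-size (just _ ∷ T)  zero    = All.map⁺ (choose-size T zero)
  choose-size (just _ ∷ T)  (suc h) = All.++⁺ (All.map⁺ (All.map (cong suc) (choose-size T h))) (All.map⁺ (choose-size T (suc h)))

  choose-length : ∀ {n} (T : PTerm n) h → length (choose T h) ℕ.≤ 2 ℕ.^ size T
  choose-length []  zero    = ℕ.≤-refl
  choose-length []  (suc h) = ℕ.z≤n
  choose-length (nothing ∷ T) h  = ℕ.≤-trans (ℕ.≤-reflexive (length-map _ (choose T h))) (choose-length T h)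
  choose-length (just _ ∷ T)  zero    = ℕ.≤-trans (ℕ.≤-reflexive (length-map _ (choose T zero))) (ℕ.≤-trans (choose-length T zero) (ℕ.m≤m+n _ _))
  choose-length (just _ ∷ T)  (suc h) = ℕ.≤-trans
    (ℕ.≤-reflexive (trans (length-++ (map (inside ∷_) (choose T h))) (cong₂ ℕ._+_ (length-map _ (choose T h)) (length-map _ (choose T (suc h))))))
    (ℕ.+-mono-≤ (choose-length T h) (ℕ.≤-trans (choose-length T (suc h)) (ℕ.≤-reflexive (sym (ℕ.+-identityʳ _)))))

  -- A greedy choice: the first `h` live variables of the term.
  choose-live : ∀ {n} (T : PTerm n) (L : Subset n) h → h ℕ.≤ liveSize L T → Any (_⊆ L) (choose T h)
  choose-live []  []  zero    _ = here (λ x → x)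
  choose-live (nothing ∷ T) (inside ∷ L)  h  k = Any.map⁺ (Any.map out⊆ (choose-live T L h k))
  choose-live (nothing ∷ T) (outside ∷ L) h  k = Any.map⁺ (Any.map out⊆ (choose-live T L h k))
  choose-live (just _ ∷ T)  (inside ∷ L)  zero    k = Any.map⁺ (Any.map out⊆ (choose-live T L zero ℕ.z≤n))
  choose-live (just _ ∷ T)  (outside ∷ L) zero    k = Any.map⁺ (Any.map out⊆ (choose-live T L zero ℕ.z≤n))
  choose-live (just _ ∷ T)  (inside ∷ L)  (suc h) k = Any.++⁺ˡ (Any.map⁺ (Any.map s⊆s (choose-live T L h (ℕ.≤-pred k))))
  choose-live (just _ ∷ T)  (outside ∷ L) (suc h) k = Any.++⁺ʳ (map (inside ∷_) (choose T h)) (Any.map⁺ (Any.map out⊆ (choose-live T L (suc h) k)))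

  live-sum : ∀ {n} (T : PTerm n) (L : Subset n) h → h ℕ.≤ liveSize L T → 1ℚ ≤ ΣL (λ I → ind (does (I ⊆? L))) (choose T h)
  live-sum T L h k = go (choose-live T L h k)
    where
    go : ∀ {Is} → Any (_⊆ L) Is → 1ℚ ≤ ΣL (λ I → ind (does (I ⊆? L))) Is
    go {I ∷ Is} (here I⊆L)  = subst₂ _≤_ (ℚ.+-identityʳ 1ℚ) (cong (λ b → ind b + ΣL (λ I → ind (does (I ⊆? L))) Is) (sym (dec-true (I ⊆? L) I⊆L)))
      (ℚ.+-monoʳ-≤ 1ℚ (ΣL-≥0 (λ I → 0≤ind (does (I ⊆? L))) Is))
    go {I ∷ Is} (there any) = subst (_≤ ind (does (I ⊆? L)) + ΣL (λ I → ind (does (I ⊆? L))) Is) (ℚ.+-identityˡ 1ℚ) (ℚ.+-mono-≤ (0≤ind (does (I ⊆? L))) (go any))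

-- The good restrictions and their probability

module Event where
  open import Data.Rational using (ℚ; 0ℚ; 1ℚ; ½; _+_; _*_; _-_; -_; _≤_; _<_; ∣_∣; _⊓_)
  open Rationals
  open Averages
  open SecondMoment
  open Spread
  open Sunflower
  open Sparsify
  open Restrict
  open Average

  T-split : ∀ a b → T (a ∧ b) → T a × T b
  T-split true b t = _ , t

  true⇒true⇒≤ : ∀ {a b} → (a ≡ true → b ≡ true) → a Bool.≤ b
  true⇒true⇒≤ {false} {false} _ = Bool.b≤b
  true⇒true⇒≤ {false} {true}  _ = Bool.f≤t
  true⇒true⇒≤ {true}  {b}  i = subst (true Bool.≤_) (sym (i refl)) Bool.b≤b

  markov : ∀ {A : Set} (𝒜 : Average A) (X : A → ℚ) e → (∀ a → 0ℚ ≤ X a) → 0ℚ ≤ e →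
           e * avg 𝒜 (λ a → ind (not (X a ℚ.≤ᵇ e))) ≤ avg 𝒜 X
  markov 𝒜 X e 0≤X 0≤e = subst (_≤ avg 𝒜 X) (scale 𝒜 e _) (mono 𝒜 pointwise)
    where
    pointwise : ∀ a → e * ind (not (X a ℚ.≤ᵇ e)) ≤ X a
    pointwise a with X a ℚ.≤ᵇ e in h
    ... | true  = subst (_≤ X a) (sym (ℚ.*-zeroʳ e)) (0≤X a)
    ... | false = subst (_≤ X a) (sym (ℚ.*-identityʳ e)) (ℚ.<⇒≤ (ℚ.≰⇒> λ le → subst T h (ℚ.≤⇒≤ᵇ le)))

  -- The weights a are rational approximations to reals, so their properties hold only up to η.
  union-bound : ∀ {A B : Set} (Ls : List A) (Is : List B) (a g : A → ℚ) (hit : B → A → ℚ) e η P →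
    0ℚ ≤ e → e ≤ 1ℚ → 0ℚ ≤ η →
    (∀ L → - η ≤ a L) → (∀ L → g L ≤ 1ℚ) → (∀ I L → hit I L ≤ 1ℚ) →
    1ℚ - η ≤ ΣL a Ls → All (λ I → ΣL (λ L → a L * hit I L) Ls ≤ P + η) Is →
    (∀ L → 1ℚ - ΣL (λ I → hit I L) Is - e ≤ g L) →
    let S = ι (length Ls) ; N = ι (length Is) in
    1ℚ - e - N * P - (1ℚ + S + N * (1ℚ + S)) * η ≤ ΣL (λ L → a L * g L) Ls
  union-bound Ls Is a g hit e η P 0≤e e≤1 0≤η a≥ g≤1 hit≤1 total each good = ≤-by
      (0≤+ (0≤+ (0≤+ (≤⇒0≤- lower) (0≤* (≤⇒0≤- e≤1) (≤⇒0≤- total))) (0≤+ (≤⇒0≤- hits) (≤⇒0≤- gsum))) (0≤+ (0≤* 0≤e 0≤η) (0≤* (≤⇒0≤- e≤1) (0≤* 0≤η (0≤ι (length Ls))))))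
      (trans (cong (_- (1ℚ - e - N * P - (1ℚ + S + N * (1ℚ + S)) * η)) split) (eq₀ e N P S η Σbg Σhit Σa Σg))
    where
    S N Σa Σg Σbg Σhit : ℚ
    S = ι (length Ls)
    N = ι (length Is)
    -- The shift by `η` makes the weights nonnegative, so that pointwise inequalities may be
    -- multiplied by them. It is undone at the price of `η` times the number of sets.
    b : _ → ℚ
    b L = a L + η
    0≤b : ∀ L → 0ℚ ≤ b L
    0≤b L = subst (_≤ b L) (ℚ.+-inverseˡ η) (ℚ.+-monoˡ-≤ η (a≥ L))
    bad : _ → ℚ
    bad L = ΣL (λ I → hit I L) Is
    Σa = ΣL a Ls
    Σg = ΣL g Ls
    Σbg = ΣL (λ L → b L * g L) Ls
    Σhit = ΣL (λ L → b L * bad L) Ls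
    split : ΣL (λ L → a L * g L) Ls ≡ Σbg - η * Σg
    split = trans (ΣL-cong (λ L → eq (a L) (g L) η) Ls) (trans (ΣL-+ (λ L → b L * g L) (λ L → - η * g L) Ls)
      (cong (Σbg +_) (trans (ΣL-*ˡ (- η) g Ls) (neg η Σg))))
      where
      eq : ∀ a g η → a * g ≡ (a + η) * g + - η * g
      eq = solve-∀ ring
      neg : ∀ η x → - η * x ≡ - (η * x)
      neg = solve-∀ ring
    Σb : ΣL b Ls ≡ Σa + η * S
    Σb = trans (ΣL-+ a (λ _ → η) Ls) (cong (Σa +_) (trans (ΣL-const η Ls) (ℚ.*-comm S η)))
    lower : (1ℚ - e) * (Σa + η * S) - Σhit ≤ Σbg
    lower = subst (_≤ Σbg) eq₁ (ΣL-mono (λ L → *-monoˡ-≤ (0≤b L) (good L)) Ls)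
      where
      eq : ∀ b d e → b * (1ℚ - d - e) ≡ (1ℚ - e) * b + - 1ℚ * (b * d)
      eq = solve-∀ ring
      neg : ∀ x y → x + - 1ℚ * y ≡ x - y
      neg = solve-∀ ring
      eq₁ : ΣL (λ L → b L * (1ℚ - bad L - e)) Ls ≡ (1ℚ - e) * (Σa + η * S) - Σhit
      eq₁ = trans (ΣL-cong (λ L → eq (b L) (bad L) e) Ls) (trans (ΣL-+ (λ L → (1ℚ - e) * b L) (λ L → - 1ℚ * (b L * bad L)) Ls)
        (trans (cong₂ _+_ (trans (ΣL-*ˡ (1ℚ - e) b Ls) (cong ((1ℚ - e) *_) Σb)) (ΣL-*ˡ (- 1ℚ) (λ L → b L * bad L) Ls)) (neg ((1ℚ - e) * (Σa + η * S)) Σhit)))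
    hits : Σhit ≤ N * (P + η + η * S)
    hits = ℚ.≤-trans (ℚ.≤-reflexive (trans (ΣL-cong (λ L → sym (ΣL-*ˡ (b L) (λ I → hit I L) Is)) Ls) (ΣL-swap (λ L I → b L * hit I L) Ls Is))) (go each)
      where
      one : ∀ I → ΣL (λ L → a L * hit I L) Ls ≤ P + η → ΣL (λ L → b L * hit I L) Ls ≤ P + η + η * S
      one I h = ℚ.≤-trans (ℚ.≤-reflexive (trans (ΣL-cong (λ L → ℚ.*-distribʳ-+ (hit I L) (a L) η) Ls) (ΣL-+ (λ L → a L * hit I L) (λ L → η * hit I L) Ls)))
        (ℚ.+-mono-≤ h (ℚ.≤-trans (ℚ.≤-reflexive (ΣL-*ˡ η (hit I) Ls)) (*-monoˡ-≤ 0≤η (ℚ.≤-trans (ΣL-mono (hit≤1 I) Ls) (ℚ.≤-reflexive (trans (ΣL-const 1ℚ Ls) (ℚ.*-identityʳ S)))))))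
      go : ∀ {Is} → All (λ I → ΣL (λ L → a L * hit I L) Ls ≤ P + η) Is → ΣL (λ I → ΣL (λ L → b L * hit I L) Ls) Is ≤ ι (length Is) * (P + η + η * S)
      go {[]} []  = ℚ.≤-reflexive (sym (trans (cong (_* (P + η + η * S)) ι-0) (ℚ.*-zeroˡ (P + η + η * S))))
      go {I ∷ Is} (h ∷ hs) = ℚ.≤-trans (ℚ.+-mono-≤ (one I h) (go hs)) (ℚ.≤-reflexive (trans (eq (P + η + η * S) (ι (length Is))) (cong (_* (P + η + η * S)) (sym (ι-suc (length Is))))))
        where
        eq : ∀ c l → c + l * c ≡ (1ℚ + l) * c
        eq = solve-∀ ring
    gsum : η * Σg ≤ η * S
    gsum = *-monoˡ-≤ 0≤η (ℚ.≤-trans (ΣL-mono g≤1 Ls) (ℚ.≤-reflexive (trans (ΣL-const 1ℚ Ls) (ℚ.*-identityʳ S))))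
    eq₀ : ∀ e N P S η bg hit Σa g → bg - η * g - (1ℚ - e - N * P - (1ℚ + S + N * (1ℚ + S)) * η) ≡
        bg - ((1ℚ - e) * (Σa + η * S) - hit) + (1ℚ - e) * (Σa - (1ℚ - η)) + (N * (P + η + η * S) - hit + (η * S - η * g)) + (e * η + (1ℚ - e) * (η * S))
    eq₀ = solve-∀ ring

  module GoodEvent (n w K : ℕ) .{{_ : ℕ.NonZero w}} (φ : DNF (Fin n)) (width : HasWidth (ℤ.+ w ℚ./ 1) φ) where

    F : List (PTerm n)
    F = normalise φ

    f : Vec Bool n → Bool
    f z = eval φ (lookup z)

    narrow : Narrow w F
    narrow = normalise-narrow w φ width

    -- Chosen so that `½ ^ J = ½ e²`. Markov's inequality at the level `e` then fails with
    -- probability at most `½ e` for each of the two approximators, together `e`.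
    J : ℕ
    J = suc (K ℕ.+ K)

    lowerDNF upperDNF both : List (PTerm n)
    lowerDNF = proj₁ (sparse-lower {n} {w} J F narrow)
    upperDNF = proj₁ (sparse-upper {n} {w} J F narrow)
    both = lowerDNF ++ upperDNF

    -- `h` is the least number of live variables that makes a term wider than `w/2`, for even and
    -- for odd `w`.
    half h : ℕ
    half = w ℕ./ 2
    h = suc half

    e : ℚ
    e = powℚ ½ K

    0≤e : 0ℚ ≤ e
    0≤e = pow-≥0 K 0≤½

    e≤1 : e ≤ 1ℚ
    e≤1 = pow-≤1 K 0≤½ ½≤1

    short : Subset n → Bool
    short L = all (λ T → liveSize L T ℕ.≤ᵇ half) both

    errorAt : List (PTerm n) → Restriction n → ℚ
    errorAt H ρ = uniformPr (live ρ) (λ y → eval (restrictDNF ρ H) (coord y) xor f (fill ρ y))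

    -- The decidable event that `ProbAtLeast` asks for: the errors are compared with the rational
    -- `e = 2^(-K)` below ε instead of ε itself.
    good : Restriction n → Bool
    good ρ = short (live ρ) ∧ ((errorAt lowerDNF ρ ℚ.≤ᵇ e) ∧ (errorAt upperDNF ρ ℚ.≤ᵇ e))

    Is : List (Subset n)
    Is = concatMap (λ T → choose T h) both

    both-narrow : Narrow w both
    both-narrow = All.++⁺ (proj₁ (proj₂ (sparse-lower {n} {w} J F narrow))) (proj₁ (proj₂ (sparse-upper {n} {w} J F narrow)))

    both-length : length both ℕ.≤ cap w (suc J) ℕ.+ cap w (suc J)
    both-length = ℕ.≤-trans (ℕ.≤-reflexive (length-++ lowerDNF))
      (ℕ.+-mono-≤ (proj₁ (proj₂ (proj₂ (sparse-lower {n} {w} J F narrow)))) (proj₁ (proj₂ (proj₂ (sparse-upper {n} {w} J F narrow)))))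

    Is-size : All (λ I → ∥ I ∥ ≡ h) Is
    Is-size = go both
      where
      go : ∀ H → All (λ I → ∥ I ∥ ≡ h) (concatMap (λ T → choose T h) H)
      go []  = []
      go (T ∷ H) = All.++⁺ (choose-size T h) (go H)

    Is-length : length Is ℕ.≤ (cap w (suc J) ℕ.+ cap w (suc J)) ℕ.* 2 ℕ.^ w
    Is-length = ℕ.≤-trans (go both-narrow) (ℕ.*-monoˡ-≤ (2 ℕ.^ w) both-length)
      where
      go : ∀ {H} → Narrow w H → length (concatMap (λ T → choose T h) H) ℕ.≤ length H ℕ.* 2 ℕ.^ w
      go []  = ℕ.z≤n
      go {T ∷ H} (le ∷ les) = ℕ.≤-trans (ℕ.≤-reflexive (length-++ (choose T h)))
        (ℕ.+-mono-≤ (ℕ.≤-trans (choose-length T h) (ℕ.^-monoʳ-≤ 2 le)) (go les))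

    hit : Subset n → Subset n → ℚ
    hit I L = ind (does (I ⊆? L))

    bad : Subset n → ℚ
    bad L = ΣL (λ I → hit I L) Is

    -- If some term is too wide, one of its sets of `h` variables is entirely live, so the sum over
    -- these sets is at least 1.
    short-or-bad : ∀ L → ind (not (short L)) ≤ bad L
    short-or-bad L = go both
      where
      ΣL-++ : ∀ (g : Subset n → ℚ) xs ys → ΣL g (xs ++ ys) ≡ ΣL g xs + ΣL g ys
      ΣL-++ g []  ys = sym (ℚ.+-identityˡ _)
      ΣL-++ g (x ∷ xs) ys = trans (cong (g x +_) (ΣL-++ g xs ys)) (sym (ℚ.+-assoc (g x) (ΣL g xs) (ΣL g ys)))
      g : Subset n → ℚ
      g I = hit I L
      0≤g : ∀ I → 0ℚ ≤ g I
      0≤g I = 0≤ind (does (I ⊆? L))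
      go : ∀ H → ind (not (all (λ T → liveSize L T ℕ.≤ᵇ half) H)) ≤ ΣL g (concatMap (λ T → choose T h) H)
      go []  = ℚ.≤-refl
      go (T ∷ H) = subst (ind (not (all (λ T → liveSize L T ℕ.≤ᵇ half) (T ∷ H))) ≤_) (sym (ΣL-++ g (choose T h) (concatMap (λ T → choose T h) H))) (cases (liveSize L T ℕ.≤ᵇ half) refl)
        where
        cases : ∀ b → (liveSize L T ℕ.≤ᵇ half) ≡ b → ind (not (b ∧ all (λ T → liveSize L T ℕ.≤ᵇ half) H)) ≤ ΣL g (choose T h) + ΣL g (concatMap (λ T → choose T h) H)
        cases true  _  = subst (_≤ ΣL g (choose T h) + ΣL g (concatMap (λ T → choose T h) H)) (ℚ.+-identityˡ _) (ℚ.+-mono-≤ (ΣL-≥0 0≤g (choose T h)) (go H))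
        cases false eq = subst (_≤ ΣL g (choose T h) + ΣL g (concatMap (λ T → choose T h) H)) (ℚ.+-identityʳ 1ℚ)
          (ℚ.+-mono-≤ (live-sum T L h (ℕ.≰⇒> (λ le → subst Bool.T eq (ℕ.≤⇒≤ᵇ le)))) (ΣL-≥0 0≤g (concatMap (λ T → choose T h) H)))

    errorAt-avg : ∀ H ρ → errorAt H ρ ≡ avg (subcube (live ρ)) (λ y → ind (holds H (fill ρ y) xor holds F (fill ρ y)))
    errorAt-avg H ρ = trans (uniformPr-avg (live ρ) _) (avg-cong (subcube (live ρ))
      (λ y → cong ind (cong₂ _xor_ (restrictDNF-eval ρ H y) (sym (normalise-holds φ (fill ρ y))))))

    module _ (L : Subset n) where

      𝒳 : Average (Cube (∁ L))
      𝒳 = subcube (∁ L)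

      fails : List (PTerm n) → Cube (∁ L) → ℚ
      fails H x = ind (not (errorAt H (restriction L x) ℚ.≤ᵇ e))

      fails-rare : ∀ H → error F H ≤ powℚ ½ J → avg 𝒳 (fails H) ≤ ½ * e
      fails-rare H err = ℚ.*-cancelˡ-≤-pos e {{ℚ.positive (pow->0 K 0<½)}} (ℚ.≤-trans (markov 𝒳 (λ x → errorAt H (restriction L x)) e
          (λ x → subst (0ℚ ≤_) (sym (errorAt-avg H (restriction L x))) (avg-≥0 (subcube (live (restriction L x))) (λ y → 0≤ind (holds H (fill (restriction L x) y) xor holds F (fill (restriction L x) y))))) 0≤e)
        (subst₂ _≤_ (sym mean) (trans (cong (½ *_) (pow-+ ½ K K)) (eq e)) err))
        where
        mean : avg 𝒳 (λ x → errorAt H (restriction L x)) ≡ error F H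
        mean = trans (avg-cong 𝒳 (λ x → errorAt-avg H (restriction L x))) (restriction-avg L (λ z → ind (holds H z xor holds F z)))
        eq : ∀ e → ½ * (e * e) ≡ e * (½ * e)
        eq = solve-∀ ring

      goodPr : ℚ
      goodPr = uniformPr (∁ L) (λ x → good (restriction L x))

      goodPr≡ : goodPr ≡ avg 𝒳 (λ x → ind (good (restriction L x)))
      goodPr≡ = uniformPr-avg (∁ L) _

      goodPr≤1 : goodPr ≤ 1ℚ
      goodPr≤1 = subst (_≤ 1ℚ) (sym goodPr≡) (avg-≤1 𝒳 (λ x → ind≤1 (good (restriction L x))))

      0≤goodPr : 0ℚ ≤ goodPr
      0≤goodPr = subst (0ℚ ≤_) (sym goodPr≡) (avg-≥0 𝒳 (λ x → 0≤ind (good (restriction L x))))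

      ind-∧∧ : ∀ a b c → 1ℚ ≤ ind (a ∧ (b ∧ c)) + (ind (not a) + (ind (not b) + ind (not c)))
      ind-∧∧ true  true  true  = ℚ.≤ᵇ⇒≤ _
      ind-∧∧ true  true  false = ℚ.≤ᵇ⇒≤ _
      ind-∧∧ true  false true  = ℚ.≤ᵇ⇒≤ _
      ind-∧∧ true  false false = ℚ.≤ᵇ⇒≤ _
      ind-∧∧ false true  true  = ℚ.≤ᵇ⇒≤ _
      ind-∧∧ false true  false = ℚ.≤ᵇ⇒≤ _
      ind-∧∧ false false true  = ℚ.≤ᵇ⇒≤ _
      ind-∧∧ false false false = ℚ.≤ᵇ⇒≤ _

      goodPr-bound : 1ℚ - bad L - e ≤ goodPr
      goodPr-bound = ≤-by (0≤+ (≤⇒0≤- summed) (0≤+ (≤⇒0≤- (short-or-bad L)) (0≤+ (≤⇒0≤- (fails-rare lowerDNF errₗ)) (≤⇒0≤- (fails-rare upperDNF errᵤ)))))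
          (eq goodPr (bad L) e (ind (not (short L))) (avg 𝒳 (fails lowerDNF)) (avg 𝒳 (fails upperDNF)))
        where
        errₗ = proj₂ (proj₂ (proj₂ (proj₂ (sparse-lower {n} {w} J F narrow))))
        errᵤ = proj₂ (proj₂ (proj₂ (proj₂ (sparse-upper {n} {w} J F narrow))))
        eq : ∀ g b e s l u → g - (1ℚ - b - e) ≡ (g + (s + (l + u)) - 1ℚ) + (b - s + (½ * e - l + (½ * e - u)))
        eq = solve-∀ ring
        summed : 1ℚ ≤ goodPr + (ind (not (short L)) + (avg 𝒳 (fails lowerDNF) + avg 𝒳 (fails upperDNF)))
        summed = subst₂ _≤_ (const 𝒳 1ℚ) expand (mono 𝒳 {f = λ _ → 1ℚ} pointwise)
          where
          G : Cube (∁ L) → ℚ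
          G x = ind (good (restriction L x))
          pointwise : ∀ x → 1ℚ ≤ G x + (ind (not (short L)) + (fails lowerDNF x + fails upperDNF x))
          pointwise x = subst (λ b → 1ℚ ≤ G x + (ind (not b) + (fails lowerDNF x + fails upperDNF x))) (cong short (live-restriction L x))
            (ind-∧∧ (short (live (restriction L x))) (errorAt lowerDNF (restriction L x) ℚ.≤ᵇ e) (errorAt upperDNF (restriction L x) ℚ.≤ᵇ e))
          expand : avg 𝒳 (λ x → G x + (ind (not (short L)) + (fails lowerDNF x + fails upperDNF x))) ≡
                   goodPr + (ind (not (short L)) + (avg 𝒳 (fails lowerDNF) + avg 𝒳 (fails upperDNF)))
          expand = trans (add 𝒳 G _) (cong₂ _+_ (sym goodPr≡) (trans (add 𝒳 (λ _ → ind (not (short L))) _)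
            (cong₂ _+_ (const 𝒳 (ind (not (short L)))) (add 𝒳 (fails lowerDNF) (fails upperDNF)))))

    good⇒sandwich : ∀ (ε : Seq) → (∃ λ N → ∀ k → N ℕ.≤ k → e ≤ ε k) → ∀ ρ → T (good ρ) → HasSandwich ε (ℤ.+ w ℚ./ 2) f ρ
    good⇒sandwich ε (N , e≤ε) ρ ok = restrictDNF ρ lowerDNF , restrictDNF ρ upperDNF ,
        widths (All.++⁻ˡ lowerDNF shortTerms) , widths (All.++⁻ʳ lowerDNF shortTerms) , record
        { lower    = λ y → true⇒true⇒≤ (λ t → trans (sym (normalise-holds φ (fill ρ y))) (proj₁ (proj₂ (proj₂ (proj₂ (sparse-lower {n} {w} J F narrow)))) (fill ρ y) (trans (sym (restrictDNF-eval ρ lowerDNF y)) t)))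
        ; upper    = λ y → true⇒true⇒≤ (λ t → trans (restrictDNF-eval ρ upperDNF y) (proj₁ (proj₂ (proj₂ (proj₂ (sparse-upper {n} {w} J F narrow)))) (fill ρ y) (trans (normalise-holds φ (fill ρ y)) t)))
        ; lowerErr = small (proj₁ errs)
        ; upperErr = small (proj₂ errs)
        }
      where
      oks : T (short (live ρ)) × T ((errorAt lowerDNF ρ ℚ.≤ᵇ e) ∧ (errorAt upperDNF ρ ℚ.≤ᵇ e))
      oks = T-split (short (live ρ)) ((errorAt lowerDNF ρ ℚ.≤ᵇ e) ∧ (errorAt upperDNF ρ ℚ.≤ᵇ e)) ok
      okerrs : T (errorAt lowerDNF ρ ℚ.≤ᵇ e) × T (errorAt upperDNF ρ ℚ.≤ᵇ e)
      okerrs = T-split (errorAt lowerDNF ρ ℚ.≤ᵇ e) (errorAt upperDNF ρ ℚ.≤ᵇ e) (proj₂ oks)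
      errs : errorAt lowerDNF ρ ≤ e × errorAt upperDNF ρ ≤ e
      errs = ℚ.≤ᵇ⇒≤ (proj₁ okerrs) , ℚ.≤ᵇ⇒≤ (proj₂ okerrs)
      shortTerms : All (λ T → liveSize (live ρ) T ℕ.≤ half) both
      shortTerms = go both (proj₁ oks)
        where
        go : ∀ H → T (all (λ T → liveSize (live ρ) T ℕ.≤ᵇ half) H) → All (λ T → liveSize (live ρ) T ℕ.≤ half) H
        go []  _ = []
        go (U ∷ H) t = let (t₁ , t₂) = T-split (liveSize (live ρ) U ℕ.≤ᵇ half) (all (λ T → liveSize (live ρ) T ℕ.≤ᵇ half) H) t in ℕ.≤ᵇ⇒≤ (liveSize (live ρ) U) half t₁ ∷ go H t₂
      widths : ∀ {H} → All (λ T → liveSize (live ρ) T ℕ.≤ half) H → HasWidth (ℤ.+ w ℚ./ 2) (restrictDNF ρ H)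
      widths hs = All.map (λ {t} le → *-cancelʳ-≤ (0<ι 2) (subst₂ _≤_ (trans (ι-* (length t) 2) (cong (_* ι 2) (ι-def (length t)))) (sym (/-*-cancel w 2))
        (ι-mono (ℕ.≤-trans (ℕ.*-monoˡ-≤ 2 le) (ℕ.m/n*n≤m w 2))))) (restrictDNF-lengths ρ half hs)
      small : ∀ {q} → q ≤ e → fromℚ q Defs.≤ ε
      small {q} q≤e η 0<η = N , λ k N≤k → ℚ.≤-trans q≤e (ℚ.≤-trans (e≤ε k N≤k)
        (subst (_≤ ε k + η) (ℚ.+-identityʳ (ε k)) (ℚ.+-monoʳ-≤ (ε k) (ℚ.<⇒≤ 0<η))))

    good-probability : ∀ (a : Subset n → ℚ) η P → 0ℚ ≤ η → (∀ L → - η ≤ a L) → 1ℚ - η ≤ ΣL a (subsets n) →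
      All (λ I → ΣL (λ L → a L * hit I L) (subsets n) ≤ P + η) Is →
      let S = ι (length (subsets n)) ; N = ι (length Is) in
      1ℚ - e - N * P - (1ℚ + S + N * (1ℚ + S)) * η ≤ ΣL (λ L → a L * goodPr L) (subsets n)
    good-probability a η P 0≤η a≥ total each = union-bound (subsets n) Is a goodPr hit e η P 0≤e e≤1 0≤η a≥ goodPr≤1
      (λ I L → ind≤1 (does (I ⊆? L))) total each goodPr-bound

-- The truncated exponential series

module Exponential where
  open import Data.Rational using (ℚ; 0ℚ; 1ℚ; ½; _+_; _*_; _-_; -_; _≤_; _<_; ∣_∣; _⊓_)
  open Rationals
  open Averages
  open SecondMoment
  open Spread
  open Sunflower
  open Sparsify
  open Restrict
  open Event
  open Average

  -- An inequality of reals is, for each tolerance, a statement about all large indices. Finitely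
  -- many of them are joined by `∧ᵉ` and then used at a common index.
  Eventually : (ℕ → Set) → Set
  Eventually P = ∃ λ N → ∀ n → N ℕ.≤ n → P n

  infixr 4 _∧ᵉ_
  _∧ᵉ_ : ∀ {P Q} → Eventually P → Eventually Q → Eventually (λ n → P n × Q n)
  (N , p) ∧ᵉ (M , q) = N ℕ.⊔ M , λ n h → p n (ℕ.m⊔n≤o⇒m≤o N M h) , q n (ℕ.m⊔n≤o⇒n≤o N M h)

  mapᵉ : ∀ {P Q : ℕ → Set} → (∀ n → P n → Q n) → Eventually P → Eventually Q
  mapᵉ f (N , p) = N , λ n h → f n (p n h)

  -- The absolute value of the numerator serves, as the denominator is at least 1.
  ≤ι : ∀ x → ∃ λ N → x ≤ ι N
  ≤ι x = N , ℚ.≤-trans (≤∣∣ x) (ℚ.≤-trans (ℚ.≤-reflexive (sym (ℚ.*-identityʳ ∣ x ∣)))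
      (ℚ.≤-trans (*-monoˡ-≤ (ℚ.0≤∣p∣ x) (1≤ι d)) (ℚ.≤-reflexive (eq x))))
    where
    N d : ℕ
    N = ℤ.∣ ℚ.↥ x ∣
    d = ℚ.↧ₙ x
    eq : ∀ x → ∣ x ∣ * ι (ℚ.↧ₙ x) ≡ ι ℤ.∣ ℚ.↥ x ∣
    eq x@(ℚ.mkℚ n d-1 c) = trans (cong (_* ι (suc d-1)) (sym (ℚ.↥p/↧p≡p ∣ x ∣))) (/-*-cancel ℤ.∣ n ∣ (suc d-1))

  ½^-small : ∀ T q → 0ℚ < q → Eventually (λ k → powℚ ½ k * T ≤ q)
  ½^-small T q 0<q = let (N , h) = ≤ι (T * invℚ q) in N , λ k N≤k → begin
    powℚ ½ k * T  ≡⟨ cong (powℚ ½ k *_) (T≡) ⟩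
    powℚ ½ k * ((T * invℚ q) * q)  ≤⟨ *-monoˡ-≤ (pow-≥0 k 0≤½) (*-monoʳ-≤ (ℚ.<⇒≤ 0<q) (ℚ.≤-trans h (ι-mono (ℕ.≤-trans N≤k (n≤2^n k))))) ⟩
    powℚ ½ k * (ι (2 ℕ.^ k) * q)  ≡⟨ sym (ℚ.*-assoc (powℚ ½ k) (ι (2 ℕ.^ k)) q) ⟩
    powℚ ½ k * ι (2 ℕ.^ k) * q  ≡⟨ cong (_* q) (pow½-2^ k) ⟩
    1ℚ * q  ≡⟨ ℚ.*-identityˡ q ⟩
    q  ∎
    where
    open ℚ.≤-Reasoning
    eq : ∀ T i q → T * (q * i) ≡ T * i * q
    eq = solve-∀ ring
    T≡ : T ≡ T * invℚ q * q
    T≡ = trans (sym (ℚ.*-identityʳ T)) (trans (cong (T *_) (sym (inv-*ʳ 0<q))) (eq T (invℚ q) q))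

  psum : (ℕ → ℚ) → ℕ → ℚ
  psum f zero    = f zero
  psum f (suc n) = psum f n + f (suc n)

  psum-cong : ∀ {f g : ℕ → ℚ} → (∀ i → f i ≡ g i) → ∀ n → psum f n ≡ psum g n
  psum-cong h zero    = h zero
  psum-cong h (suc n) = cong₂ _+_ (psum-cong h n) (h (suc n))

  psum-front : ∀ f n → psum f (suc n) ≡ f zero + psum (f ∘ suc) n
  psum-front f zero    = refl
  psum-front f (suc n) = trans (cong (_+ f (suc (suc n))) (psum-front f n)) (ℚ.+-assoc (f zero) (psum (f ∘ suc) n) (f (suc (suc n))))

  psum-+ : ∀ f g n → psum (λ i → f i + g i) n ≡ psum f n + psum g n
  psum-+ f g zero    = refl
  psum-+ f g (suc n) = trans (cong (_+ (f (suc n) + g (suc n))) (psum-+ f g n)) (eq (psum f n) (psum g n) (f (suc n)) (g (suc n)))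
    where
    eq : ∀ a b c d → a + b + (c + d) ≡ a + c + (b + d)
    eq = solve-∀ ring

  psum-*ˡ : ∀ c f n → psum (λ i → c * f i) n ≡ c * psum f n
  psum-*ˡ c f zero    = refl
  psum-*ˡ c f (suc n) = trans (cong (_+ c * f (suc n)) (psum-*ˡ c f n)) (sym (ℚ.*-distribˡ-+ c (psum f n) (f (suc n))))

  psum-≥0 : ∀ {f} → (∀ i → 0ℚ ≤ f i) → ∀ n → 0ℚ ≤ psum f n
  psum-≥0 h zero    = h zero
  psum-≥0 h (suc n) = 0≤+ (psum-≥0 h n) (h (suc n))

  psum-mono-n : ∀ {f} → (∀ i → 0ℚ ≤ f i) → ∀ k n → psum f n ≤ psum f (k ℕ.+ n)
  psum-mono-n h zero    n = ℚ.≤-refl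
  psum-mono-n {f} h (suc k) n = ℚ.≤-trans (psum-mono-n h k n) (subst (_≤ psum f (suc k ℕ.+ n)) (ℚ.+-identityʳ _) (ℚ.+-monoʳ-≤ (psum f (k ℕ.+ n)) (h (suc (k ℕ.+ n)))))

  -- The coefficients of the Cauchy product of two power series.
  conv : (ℕ → ℚ) → (ℕ → ℚ) → ℕ → ℚ
  conv f g zero    = f zero * g zero
  conv f g (suc m) = f zero * g (suc m) + conv (f ∘ suc) g m

  conv-congˡ : ∀ {f f′} g → (∀ i → f i ≡ f′ i) → ∀ m → conv f g m ≡ conv f′ g m
  conv-congˡ g h zero    = cong (_* g zero) (h zero)
  conv-congˡ g h (suc m) = cong₂ _+_ (cong (_* g (suc m)) (h zero)) (conv-congˡ g (h ∘ suc) m)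

  conv-congʳ : ∀ f {g g′ : ℕ → ℚ} → (∀ i → g i ≡ g′ i) → ∀ m → conv f g m ≡ conv f g′ m
  conv-congʳ f h zero    = cong (f zero *_) (h zero)
  conv-congʳ f h (suc m) = cong₂ _+_ (cong (f zero *_) (h (suc m))) (conv-congʳ (f ∘ suc) h m)

  conv-+ˡ : ∀ f f′ g m → conv (λ i → f i + f′ i) g m ≡ conv f g m + conv f′ g m
  conv-+ˡ f f′ g zero    = ℚ.*-distribʳ-+ (g zero) (f zero) (f′ zero)
  conv-+ˡ f f′ g (suc m) = trans (cong ((f zero + f′ zero) * g (suc m) +_) (conv-+ˡ (f ∘ suc) (f′ ∘ suc) g m))
      (eq (f zero) (f′ zero) (g (suc m)) (conv (f ∘ suc) g m) (conv (f′ ∘ suc) g m))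
    where
    eq : ∀ a b c x y → (a + b) * c + (x + y) ≡ a * c + x + (b * c + y)
    eq = solve-∀ ring

  conv-+ʳ : ∀ f g g′ m → conv f (λ i → g i + g′ i) m ≡ conv f g m + conv f g′ m
  conv-+ʳ f g g′ zero    = ℚ.*-distribˡ-+ (f zero) (g zero) (g′ zero)
  conv-+ʳ f g g′ (suc m) = trans (cong (f zero * (g (suc m) + g′ (suc m)) +_) (conv-+ʳ (f ∘ suc) g g′ m))
      (eq (f zero) (g (suc m)) (g′ (suc m)) (conv (f ∘ suc) g m) (conv (f ∘ suc) g′ m))
    where
    eq : ∀ a b c x y → a * (b + c) + (x + y) ≡ a * b + x + (a * c + y)
    eq = solve-∀ ring

  conv-*ˡ : ∀ c f g m → conv (λ i → c * f i) g m ≡ c * conv f g m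
  conv-*ˡ c f g zero    = ℚ.*-assoc c (f zero) (g zero)
  conv-*ˡ c f g (suc m) = trans (cong (c * f zero * g (suc m) +_) (conv-*ˡ c (f ∘ suc) g m)) (eq c (f zero) (g (suc m)) (conv (f ∘ suc) g m))
    where
    eq : ∀ c a b x → c * a * b + c * x ≡ c * (a * b + x)
    eq = solve-∀ ring

  conv-*ʳ : ∀ c f g m → conv f (λ i → c * g i) m ≡ c * conv f g m
  conv-*ʳ c f g zero    = eq c (f zero) (g zero)
    where
    eq : ∀ c a b → a * (c * b) ≡ c * (a * b)
    eq = solve-∀ ring
  conv-*ʳ c f g (suc m) = trans (cong (f zero * (c * g (suc m)) +_) (conv-*ʳ c (f ∘ suc) g m)) (eq c (f zero) (g (suc m)) (conv (f ∘ suc) g m))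
    where
    eq : ∀ c a b x → a * (c * b) + c * x ≡ c * (a * b + x)
    eq = solve-∀ ring

  conv-constʳ : ∀ f c n → conv f (λ _ → c) n ≡ psum f n * c
  conv-constʳ f c zero    = refl
  conv-constʳ f c (suc n) = trans (cong (f zero * c +_) (conv-constʳ (f ∘ suc) c n))
    (trans (sym (ℚ.*-distribʳ-+ c (f zero) (psum (f ∘ suc) n))) (cong (_* c) (sym (psum-front f n))))

  -- Both sides add up `f i * g j` over the triangle `i + j ≤ n`.
  conv-psum : ∀ f g n → conv f (psum g) n ≡ psum (conv f g) n
  conv-psum f g zero    = refl
  conv-psum f g (suc n) = begin
    f zero * psum g (suc n) + conv (f ∘ suc) (psum g) n  ≡⟨ cong₂ (λ x y → f zero * x + y) (psum-front g n) (conv-psum (f ∘ suc) g n) ⟩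
    f zero * (g zero + psum (g ∘ suc) n) + psum (conv (f ∘ suc) g) n  ≡⟨ eq (f zero) (g zero) (psum (g ∘ suc) n) (psum (conv (f ∘ suc) g) n) ⟩
    f zero * g zero + (f zero * psum (g ∘ suc) n + psum (conv (f ∘ suc) g) n)  ≡⟨ cong (λ x → f zero * g zero + (x + psum (conv (f ∘ suc) g) n)) (sym (psum-*ˡ (f zero) (g ∘ suc) n)) ⟩
    f zero * g zero + (psum (λ i → f zero * g (suc i)) n + psum (conv (f ∘ suc) g) n) ≡⟨ cong (f zero * g zero +_) (sym (psum-+ (λ i → f zero * g (suc i)) (conv (f ∘ suc) g) n)) ⟩
    conv f g zero + psum (conv f g ∘ suc) n  ≡⟨ sym (psum-front (conv f g) n) ⟩
    psum (conv f g) (suc n)  ∎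
    where
    open ≡-Reasoning
    eq : ∀ a b x y → a * (b + x) + y ≡ a * b + (a * x + y)
    eq = solve-∀ ring

  ∣conv∣ : ∀ {f F g G} n → (∀ i → ∣ f i ∣ ≤ F i) → (∀ j → j ℕ.≤ n → ∣ g j ∣ ≤ G j) → ∣ conv f g n ∣ ≤ conv F G n
  ∣conv∣ {f} {F} {g} {G} zero    hf hg = subst (_≤ F zero * G zero) (sym (ℚ.∣p*q∣≡∣p∣*∣q∣ (f zero) (g zero)))
    (*-mono-≤ (ℚ.≤-trans (ℚ.0≤∣p∣ (f zero)) (hf zero)) (ℚ.0≤∣p∣ (g zero)) (hf zero) (hg zero ℕ.≤-refl))
  ∣conv∣ {f} {F} {g} {G} (suc n) hf hg = ℚ.≤-trans (ℚ.∣p+q∣≤∣p∣+∣q∣ (f zero * g (suc n)) (conv (f ∘ suc) g n))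
    (ℚ.+-mono-≤ (subst (_≤ F zero * G (suc n)) (sym (ℚ.∣p*q∣≡∣p∣*∣q∣ (f zero) (g (suc n))))
        (*-mono-≤ (ℚ.≤-trans (ℚ.0≤∣p∣ (f zero)) (hf zero)) (ℚ.0≤∣p∣ (g (suc n))) (hf zero) (hg (suc n) ℕ.≤-refl)))
      (∣conv∣ n (hf ∘ suc) (λ j h → hg j (ℕ.m≤n⇒m≤1+n h))))

  ∣psum-diff∣ : ∀ {g G} → (∀ i → ∣ g i ∣ ≤ G i) → ∀ n j → j ℕ.≤ n → ∣ psum g n - psum g j ∣ ≤ psum G n - psum G j
  ∣psum-diff∣ {g} {G} h n j j≤n = subst (λ m → ∣ psum g m - psum g j ∣ ≤ psum G m - psum G j) (ℕ.m∸n+n≡m j≤n) (go (n ℕ.∸ j))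
    where
    eq : ∀ a b c → a + c - b ≡ a - b + c
    eq = solve-∀ ring
    go : ∀ k → ∣ psum g (k ℕ.+ j) - psum g j ∣ ≤ psum G (k ℕ.+ j) - psum G j
    go zero    = ℚ.≤-reflexive (trans (cong ∣_∣ (ℚ.+-inverseʳ (psum g j))) (sym (ℚ.+-inverseʳ (psum G j))))
    go (suc k) = subst₂ _≤_ (cong ∣_∣ (sym (eq (psum g (k ℕ.+ j)) (psum g j) (g (suc k ℕ.+ j))))) (sym (eq (psum G (k ℕ.+ j)) (psum G j) (G (suc k ℕ.+ j))))
      (ℚ.≤-trans (ℚ.∣p+q∣≤∣p∣+∣q∣ (psum g (k ℕ.+ j) - psum g j) (g (suc k ℕ.+ j))) (ℚ.+-mono-≤ (go k) (h (suc k ℕ.+ j))))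

  -- The rectangle `i ≤ n`, `j ≤ k` lies in the triangle `i + j ≤ n + k`, and the terms outside it
  -- are nonnegative.
  conv-rectangle : ∀ {f g} → (∀ i → 0ℚ ≤ f i) → (∀ i → 0ℚ ≤ g i) → ∀ n k → psum f n * psum g k ≤ conv f (psum g) (n ℕ.+ k)
  conv-rectangle {f} {g} hf hg zero    zero    = ℚ.≤-refl
  conv-rectangle {f} {g} hf hg zero    (suc k) = subst (_≤ conv f (psum g) (suc k)) (ℚ.+-identityʳ _) (ℚ.+-monoʳ-≤ (f zero * psum g (suc k)) (conv-≥0 (hf ∘ suc) (psum-≥0 hg) k))
    where
    conv-≥0 : ∀ {f g} → (∀ i → 0ℚ ≤ f i) → (∀ i → 0ℚ ≤ g i) → ∀ n → 0ℚ ≤ conv f g n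
    conv-≥0 hf hg zero    = 0≤* (hf zero) (hg zero)
    conv-≥0 hf hg (suc n) = 0≤+ (0≤* (hf zero) (hg (suc n))) (conv-≥0 (hf ∘ suc) hg n)
  conv-rectangle {f} {g} hf hg (suc n) k = subst (_≤ conv f (psum g) (suc n ℕ.+ k)) (trans (sym (ℚ.*-distribʳ-+ (psum g k) (f zero) (psum (f ∘ suc) n))) (cong (_* psum g k) (sym (psum-front f n))))
    (ℚ.+-mono-≤ (*-monoˡ-≤ (hf zero) (psum-mono-n hg (suc n) k)) (conv-rectangle (hf ∘ suc) hg n k))

  -- The formal derivative of the power series with coefficients `f`.
  ∂ : (ℕ → ℚ) → ℕ → ℚ
  ∂ f m = ι (suc m) * f (suc m)

  leibniz : ∀ f g m → ∂ (conv f g) m ≡ conv (∂ f) g m + conv f (∂ g) m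
  leibniz f g zero    = eq (ι 1) (f 0) (f 1) (g 0) (g 1)
    where
    eq : ∀ l f₀ f₁ g₀ g₁ → l * (f₀ * g₁ + f₁ * g₀) ≡ l * f₁ * g₀ + f₀ * (l * g₁)
    eq = solve-∀ ring
  leibniz f g (suc m) = begin
    ι (suc (suc m)) * (f 0 * g (suc (suc m)) + (f 1 * g (suc m) + C))  ≡⟨ cong (_* (f 0 * g (suc (suc m)) + (f 1 * g (suc m) + C))) (ι-suc (suc m)) ⟩
    (1ℚ + ι (suc m)) * (f 0 * g (suc (suc m)) + (f 1 * g (suc m) + C))  ≡⟨ eq₁ (ι (suc m)) (f 0) (f 1) (g (suc m)) (g (suc (suc m))) C ⟩
    f 1 * g (suc m) + C + (1ℚ + ι (suc m)) * (f 0 * g (suc (suc m))) + ι (suc m) * (f 1 * g (suc m) + C) ≡⟨ cong₂ (λ l x → f 1 * g (suc m) + C + l * (f 0 * g (suc (suc m))) + x) (sym (ι-suc (suc m))) (leibniz (f ∘ suc) g m) ⟩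
    f 1 * g (suc m) + C + ι (suc (suc m)) * (f 0 * g (suc (suc m))) + (A + B)  ≡⟨ eq₂ (f 0) (f 1) (g (suc m)) (g (suc (suc m))) C (ι (suc (suc m))) A B ⟩
    1ℚ * f 1 * g (suc m) + (A + C) + (f 0 * (ι (suc (suc m)) * g (suc (suc m))) + B)  ≡⟨ cong₂ (λ l x → l * f 1 * g (suc m) + x + (f 0 * (ι (suc (suc m)) * g (suc (suc m))) + B)) (sym ι-1) (sym shift) ⟩
    conv (∂ f) g (suc m) + conv f (∂ g) (suc m)  ∎
    where
    open ≡-Reasoning
    A B C : ℚ
    A = conv (∂ (f ∘ suc)) g m
    B = conv (f ∘ suc) (∂ g) m
    C = conv ((f ∘ suc) ∘ suc) g m
    eq₁ : ∀ l f₀ f₁ g₁ g₂ C → (1ℚ + l) * (f₀ * g₂ + (f₁ * g₁ + C)) ≡ f₁ * g₁ + C + (1ℚ + l) * (f₀ * g₂) + l * (f₁ * g₁ + C)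
    eq₁ = solve-∀ ring
    eq₂ : ∀ f₀ f₁ g₁ g₂ C l A B → f₁ * g₁ + C + l * (f₀ * g₂) + (A + B) ≡ 1ℚ * f₁ * g₁ + (A + C) + (f₀ * (l * g₂) + B)
    eq₂ = solve-∀ ring
    shift : conv (∂ f ∘ suc) g m ≡ A + C
    shift = trans (conv-congˡ g (λ i → trans (cong (_* f (suc (suc i))) (ι-suc (suc i))) (eq (ι (suc i)) (f (suc (suc i))))) m)
                  (conv-+ˡ (∂ (f ∘ suc)) ((f ∘ suc) ∘ suc) g m)
      where
      eq : ∀ l x → (1ℚ + l) * x ≡ l * x + x
      eq = solve-∀ ring

  term : ℚ → ℕ → ℚ
  term a i = powℚ a i * (1/! i)

  expℚ-psum : ∀ n a → expℚ n a ≡ psum (term a) n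
  expℚ-psum zero    a = refl
  expℚ-psum (suc n) a = cong (_+ term a (suc n)) (expℚ-psum n a)

  ∂-term : ∀ a m → ∂ (term a) m ≡ a * term a m
  ∂-term a m = trans (eq (ι (suc m)) a (powℚ a m) (1/! m) (ℤ.+ 1 ℚ./ suc m)) (trans (cong (a * (powℚ a m * (1/! m)) *_) (trans (/-*-cancel 1 (suc m)) ι-1)) (ℚ.*-identityʳ _))
    where
    eq : ∀ l a p f i → l * (a * p * (f * i)) ≡ a * (p * f) * (i * l)
    eq = solve-∀ ring

  -- Both sides are solutions of the formal differential equation ∂ f = (a + b) f.
  conv-term : ∀ a b m → conv (term a) (term b) m ≡ term (a + b) m
  conv-term a b zero    = refl
  conv-term a b (suc m) = *-cancelʳ-≡ (0<ι (suc m)) (trans (ℚ.*-comm _ (ι (suc m))) (trans both (ℚ.*-comm (ι (suc m)) _)))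
    where
    both : ∂ (conv (term a) (term b)) m ≡ ∂ (term (a + b)) m
    both = trans (leibniz (term a) (term b) m) (trans (cong₂ _+_ (trans (conv-congˡ (term b) (∂-term a) m) (conv-*ˡ a (term a) (term b) m))
        (trans (conv-congʳ (term a) (∂-term b) m) (conv-*ʳ b (term a) (term b) m)))
      (trans (sym (ℚ.*-distribʳ-+ (conv (term a) (term b) m) a b)) (trans (cong ((a + b) *_) (conv-term a b m)) (sym (∂-term (a + b) m)))))

  1/!-≥0 : ∀ i → 0ℚ ≤ 1/! i
  1/!-≥0 zero    = 0≤1
  1/!-≥0 (suc i) = 0≤* (1/!-≥0 i) (*-cancelʳ-≤ (0<ι (suc i)) (subst₂ _≤_ (sym (ℚ.*-zeroˡ (ι (suc i)))) (sym (trans (/-*-cancel 1 (suc i)) ι-1)) 0≤1))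

  term-≥0 : ∀ {a} → 0ℚ ≤ a → ∀ i → 0ℚ ≤ term a i
  term-≥0 0≤a i = 0≤* (pow-≥0 i 0≤a) (1/!-≥0 i)

  ∣term∣ : ∀ {a B} → ∣ a ∣ ≤ B → ∀ i → ∣ term a i ∣ ≤ term B i
  ∣term∣ {a} {B} h i = subst (_≤ term B i) (sym (trans (ℚ.∣p*q∣≡∣p∣*∣q∣ (powℚ a i) (1/! i)) (cong₂ _*_ (∣pow∣ a i) (ℚ.0≤p⇒∣p∣≡p (1/!-≥0 i)))))
    (*-monoʳ-≤ (1/!-≥0 i) (pow-mono i (ℚ.0≤∣p∣ a) h))

  -- What remains is the corner of the square `i, j ≤ n` beyond the diagonal `i + j = n`: for each
  -- `i`, the indices `j` from `n - i + 1` to `n`.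
  exp-product : ∀ n a b → expℚ n a * expℚ n b - expℚ n (a + b) ≡ conv (term a) (λ j → psum (term b) n - psum (term b) j) n
  exp-product n a b = sym (begin
    conv (term a) (λ j → psum (term b) n - psum (term b) j) n
      ≡⟨ conv-congʳ (term a) (λ j → eq (psum (term b) n) (psum (term b) j)) n ⟩
    conv (term a) (λ j → psum (term b) n + - 1ℚ * psum (term b) j) n
      ≡⟨ trans (conv-+ʳ (term a) (λ _ → psum (term b) n) (λ j → - 1ℚ * psum (term b) j) n)
               (cong₂ _+_ (conv-constʳ (term a) (psum (term b) n) n) (conv-*ʳ (- 1ℚ) (term a) (psum (term b)) n)) ⟩
    psum (term a) n * psum (term b) n + - 1ℚ * conv (term a) (psum (term b)) n
      ≡⟨ cong (λ t → psum (term a) n * psum (term b) n + - 1ℚ * t) (trans (conv-psum (term a) (term b) n) (psum-cong (conv-term a b) n)) ⟩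
    psum (term a) n * psum (term b) n + - 1ℚ * psum (term (a + b)) n
      ≡⟨ sym (eq (psum (term a) n * psum (term b) n) (psum (term (a + b)) n)) ⟩
    psum (term a) n * psum (term b) n - psum (term (a + b)) n
      ≡⟨ sym (cong₂ _-_ (cong₂ _*_ (expℚ-psum n a) (expℚ-psum n b)) (expℚ-psum n (a + b))) ⟩
    expℚ n a * expℚ n b - expℚ n (a + b) ∎)
    where
    open ≡-Reasoning
    eq : ∀ x y → x - y ≡ x + - 1ℚ * y
    eq = solve-∀ ring

  -- The corner is dominated termwise by the corner for `B`, which lies between the triangles of
  -- side `n` and `2n`.
  exp-product-bound : ∀ {a b B} n → 0ℚ ≤ B → ∣ a ∣ ≤ B → ∣ b ∣ ≤ B →
                      ∣ expℚ n a * expℚ n b - expℚ n (a + b) ∣ ≤ expℚ (n ℕ.+ n) (B + B) - expℚ n (B + B)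
  exp-product-bound {a} {b} {B} n 0≤B ha hb = begin
    ∣ expℚ n a * expℚ n b - expℚ n (a + b) ∣  ≡⟨ cong ∣_∣ (exp-product n a b) ⟩
    ∣ conv (term a) (λ j → psum (term b) n - psum (term b) j) n ∣  ≤⟨ ∣conv∣ n (∣term∣ ha) (∣psum-diff∣ (∣term∣ hb) n) ⟩
    conv (term B) (λ j → psum (term B) n - psum (term B) j) n  ≡⟨ sym (exp-product n B B) ⟩
    expℚ n B * expℚ n B - expℚ n (B + B)  ≤⟨ ℚ.+-monoˡ-≤ (- expℚ n (B + B)) square ⟩
    expℚ (n ℕ.+ n) (B + B) - expℚ n (B + B)  ∎
    where
    open ℚ.≤-Reasoning
    square : expℚ n B * expℚ n B ≤ expℚ (n ℕ.+ n) (B + B)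
    square = subst₂ _≤_ (sym (cong₂ _*_ (expℚ-psum n B) (expℚ-psum n B)))
      (trans (conv-psum (term B) (term B) (n ℕ.+ n)) (trans (psum-cong (conv-term B B) (n ℕ.+ n)) (sym (expℚ-psum (n ℕ.+ n) (B + B)))))
      (conv-rectangle (term-≥0 0≤B) (term-≥0 0≤B) n n)

  module Tail (C : ℚ) (0≤C : 0ℚ ≤ C) where

    m₀ : ℕ
    m₀ = proj₁ (≤ι (C + C))

    term-half : ∀ m → m₀ ℕ.≤ m → term C (suc m) ≤ ½ * term C m
    term-half m m₀≤m = *-cancelʳ-≤ (0<ι (suc m)) (subst₂ _≤_ (trans (sym (∂-term C m)) (ℚ.*-comm (ι (suc m)) (term C (suc m)))) (eq (term C m) (ι (suc m)))
        (*-monoʳ-≤ (term-≥0 0≤C m) C≤))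
      where
      eq : ∀ t l → ½ * l * t ≡ ½ * t * l
      eq = solve-∀ ring
      dbl : ∀ c → ½ * (c + c) ≡ c
      dbl = solve-∀ ring
      C≤ : C ≤ ½ * ι (suc m)
      C≤ = subst (_≤ ½ * ι (suc m)) (dbl C) (*-monoˡ-≤ 0≤½ (ℚ.≤-trans (proj₂ (≤ι (C + C))) (ι-mono (ℕ.m≤n⇒m≤1+n m₀≤m))))

    -- Past `2C` every term is at most half of the preceding one, so the partial sum plus its last
    -- term does not increase.
    tail : ∀ n k → m₀ ℕ.≤ n → expℚ (k ℕ.+ n) C - expℚ n C ≤ term C n
    tail n k h = ≤-by (0≤+ (≤⇒0≤- (go k)) (term-≥0 0≤C (k ℕ.+ n))) (eq (expℚ (k ℕ.+ n) C) (expℚ n C) (term C n) (term C (k ℕ.+ n)))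
      where
      eq : ∀ a b t u → t - (a - b) ≡ (b + t - (a + u)) + u
      eq = solve-∀ ring
      half2 : ∀ a t u → a + u - (a + t + t) ≡ (½ * u - t) + (½ * u - t)
      half2 = solve-∀ ring
      go : ∀ k → expℚ (k ℕ.+ n) C + term C (k ℕ.+ n) ≤ expℚ n C + term C n
      go zero    = ℚ.≤-refl
      go (suc k) = ℚ.≤-trans (≤-by (0≤+ d d) (half2 (expℚ (k ℕ.+ n) C) (term C (suc (k ℕ.+ n))) (term C (k ℕ.+ n)))) (go k)
        where
        d : 0ℚ ≤ ½ * term C (k ℕ.+ n) - term C (suc (k ℕ.+ n))
        d = ≤⇒0≤- (term-half (k ℕ.+ n) (ℕ.≤-trans h (ℕ.m≤n+m n k)))

    term-decay : ∀ k → term C (k ℕ.+ m₀) ≤ powℚ ½ k * term C m₀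
    term-decay zero    = ℚ.≤-reflexive (sym (ℚ.*-identityˡ _))
    term-decay (suc k) = ℚ.≤-trans (term-half (k ℕ.+ m₀) (ℕ.m≤n+m m₀ k)) (ℚ.≤-trans (*-monoˡ-≤ 0≤½ (term-decay k)) (ℚ.≤-reflexive (sym (ℚ.*-assoc ½ (powℚ ½ k) (term C m₀)))))

    tail-small : ∀ q → 0ℚ < q → Eventually (λ n → expℚ (n ℕ.+ n) C - expℚ n C ≤ q)
    tail-small q 0<q = let (N , small) = ½^-small (term C m₀) q 0<q in N ℕ.+ m₀ , λ n h →
      let m₀≤n = ℕ.≤-trans (ℕ.m≤n+m m₀ N) h in
      ℚ.≤-trans (tail n n m₀≤n) (ℚ.≤-trans (subst (λ m → term C m ≤ powℚ ½ (n ℕ.∸ m₀) * term C m₀) (ℕ.m∸n+n≡m m₀≤n) (term-decay (n ℕ.∸ m₀)))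
        (small (n ℕ.∸ m₀) (ℕ.m+n≤o⇒m≤o∸n N h)))

  exp-mul : ∀ B q → 0ℚ ≤ B → 0ℚ < q → Eventually (λ n → ∀ a b → ∣ a ∣ ≤ B → ∣ b ∣ ≤ B → ∣ expℚ n a * expℚ n b - expℚ n (a + b) ∣ ≤ q)
  exp-mul B q 0≤B 0<q = mapᵉ (λ n small a b ha hb → ℚ.≤-trans (exp-product-bound n 0≤B ha hb) small) (Tail.tail-small (B + B) (0≤+ 0≤B 0≤B) q 0<q)

  exp-0 : ∀ n → expℚ n 0ℚ ≡ 1ℚ
  exp-0 zero    = refl
  exp-0 (suc n) = cong₂ _+_ (exp-0 n) (trans (cong (_* (1/! suc n)) (ℚ.*-zeroˡ (powℚ 0ℚ n))) (ℚ.*-zeroˡ (1/! suc n)))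

  exp-≥1 : ∀ n {a} → 0ℚ ≤ a → 1ℚ ≤ expℚ n a
  exp-≥1 zero    0≤a = ℚ.≤-refl
  exp-≥1 (suc n) {a} 0≤a = subst (_≤ expℚ (suc n) a) (ℚ.+-identityʳ 1ℚ) (ℚ.+-mono-≤ (exp-≥1 n 0≤a) (term-≥0 0≤a (suc n)))

  ∣-∣≤⇒≤+ : ∀ {x y q} → ∣ x - y ∣ ≤ q → x ≤ y + q
  ∣-∣≤⇒≤+ {x} {y} {q} h = ≤-by (≤⇒0≤- (ℚ.≤-trans (≤∣∣ (x - y)) h)) (eq x y q)
    where
    eq : ∀ x y q → y + q - x ≡ q - (x - y)
    eq = solve-∀ ring

  ∣-∣≤⇒≥- : ∀ {x y q} → ∣ x - y ∣ ≤ q → y ≤ x + q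
  ∣-∣≤⇒≥- {x} {y} {q} h = ∣-∣≤⇒≤+ (subst (_≤ q) (∣-∣-sym x y) h)

  neg-involutive : ∀ q → - - q ≡ q
  neg-involutive = solve-∀ ring

  -- A truncated exponential of a nonpositive number can fall slightly outside [0,1]. After
  -- clamping, its powers decrease with the exponent.
  clamp : ℚ → ℚ
  clamp x = 0ℚ ℚ.⊔ (x ⊓ 1ℚ)

  clamp-≥0 : ∀ x → 0ℚ ≤ clamp x
  clamp-≥0 x = ℚ.p≤p⊔q 0ℚ (x ⊓ 1ℚ)

  clamp-≤1 : ∀ x → clamp x ≤ 1ℚ
  clamp-≤1 x = ℚ.⊔-lub 0≤1 (ℚ.p⊓q≤q x 1ℚ)

  clamp-near : ∀ {x q} → 0ℚ ≤ q → - q ≤ x → x ≤ 1ℚ + q → ∣ x - clamp x ∣ ≤ q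
  clamp-near {x} {q} 0≤q lo hi with ℚ.≤-total x 1ℚ | ℚ.≤-total 0ℚ (x ⊓ 1ℚ)
  ... | inj₁ x≤1 | inj₁ 0≤m = subst (λ c → ∣ x - c ∣ ≤ q) (sym (trans (ℚ.p≤q⇒p⊔q≡q 0≤m) (ℚ.p≤q⇒p⊓q≡p x≤1))) (subst (λ t → ∣ t ∣ ≤ q) (sym (ℚ.+-inverseʳ x)) 0≤q)
  ... | inj₁ x≤1 | inj₂ m≤0 = subst (λ c → ∣ x - c ∣ ≤ q) (sym (ℚ.p≥q⇒p⊔q≡p m≤0))
        (∣∣≤ (subst (_≤ q) (sym (ℚ.+-identityʳ x)) (ℚ.≤-trans (subst (_≤ 0ℚ) (ℚ.p≤q⇒p⊓q≡p x≤1) m≤0) 0≤q)) (subst₂ _≤_ (cong -_ (sym (ℚ.+-identityʳ x))) (neg-involutive q) (ℚ.neg-antimono-≤ lo)))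
  ... | inj₂ 1≤x | _ = subst (λ c → ∣ x - c ∣ ≤ q) (sym (trans (cong (0ℚ ℚ.⊔_) (ℚ.p≥q⇒p⊓q≡q 1≤x)) (ℚ.p≤q⇒p⊔q≡q 0≤1)))
        (subst (_≤ q) (sym (ℚ.0≤p⇒∣p∣≡p (≤⇒0≤- 1≤x))) (≤-by (≤⇒0≤- hi) (eq x q)))
    where
    eq : ∀ x q → q - (x - 1ℚ) ≡ 1ℚ + q - x
    eq = solve-∀ ring

  module NonPositive (B : ℚ) (0≤B : 0ℚ ≤ B) where

    In : ℚ → Set
    In u = - B ≤ u × u ≤ 0ℚ

    ∣∣-In : ∀ {u} → In u → ∣ u ∣ ≤ B
    ∣∣-In {u} (lo , hi) = ∣∣≤ (ℚ.≤-trans hi 0≤B) (subst (- u ≤_) (neg-involutive B) (ℚ.neg-antimono-≤ lo))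

    -- Up to `q` the value is the square of the exponential of `½ * u`.
    exp-lower : ∀ n q → (∀ a b → ∣ a ∣ ≤ B → ∣ b ∣ ≤ B → ∣ expℚ n a * expℚ n b - expℚ n (a + b) ∣ ≤ q) → ∀ u → In u → - q ≤ expℚ n u
    exp-lower n q mul u hu = ≤-by (0≤+ (0≤sq y) (≤⇒0≤- (∣-∣≤⇒≤+ {y * y} {expℚ n (½ * u + ½ * u)} (mul (½ * u) (½ * u) small small)))) (trans (cong (λ t → t - - q) (cong (expℚ n) (sym (dbl u)))) (eq (expℚ n (½ * u + ½ * u)) q y))
      where
      y = expℚ n (½ * u)
      dbl : ∀ u → ½ * u + ½ * u ≡ u
      dbl = solve-∀ ring
      eq : ∀ x q y → x - - q ≡ y * y + (x + q - y * y)
      eq = solve-∀ ring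
      small : ∣ ½ * u ∣ ≤ B
      small = ℚ.≤-trans (ℚ.≤-reflexive (ℚ.∣p*q∣≡∣p∣*∣q∣ ½ u)) (ℚ.≤-trans (*-monoʳ-≤ (ℚ.0≤∣p∣ u) (ℚ.≤ᵇ⇒≤ {∣ ½ ∣} {1ℚ} _)) (ℚ.≤-trans (ℚ.≤-reflexive (ℚ.*-identityˡ ∣ u ∣)) (∣∣-In hu)))

    -- The product with the exponential of `- u`, which is at least 1, equals 1 up to `q`.
    exp-upper : ∀ n q → 0ℚ ≤ q → (∀ a b → ∣ a ∣ ≤ B → ∣ b ∣ ≤ B → ∣ expℚ n a * expℚ n b - expℚ n (a + b) ∣ ≤ q) → ∀ u → In u → expℚ n u ≤ 1ℚ + q
    exp-upper n q 0≤q mul u hu with ℚ.≤-total 0ℚ (expℚ n u)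
    ... | inj₂ X≤0 = ℚ.≤-trans X≤0 (0≤+ 0≤1 0≤q)
    ... | inj₁ 0≤X = ℚ.≤-trans (subst (_≤ expℚ n u * expℚ n (- u)) (ℚ.*-identityʳ (expℚ n u)) (*-monoˡ-≤ 0≤X (exp-≥1 n (ℚ.neg-antimono-≤ (proj₂ hu)))))
          (subst (λ t → expℚ n u * expℚ n (- u) ≤ t + q) (trans (cong (expℚ n) (ℚ.+-inverseʳ u)) (exp-0 n))
            (∣-∣≤⇒≤+ {expℚ n u * expℚ n (- u)} {expℚ n (u + - u)} (mul u (- u) (∣∣-In hu) (subst (_≤ B) (sym (ℚ.∣-p∣≡∣p∣ u)) (∣∣-In hu)))))

    near : ∀ q → 0ℚ < q → Eventually (λ n → ∀ u → In u → ∣ expℚ n u - clamp (expℚ n u) ∣ ≤ q)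
    near q 0<q = mapᵉ (λ n mul u hu → clamp-near (ℚ.<⇒≤ 0<q) (exp-lower n q mul u hu) (exp-upper n q (ℚ.<⇒≤ 0<q) mul u hu)) (exp-mul B q 0≤B 0<q)

    ¼ : ℚ
    ¼ = ½ * ½

    min-pos : ∀ {q} → 0ℚ < q → 0ℚ < q ⊓ 1ℚ
    min-pos {q} 0<q with ℚ.≤-total q 1ℚ
    ... | inj₁ q≤1 = subst (0ℚ <_) (sym (ℚ.p≤q⇒p⊓q≡p q≤1)) 0<q
    ... | inj₂ 1≤q = subst (0ℚ <_) (sym (ℚ.p≥q⇒p⊓q≡q 1≤q)) 0<1

    product-close : ∀ {E X Y c d q} → 0ℚ ≤ c → c ≤ 1ℚ → ∣ d ∣ ≤ 1ℚ → 0ℚ ≤ q → q ≤ 1ℚ → ∣ X * Y - E ∣ ≤ q → ∣ X - c ∣ ≤ q → ∣ Y - d ∣ ≤ q → ∣ E - c * d ∣ ≤ q + q + q + q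
    product-close {E} {X} {Y} {c} {d} {q} 0≤c c≤1 d≤1 0≤q q≤1 h₁ h₂ h₃ = begin
      ∣ E - c * d ∣  ≤⟨ ∣-∣-triangle E (X * Y) (c * d) ⟩
      ∣ E - X * Y ∣ + ∣ X * Y - c * d ∣  ≤⟨ ℚ.+-mono-≤ (subst (_≤ q) (∣-∣-sym (X * Y) E) h₁) (subst (λ t → ∣ t ∣ ≤ ∣ (X - c) * Y ∣ + ∣ c * (Y - d) ∣) (eq X Y c d) (ℚ.∣p+q∣≤∣p∣+∣q∣ ((X - c) * Y) (c * (Y - d)))) ⟩
      q + (∣ (X - c) * Y ∣ + ∣ c * (Y - d) ∣)  ≤⟨ ℚ.+-monoʳ-≤ q (ℚ.+-mono-≤ first second) ⟩
      q + (q * (1ℚ + 1ℚ) + q)  ≡⟨ eq₂ q ⟩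
      q + q + q + q  ∎
      where
      open ℚ.≤-Reasoning
      eq : ∀ X Y c d → (X - c) * Y + c * (Y - d) ≡ X * Y - c * d
      eq = solve-∀ ring
      eq₂ : ∀ q → q + (q * (1ℚ + 1ℚ) + q) ≡ q + q + q + q
      eq₂ = solve-∀ ring
      eq₃ : ∀ Y d → (Y - d) + d ≡ Y
      eq₃ = solve-∀ ring
      Y≤2 : ∣ Y ∣ ≤ 1ℚ + 1ℚ
      Y≤2 = subst (λ t → ∣ t ∣ ≤ 1ℚ + 1ℚ) (eq₃ Y d) (ℚ.≤-trans (ℚ.∣p+q∣≤∣p∣+∣q∣ (Y - d) d) (ℚ.+-mono-≤ (ℚ.≤-trans h₃ q≤1) d≤1))
      first : ∣ (X - c) * Y ∣ ≤ q * (1ℚ + 1ℚ)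
      first = subst (_≤ q * (1ℚ + 1ℚ)) (sym (ℚ.∣p*q∣≡∣p∣*∣q∣ (X - c) Y)) (*-mono-≤ 0≤q (ℚ.0≤∣p∣ Y) h₂ Y≤2)
      second : ∣ c * (Y - d) ∣ ≤ q
      second = subst₂ _≤_ (sym (ℚ.∣p*q∣≡∣p∣*∣q∣ c (Y - d))) (ℚ.*-identityˡ q) (*-mono-≤ 0≤1 (ℚ.0≤∣p∣ (Y - d)) (subst (_≤ 1ℚ) (sym (ℚ.0≤p⇒∣p∣≡p 0≤c)) c≤1) h₃)

    abstract
      -- Induction by the product law. The index has to be uniform in `u`, since the argument used
      -- later is itself an entry of a sequence and changes with `n`.
      pow-approx : ∀ m q → 0ℚ < q → Eventually (λ n → ∀ u → In u → ∣ expℚ n (ι m * u) - powℚ (clamp (expℚ n u)) m ∣ ≤ q)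
      pow-approx zero    q 0<q = 0 , λ n _ u _ → subst (λ t → ∣ t ∣ ≤ q)
        (sym (trans (cong (_- 1ℚ) (trans (cong (expℚ n) (trans (cong (_* u) ι-0) (ℚ.*-zeroˡ u))) (exp-0 n))) (ℚ.+-inverseʳ 1ℚ))) (ℚ.<⇒≤ 0<q)
      pow-approx (suc m) q 0<q = mapᵉ combine (exp-mul (ι (suc m) * B) q′ (0≤* (0≤ι (suc m)) 0≤B) 0<q′ ∧ᵉ near q′ 0<q′ ∧ᵉ pow-approx m q′ 0<q′)
        where
        q′ : ℚ
        q′ = ¼ * (q ⊓ 1ℚ)
        0<q′ : 0ℚ < q′
        0<q′ = 0<* (0<* 0<½ 0<½) (min-pos 0<q)
        four : ∀ x → ½ * ½ * x + ½ * ½ * x + ½ * ½ * x + ½ * ½ * x ≡ x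
        four = solve-∀ ring
        4q′≤q : q′ + q′ + q′ + q′ ≤ q
        4q′≤q = ℚ.≤-trans (ℚ.≤-reflexive (four (q ⊓ 1ℚ))) (ℚ.p⊓q≤p q 1ℚ)
        q′≤1 : q′ ≤ 1ℚ
        q′≤1 = ℚ.≤-trans (*-mono-≤ 0≤1 (ℚ.<⇒≤ (min-pos 0<q)) (ℚ.≤ᵇ⇒≤ {¼} {1ℚ} _) (ℚ.p⊓q≤q q 1ℚ)) (ℚ.≤-reflexive (ℚ.*-identityˡ 1ℚ))
        bound : ∀ {x} k → k ℕ.≤ suc m → In x → ∣ ι k * x ∣ ≤ ι (suc m) * B
        bound {x} k k≤ hx = subst (_≤ ι (suc m) * B) (sym (trans (ℚ.∣p*q∣≡∣p∣*∣q∣ (ι k) x) (cong (_* ∣ x ∣) (ℚ.0≤p⇒∣p∣≡p (0≤ι k)))))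
          (*-mono-≤ (0≤ι (suc m)) (ℚ.0≤∣p∣ x) (ι-mono k≤) (∣∣-In hx))
        combine : ∀ n → (∀ a b → ∣ a ∣ ≤ ι (suc m) * B → ∣ b ∣ ≤ ι (suc m) * B → ∣ expℚ n a * expℚ n b - expℚ n (a + b) ∣ ≤ q′) ×
                        (∀ u → In u → ∣ expℚ n u - clamp (expℚ n u) ∣ ≤ q′) × (∀ u → In u → ∣ expℚ n (ι m * u) - powℚ (clamp (expℚ n u)) m ∣ ≤ q′) →
                  ∀ u → In u → ∣ expℚ n (ι (suc m) * u) - powℚ (clamp (expℚ n u)) (suc m) ∣ ≤ q
        combine n (mul , close , ih) u hu = ℚ.≤-trans (product-close {expℚ n (ι (suc m) * u)} {expℚ n u} {expℚ n (ι m * u)} {clamp (expℚ n u)} {powℚ (clamp (expℚ n u)) m} {q′} (clamp-≥0 (expℚ n u)) (clamp-≤1 (expℚ n u))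
            (subst (_≤ 1ℚ) (sym (ℚ.0≤p⇒∣p∣≡p (pow-≥0 m (clamp-≥0 (expℚ n u))))) (pow-≤1 m (clamp-≥0 (expℚ n u)) (clamp-≤1 (expℚ n u))))
            (ℚ.<⇒≤ 0<q′) q′≤1
            (subst (λ t → ∣ expℚ n u * expℚ n (ι m * u) - expℚ n t ∣ ≤ q′) arg
              (mul u (ι m * u) (subst (λ t → ∣ t ∣ ≤ ι (suc m) * B) (trans (cong (_* u) ι-1) (ℚ.*-identityˡ u)) (bound 1 (ℕ.s≤s ℕ.z≤n) hu)) (bound m (ℕ.n≤1+n m) hu)))
            (close u hu) (ih u hu)) 4q′≤q
          where
          eq : ∀ l u → u + l * u ≡ (1ℚ + l) * u
          eq = solve-∀ ring
          arg : u + ι m * u ≡ ι (suc m) * u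
          arg = trans (eq (ι m) u) (cong (_* u) (sym (ι-suc m)))

    -- Used with `u` equal to `(s/4w) ln δ`: then `x` stands for δ^(s/4w), its square for the factor
    -- δ^(s/2w) in the bound on p, and its power `w` for δ^(s/4).
    exp-powers : ∀ w q → 0ℚ < q → Eventually (λ n → ∀ u → In u →
      ∃ λ x → 0ℚ ≤ x × x ≤ 1ℚ × expℚ n (u + u) ≤ powℚ x 2 + q × powℚ x w ≤ expℚ n (ι w * u) + q)
    exp-powers w q 0<q = mapᵉ step (pow-approx 2 q 0<q ∧ᵉ pow-approx w q 0<q)
      where
      eq : ∀ u → (ℤ.+ 2 ℚ./ 1) * u ≡ u + u
      eq = solve-∀ ring
      dbl : ∀ u → ι 2 * u ≡ u + u
      dbl u = trans (cong (_* u) (ι-def 2)) (eq u)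
      Close : ℕ → ℕ → Set
      Close m n = ∀ u → In u → ∣ expℚ n (ι m * u) - powℚ (clamp (expℚ n u)) m ∣ ≤ q
      above : ∀ m n → Close m n → ∀ u → In u → expℚ n (ι m * u) ≤ powℚ (clamp (expℚ n u)) m + q
      above m n h u hu = ∣-∣≤⇒≤+ {expℚ n (ι m * u)} {powℚ (clamp (expℚ n u)) m} (h u hu)
      below : ∀ m n → Close m n → ∀ u → In u → powℚ (clamp (expℚ n u)) m ≤ expℚ n (ι m * u) + q
      below m n h u hu = ∣-∣≤⇒≥- {expℚ n (ι m * u)} {powℚ (clamp (expℚ n u)) m} (h u hu)
      step : ∀ n → Close 2 n × Close w n → ∀ u → In u →
             ∃ λ x → 0ℚ ≤ x × x ≤ 1ℚ × expℚ n (u + u) ≤ powℚ x 2 + q × powℚ x w ≤ expℚ n (ι w * u) + q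
      step n (two , many) u hu = clamp (expℚ n u) , clamp-≥0 (expℚ n u) , clamp-≤1 (expℚ n u) , square , below w n many u hu
        where
        square : expℚ n (u + u) ≤ powℚ (clamp (expℚ n u)) 2 + q
        square = subst (λ t → expℚ n t ≤ powℚ (clamp (expℚ n u)) 2 + q) (dbl u) (above 2 n two u hu)

-- The truncated logarithm and the choice of the precision

module Logarithm where
  open import Data.Rational using (ℚ; 0ℚ; 1ℚ; ½; _+_; _*_; _-_; -_; _≤_; _<_; ∣_∣; _⊓_)
  open Rationals
  open Averages
  open SecondMoment
  open Spread
  open Sunflower
  open Sparsify
  open Restrict
  open Event
  open Exponential
  open Average

  odd : ℕ → ℕ
  odd i = suc (2 ℕ.* i)

  1/suc-≥0 : ∀ m → 0ℚ ≤ ℤ.+ 1 ℚ./ suc m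
  1/suc-≥0 m = *-cancelʳ-≤ (0<ι (suc m)) (subst₂ _≤_ (sym (ℚ.*-zeroˡ (ι (suc m)))) (sym (trans (/-*-cancel 1 (suc m)) ι-1)) 0≤1)

  1/suc-≤1 : ∀ m → ℤ.+ 1 ℚ./ suc m ≤ 1ℚ
  1/suc-≤1 m = *-cancelʳ-≤ (0<ι (suc m)) (subst₂ _≤_ (sym (trans (/-*-cancel 1 (suc m)) ι-1)) (sym (ℚ.*-identityˡ (ι (suc m)))) (1≤ι (suc m)))

  pow-odd-suc : ∀ r k → powℚ r (odd (suc k)) ≡ r * r * powℚ r (odd k)
  pow-odd-suc r k = trans (cong (λ m → powℚ r (suc m)) (ℕ.*-suc 2 k)) (sym (ℚ.*-assoc r r (powℚ r (odd k))))

  module _ {r z} (0≤r : 0ℚ ≤ r) (r≤1 : r ≤ 1ℚ) (z≤r : ∣ z ∣ ≤ r) where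

    -- Comparison with the geometric series of ratio `r`. Keeping the remainder `r ^ odd k` on the
    -- right makes the induction close.
    artanh-geometric : ∀ k → ∣ artanhℚ k z ∣ * (1ℚ - r) ≤ 1ℚ - powℚ r (odd k)
    artanh-geometric zero    = ℚ.≤-trans (*-monoʳ-≤ (≤⇒0≤- r≤1) z≤r) (≤-by (0≤* (≤⇒0≤- r≤1) (≤⇒0≤- r≤1)) (eq r))
      where
      eq : ∀ r → 1ℚ - r * 1ℚ - r * (1ℚ - r) ≡ (1ℚ - r) * (1ℚ - r)
      eq = solve-∀ ring
    artanh-geometric (suc k) = begin
      ∣ artanhℚ k z + t ∣ * (1ℚ - r)  ≤⟨ *-monoʳ-≤ (≤⇒0≤- r≤1) (ℚ.≤-trans (ℚ.∣p+q∣≤∣p∣+∣q∣ (artanhℚ k z) t) (ℚ.+-monoʳ-≤ ∣ artanhℚ k z ∣ t≤)) ⟩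
      (∣ artanhℚ k z ∣ + r * r * y) * (1ℚ - r)  ≡⟨ ℚ.*-distribʳ-+ (1ℚ - r) ∣ artanhℚ k z ∣ (r * r * y) ⟩
      ∣ artanhℚ k z ∣ * (1ℚ - r) + r * r * y * (1ℚ - r)  ≤⟨ ℚ.+-monoˡ-≤ (r * r * y * (1ℚ - r)) (artanh-geometric k) ⟩
      (1ℚ - y) + r * r * y * (1ℚ - r)  ≤⟨ ≤-by (0≤* 0≤y (0≤* (≤⇒0≤- r≤1) (0≤+ 0≤1 (0≤* 0≤r (≤⇒0≤- r≤1))))) (eq r y) ⟩
      1ℚ - r * r * y  ≡⟨ cong (λ q → 1ℚ - q) (sym (pow-odd-suc r k)) ⟩
      1ℚ - powℚ r (odd (suc k))  ∎
      where
      open ℚ.≤-Reasoning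
      y t : ℚ
      y = powℚ r (odd k)
      t = powℚ z (odd (suc k)) * (ℤ.+ 1 ℚ./ odd (suc k))
      0≤y : 0ℚ ≤ y
      0≤y = pow-≥0 (odd k) 0≤r
      eq : ∀ r y → 1ℚ - r * r * y - ((1ℚ - y) + r * r * y * (1ℚ - r)) ≡ y * ((1ℚ - r) * (1ℚ + r * (1ℚ - r)))
      eq = solve-∀ ring
      t≤ : ∣ t ∣ ≤ r * r * y
      t≤ = subst₂ _≤_ (sym (trans (ℚ.∣p*q∣≡∣p∣*∣q∣ (powℚ z (odd (suc k))) (ℤ.+ 1 ℚ./ odd (suc k))) (cong₂ _*_ (∣pow∣ z (odd (suc k))) (ℚ.0≤p⇒∣p∣≡p (1/suc-≥0 (2 ℕ.* suc k))))))
        (trans (ℚ.*-identityʳ _) (pow-odd-suc r k))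
        (*-mono-≤ (pow-≥0 (odd (suc k)) 0≤r) (1/suc-≥0 (2 ℕ.* suc k)) (pow-mono (odd (suc k)) (ℚ.0≤∣p∣ z) z≤r) (1/suc-≤1 (2 ℕ.* suc k)))

    artanh-bounded : ∀ k → ∣ artanhℚ k z ∣ * (1ℚ - r) ≤ 1ℚ
    artanh-bounded k = ℚ.≤-trans (artanh-geometric k) (≤-by (pow-≥0 (odd k) 0≤r) (eq (powℚ r (odd k))))
      where
      eq : ∀ y → 1ℚ - (1ℚ - y) ≡ y
      eq = solve-∀ ring

  module _ {z} (0≤z : 0ℚ ≤ z) (z≤1 : z ≤ 1ℚ) where

    artanh-block : ∀ t a b → (∀ i → a ℕ.< i → i ℕ.≤ a ℕ.+ b → t ≤ powℚ z (odd i) * (ℤ.+ 1 ℚ./ odd i)) → artanhℚ a z + ι b * t ≤ artanhℚ (a ℕ.+ b) z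
    artanh-block t a zero    h = ℚ.≤-reflexive (trans (cong (artanhℚ a z +_) (trans (cong (_* t) ι-0) (ℚ.*-zeroˡ t))) (trans (ℚ.+-identityʳ _) (cong (λ m → artanhℚ m z) (sym (ℕ.+-identityʳ a)))))
    artanh-block t a (suc b) h = subst (λ m → artanhℚ a z + ι (suc b) * t ≤ artanhℚ m z) (sym (ℕ.+-suc a b))
      (ℚ.≤-trans (ℚ.≤-reflexive (trans (cong (λ l → artanhℚ a z + l * t) (ι-suc b)) (eq (artanhℚ a z) (ι b) t)))
        (ℚ.+-mono-≤ (artanh-block t a b (λ i lo hi → h i lo (ℕ.≤-trans hi (ℕ.+-monoʳ-≤ a (ℕ.n≤1+n b))))) (h (suc (a ℕ.+ b)) (ℕ.s≤s (ℕ.m≤m+n a b)) (ℕ.≤-reflexive (sym (ℕ.+-suc a b))))))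
      where
      eq : ∀ x b t → x + (1ℚ + b) * t ≡ x + b * t + t
      eq = solve-∀ ring

    artanh-mono : ∀ {a n} → a ℕ.≤ n → artanhℚ a z ≤ artanhℚ n z
    artanh-mono {a} {n} a≤n = subst (λ m → artanhℚ a z ≤ artanhℚ m z) (ℕ.m+[n∸m]≡n a≤n)
      (subst (_≤ artanhℚ (a ℕ.+ (n ℕ.∸ a)) z) (trans (cong (artanhℚ a z +_) (ℚ.*-zeroʳ (ι (n ℕ.∸ a)))) (ℚ.+-identityʳ (artanhℚ a z)))
        (artanh-block 0ℚ a (n ℕ.∸ a) (λ i _ _ → 0≤* (pow-≥0 (odd i) 0≤z) (1/suc-≥0 (2 ℕ.* i)))))

    bernoulli : ∀ m → 1ℚ - ι m * (1ℚ - z) ≤ powℚ z m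
    bernoulli zero    = ℚ.≤-reflexive (trans (cong (λ l → 1ℚ - l * (1ℚ - z)) ι-0) (eq z))
      where
      eq : ∀ z → 1ℚ - 0ℚ * (1ℚ - z) ≡ 1ℚ
      eq = solve-∀ ring
    bernoulli (suc m) = ≤-by (0≤+ (0≤* 0≤z (≤⇒0≤- (bernoulli m))) (0≤* (0≤* (0≤ι m) (≤⇒0≤- z≤1)) (≤⇒0≤- z≤1)))
        (trans (cong (λ l → z * powℚ z m - (1ℚ - l * (1ℚ - z))) (ι-suc m)) (eq z (powℚ z m) (ι m)))
      where
      eq : ∀ z p m → z * p - (1ℚ - (1ℚ + m) * (1ℚ - z)) ≡ z * (p - (1ℚ - m * (1ℚ - z))) + m * (1ℚ - z) * (1ℚ - z)
      eq = solve-∀ ring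

    -- The terms with 2^j < i ≤ 2^(j+1) contribute at least 1/16.
    artanh-dyadic : ∀ j → (1ℚ - z) * ι (2 ℕ.^ (3 ℕ.+ j)) ≤ 1ℚ → ι j ≤ ι 16 * artanhℚ (2 ℕ.^ j) z
    artanh-dyadic zero    _ = subst (_≤ ι 16 * artanhℚ 1 z) (sym ι-0) (0≤* (0≤ι 16) (ℚ.≤-trans 0≤z (artanh-mono {0} {1} ℕ.z≤n)))
    artanh-dyadic (suc j) h = ℚ.≤-trans (ℚ.≤-reflexive (ι-suc j)) (ℚ.≤-trans (ℚ.+-monoʳ-≤ 1ℚ (artanh-dyadic j h′))
        (ℚ.≤-trans (ℚ.≤-reflexive (cong (_+ ι 16 * artanhℚ N z) (sym mass))) (ℚ.≤-trans (ℚ.≤-reflexive (eq (ι 16) (ι N * t) (artanhℚ N z)))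
          (*-monoˡ-≤ (0≤ι 16) (subst (λ m → artanhℚ N z + ι N * t ≤ artanhℚ m z) (cong (N ℕ.+_) (sym (ℕ.+-identityʳ N))) (artanh-block t N N big))))))
      where
      N M : ℕ
      N = 2 ℕ.^ j
      M = 2 ℕ.^ (3 ℕ.+ j)
      instance
        M≢0 : ℕ.NonZero M
        M≢0 = ℕ.m^n≢0 2 (3 ℕ.+ j)
      t : ℚ
      t = ½ * invℚ (ι M)
      eq : ∀ l a b → l * a + l * b ≡ l * (b + a)
      eq = solve-∀ ring
      M≡8N : M ≡ 8 ℕ.* N
      M≡8N = ℕ.^-distribˡ-+-* 2 3 j
      mass : ι 16 * (ι N * t) ≡ 1ℚ
      mass = trans (cong (_* (ι N * t)) (ι-def 16)) (trans (eq₁ (ι N) (invℚ (ι M))) (trans (cong (_* invℚ (ι M)) (sym (trans (cong ι M≡8N) (trans (ι-* 8 N) (cong (_* ι N) (ι-def 8)))))) (inv-*ʳ (0<ι M))))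
        where
        eq₁ : ∀ n i → (ℤ.+ 16 ℚ./ 1) * (n * (½ * i)) ≡ (ℤ.+ 8 ℚ./ 1) * n * i
        eq₁ = solve-∀ ring
      ι2^ : ι (2 ℕ.^ (3 ℕ.+ suc j)) ≡ (1ℚ + 1ℚ) * ι M
      ι2^ = trans (cong (λ m → ι (2 ℕ.^ m)) (ℕ.+-suc 3 j)) (trans (ι-* 2 M) (cong (_* ι M) (ι-def 2)))
      small : (1ℚ - z) * ι M ≤ ½
      small = ℚ.*-cancelˡ-≤-pos (1ℚ + 1ℚ) (subst (_≤ 1ℚ) (trans (cong ((1ℚ - z) *_) ι2^) (eq₂ (1ℚ - z) (ι M))) h)
        where
        eq₂ : ∀ a m → a * ((1ℚ + 1ℚ) * m) ≡ (1ℚ + 1ℚ) * (a * m)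
        eq₂ = solve-∀ ring
      h′ : (1ℚ - z) * ι (2 ℕ.^ (3 ℕ.+ j)) ≤ 1ℚ
      h′ = ℚ.≤-trans small ½≤1
      -- Here `odd i ≤ 1 + 4N ≤ 8N = M`, so Bernoulli's inequality gives `z ^ odd i ≥ ½` and the
      -- reciprocal of `odd i` is at least `1/M`. The `N` terms of the block then reach 1/16.
      big : ∀ i → N ℕ.< i → i ℕ.≤ N ℕ.+ N → t ≤ powℚ z (odd i) * (ℤ.+ 1 ℚ./ odd i)
      big i lo hi = *-mono-≤ {½} {powℚ z (odd i)} {invℚ (ι M)} (pow-≥0 (odd i) 0≤z) (inv-≥0 (0<ι M)) (ℚ.≤-trans (≤-by (≤⇒0≤- m[1-z]≤½) (eq₃ (ι (odd i) * (1ℚ - z)))) (bernoulli (odd i))) recip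
        where
        odd≤M : odd i ℕ.≤ M
        odd≤M = ℕ.≤-trans (ℕ.s≤s (ℕ.*-monoʳ-≤ 2 hi)) (ℕ.≤-trans (ℕ.+-monoˡ-≤ (2 ℕ.* (N ℕ.+ N)) (ℕ.m^n>0 2 j)) (ℕ.≤-trans (ℕ.≤-reflexive (n₁ N)) (ℕ.≤-trans (ℕ.m≤m+n (5 ℕ.* N) (3 ℕ.* N)) (ℕ.≤-reflexive (trans (n₂ N) (sym M≡8N))))))
          where
          n₁ : ∀ N → N ℕ.+ 2 ℕ.* (N ℕ.+ N) ≡ 5 ℕ.* N
          n₁ = ℕ-solve-∀
          n₂ : ∀ N → 5 ℕ.* N ℕ.+ 3 ℕ.* N ≡ 8 ℕ.* N
          n₂ = ℕ-solve-∀
        m[1-z]≤½ : ι (odd i) * (1ℚ - z) ≤ ½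
        m[1-z]≤½ = ℚ.≤-trans (*-monoʳ-≤ (≤⇒0≤- z≤1) (ι-mono odd≤M)) (subst (_≤ ½) (ℚ.*-comm (1ℚ - z) (ι M)) small)
        eq₃ : ∀ x → 1ℚ - x - ½ ≡ ½ - x
        eq₃ = solve-∀ ring
        recip : invℚ (ι M) ≤ ℤ.+ 1 ℚ./ odd i
        recip = *-cancelʳ-≤ (0<ι (odd i)) (subst (invℚ (ι M) * ι (odd i) ≤_) (sym (trans (/-*-cancel 1 (odd i)) ι-1))
          (ℚ.≤-trans (*-monoˡ-≤ (inv-≥0 (0<ι M)) (ι-mono odd≤M)) (ℚ.≤-reflexive (trans (ℚ.*-comm (invℚ (ι M)) (ι M)) (inv-*ʳ (0<ι M))))))

  möbius : ℚ → ℚ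
  möbius v = (v - 1ℚ) * invℚ (v + 1ℚ)

  lnℚ : ℕ → ℚ → ℚ
  lnℚ n v = (ℤ.+ 2 ℚ./ 1) * artanhℚ n (möbius v)

  0≤2 : 0ℚ ≤ ℤ.+ 2 ℚ./ 1
  0≤2 = ℚ.≤ᵇ⇒≤ _

  module _ {v : ℚ} (0≤v : 0ℚ ≤ v) where

    0<v+1 : 0ℚ < v + 1ℚ
    0<v+1 = ℚ.<-≤-trans 0<1 (subst (_≤ v + 1ℚ) (ℚ.+-identityˡ 1ℚ) (ℚ.+-monoˡ-≤ 1ℚ 0≤v))

    möbius-≤1 : möbius v ≤ 1ℚ
    möbius-≤1 = *inv≤ 0<v+1 (≤-by (0≤+ 0≤1 0≤1) (eq v))
      where
      eq : ∀ v → 1ℚ * (v + 1ℚ) - (v - 1ℚ) ≡ 1ℚ + 1ℚ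
      eq = solve-∀ ring

    möbius-≥0 : 1ℚ ≤ v → 0ℚ ≤ möbius v
    möbius-≥0 1≤v = 0≤* (≤⇒0≤- 1≤v) (inv-≥0 0<v+1)

    möbius-gap : (1ℚ - möbius v) * (v + 1ℚ) ≡ 1ℚ + 1ℚ
    möbius-gap = trans (eq v (invℚ (v + 1ℚ))) (trans (cong (λ t → v + 1ℚ - (v - 1ℚ) * t) (inv-*ʳ 0<v+1)) (eq′ v))
      where
      eq : ∀ v i → (1ℚ - (v - 1ℚ) * i) * (v + 1ℚ) ≡ v + 1ℚ - (v - 1ℚ) * ((v + 1ℚ) * i)
      eq = solve-∀ ring
      eq′ : ∀ v → v + 1ℚ - (v - 1ℚ) * 1ℚ ≡ 1ℚ + 1ℚ
      eq′ = solve-∀ ring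

  -- For `z = möbius v` the gap `1 - z` is `2/(v + 1)`, at most `2^(-3-j)`. The first `2^j` terms of
  -- the series thus behave like a harmonic sum, which makes the bound valid from an index depending
  -- on `j` alone.
  ln-lower : ∀ j n v → ι (2 ℕ.^ (4 ℕ.+ j)) ≤ v → 2 ℕ.^ j ℕ.≤ n → ι j ≤ ι 8 * lnℚ n v
  ln-lower j n v big enough = begin
    ι j  ≤⟨ artanh-dyadic 0≤z z≤1 j gap ⟩
    ι 16 * artanhℚ (2 ℕ.^ j) z  ≤⟨ *-monoˡ-≤ (0≤ι 16) (artanh-mono 0≤z z≤1 enough) ⟩
    ι 16 * artanhℚ n z  ≡⟨ cong (_* artanhℚ n z) (trans (ι-* 8 2) (cong (ι 8 *_) (ι-def 2))) ⟩
    ι 8 * (ℤ.+ 2 ℚ./ 1) * artanhℚ n z  ≡⟨ ℚ.*-assoc (ι 8) (ℤ.+ 2 ℚ./ 1) (artanhℚ n z) ⟩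
    ι 8 * lnℚ n v  ∎
    where
    open ℚ.≤-Reasoning
    z : ℚ
    z = möbius v
    1≤v : 1ℚ ≤ v
    1≤v = ℚ.≤-trans (1≤ι (2 ℕ.^ (4 ℕ.+ j)) {{ℕ.m^n≢0 2 (4 ℕ.+ j)}}) big
    0≤v : 0ℚ ≤ v
    0≤v = ℚ.≤-trans 0≤1 1≤v
    0≤z : 0ℚ ≤ z
    0≤z = möbius-≥0 0≤v 1≤v
    z≤1 : z ≤ 1ℚ
    z≤1 = möbius-≤1 0≤v
    gap : (1ℚ - z) * ι (2 ℕ.^ (3 ℕ.+ j)) ≤ 1ℚ
    gap = ℚ.*-cancelˡ-≤-pos (1ℚ + 1ℚ) (begin
      (1ℚ + 1ℚ) * ((1ℚ - z) * ι (2 ℕ.^ (3 ℕ.+ j)))    ≡⟨ eq (1ℚ - z) (ι (2 ℕ.^ (3 ℕ.+ j))) ⟩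
      (1ℚ - z) * ((ℤ.+ 2 ℚ./ 1) * ι (2 ℕ.^ (3 ℕ.+ j))) ≡⟨ cong ((1ℚ - z) *_) (sym (trans (ι-* 2 (2 ℕ.^ (3 ℕ.+ j))) (cong (_* ι (2 ℕ.^ (3 ℕ.+ j))) (ι-def 2)))) ⟩
      (1ℚ - z) * ι (2 ℕ.^ (4 ℕ.+ j))  ≤⟨ *-monoˡ-≤ (≤⇒0≤- z≤1) (ℚ.≤-trans big (subst (_≤ v + 1ℚ) (ℚ.+-identityʳ v) (ℚ.+-monoʳ-≤ v 0≤1))) ⟩
      (1ℚ - z) * (v + 1ℚ)  ≡⟨ möbius-gap 0≤v ⟩
      1ℚ + 1ℚ  ≡⟨ sym (ℚ.*-identityʳ (1ℚ + 1ℚ)) ⟩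
      (1ℚ + 1ℚ) * 1ℚ  ∎)
      where
      eq : ∀ a m → (1ℚ + 1ℚ) * (a * m) ≡ a * ((ℤ.+ 2 ℚ./ 1) * m)
      eq = solve-∀ ring

  module LnBounded (q D : ℚ) (0<q : 0ℚ < q) (0≤D : 0ℚ ≤ D) where

    -- `μ` bounds both `1 - z = 2/(v + 1)` and `1 + z = 2v/(v + 1)` from below, where `z = möbius v`
    -- and `q ≤ v ≤ D`; so `r` keeps `z` away from the singularities at 1 and -1.
    m μ r : ℚ
    m = q ⊓ 1ℚ
    μ = m * invℚ (D + 1ℚ)
    r = 1ℚ - μ

    0<m : 0ℚ < m
    0<m = NonPositive.min-pos 0ℚ ℚ.≤-refl 0<q

    0<μ : 0ℚ < μ
    0<μ = 0<* 0<m (inv->0 (0<v+1 0≤D))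

    μ≤1 : μ ≤ 1ℚ
    μ≤1 = *inv≤ (0<v+1 0≤D) (ℚ.≤-trans (ℚ.p⊓q≤q q 1ℚ) (subst (1ℚ ≤_) (sym (ℚ.*-identityˡ (D + 1ℚ))) (subst (_≤ D + 1ℚ) (ℚ.+-identityˡ 1ℚ) (ℚ.+-monoˡ-≤ 1ℚ 0≤D))))

    bound : ℚ
    bound = (ℤ.+ 2 ℚ./ 1) * invℚ μ

    0≤bound : 0ℚ ≤ bound
    0≤bound = 0≤* 0≤2 (inv-≥0 0<μ)

    ln-bounded : ∀ n v → q ≤ v → v ≤ D → ∣ lnℚ n v ∣ ≤ bound
    ln-bounded n v q≤v v≤D = subst (_≤ bound) (sym (ℚ.∣p*q∣≡∣p∣*∣q∣ (ℤ.+ 2 ℚ./ 1) (artanhℚ n z)))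
        (*-monoˡ-≤ 0≤2 (subst (∣ artanhℚ n z ∣ ≤_) (ℚ.*-identityˡ (invℚ μ)) (≤*inv 0<μ (subst (λ t → ∣ artanhℚ n z ∣ * t ≤ 1ℚ) (eq₀ μ) (artanh-bounded (≤⇒0≤- μ≤1) r≤1 z≤r n)))))
      where
      z : ℚ
      z = möbius v
      0≤v : 0ℚ ≤ v
      0≤v = ℚ.≤-trans (ℚ.<⇒≤ 0<q) q≤v
      eq₀ : ∀ μ → 1ℚ - (1ℚ - μ) ≡ μ
      eq₀ = solve-∀ ring
      r≤1 : r ≤ 1ℚ
      r≤1 = ≤-by (ℚ.<⇒≤ 0<μ) (eq₀ μ)
      μ[v+1]≤m : μ * (v + 1ℚ) ≤ m
      μ[v+1]≤m = subst (_≤ m) (eq m (invℚ (D + 1ℚ)) (v + 1ℚ)) (*inv≤ (0<v+1 0≤D) (*-monoˡ-≤ (ℚ.<⇒≤ 0<m) (ℚ.+-monoˡ-≤ 1ℚ v≤D)))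
        where
        eq : ∀ m i x → m * x * i ≡ m * i * x
        eq = solve-∀ ring
      z≤r : ∣ z ∣ ≤ r
      z≤r = ∣∣≤ (*inv≤ (0<v+1 0≤v) (≤-by (0≤+ (≤⇒0≤- (ℚ.≤-trans μ[v+1]≤m (ℚ.p⊓q≤q q 1ℚ))) 0≤1) (eq₁ μ v)))
          (subst (_≤ r) (sym (eq₂ (v - 1ℚ) (invℚ (v + 1ℚ)))) (*inv≤ (0<v+1 0≤v) (≤-by (0≤+ (≤⇒0≤- (ℚ.≤-trans μ[v+1]≤m (ℚ.≤-trans (ℚ.p⊓q≤p q 1ℚ) q≤v))) 0≤v) (eq₃ μ v))))
        where
        eq₁ : ∀ μ v → (1ℚ - μ) * (v + 1ℚ) - (v - 1ℚ) ≡ 1ℚ - μ * (v + 1ℚ) + 1ℚ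
        eq₁ = solve-∀ ring
        eq₂ : ∀ a i → - (a * i) ≡ - a * i
        eq₂ = solve-∀ ring
        eq₃ : ∀ μ v → (1ℚ - μ) * (v + 1ℚ) - - (v - 1ℚ) ≡ v - μ * (v + 1ℚ) + v
        eq₃ = solve-∀ ring

  2ℚ : ℚ
  2ℚ = ℤ.+ 2 ℚ./ 1

  module _ (n : ℕ) where

    private
      ⅓ : ℚ
      ⅓ = ℤ.+ 1 ℚ./ 3

      möbius-2 : möbius 2ℚ ≡ ⅓
      möbius-2 = refl

      0≤⅓ : 0ℚ ≤ ⅓
      0≤⅓ = ℚ.≤ᵇ⇒≤ _

      ⅓≤1 : ⅓ ≤ 1ℚ
      ⅓≤1 = ℚ.≤ᵇ⇒≤ _

      0<artanh⅓ : 0ℚ < artanhℚ n ⅓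
      0<artanh⅓ = ℚ.<-≤-trans (ℚ.positive⁻¹ ⅓) (artanh-mono 0≤⅓ ⅓≤1 {0} {n} ℕ.z≤n)

      artanh⅓≤ : (1ℚ + 1ℚ) * artanhℚ n ⅓ ≤ ℤ.+ 3 ℚ./ 1
      artanh⅓≤ = subst₂ _≤_ (trans (cong (λ t → (ℤ.+ 3 ℚ./ 1) * (t * (1ℚ - ⅓))) (ℚ.0≤p⇒∣p∣≡p (ℚ.<⇒≤ 0<artanh⅓))) (eq (artanhℚ n ⅓))) (ℚ.*-identityʳ (ℤ.+ 3 ℚ./ 1))
        (*-monoˡ-≤ {c = ℤ.+ 3 ℚ./ 1} (ℚ.≤ᵇ⇒≤ _) (artanh-bounded 0≤⅓ ⅓≤1 (ℚ.≤-refl {⅓}) n))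
        where
        eq : ∀ a → (ℤ.+ 3 ℚ./ 1) * (a * (1ℚ - (ℤ.+ 1 ℚ./ 3))) ≡ (1ℚ + 1ℚ) * a
        eq = solve-∀ ring

    0<ln2 : 0ℚ < lnℚ n 2ℚ
    0<ln2 = 0<* (ℚ.positive⁻¹ 2ℚ) (subst (λ z → 0ℚ < artanhℚ n z) (sym möbius-2) 0<artanh⅓)

    ln2≤3 : lnℚ n 2ℚ ≤ ι 3
    ln2≤3 = subst₂ _≤_ (cong (λ z → 2ℚ * artanhℚ n z) (sym möbius-2)) (sym (ι-def 3)) artanh⅓≤

  log₂-lower : ∀ j n v → ι (2 ℕ.^ (4 ℕ.+ j)) ≤ v → 2 ℕ.^ j ℕ.≤ n → ι j ≤ ι 24 * (lnℚ n v * invℚ (lnℚ n 2ℚ))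
  log₂-lower j n v big enough = subst (ι j ≤_) (ℚ.*-assoc (ι 24) (lnℚ n v) (invℚ (lnℚ n 2ℚ))) (≤*inv (0<ln2 n) (begin
      ι j * lnℚ n 2ℚ  ≤⟨ *-monoˡ-≤ (0≤ι j) (ln2≤3 n) ⟩
      ι j * ι 3  ≤⟨ *-monoʳ-≤ (0≤ι 3) (ln-lower j n v big enough) ⟩
      ι 8 * lnℚ n v * ι 3  ≡⟨ eq (ι 8) (ι 3) (lnℚ n v) ⟩
      ι 8 * ι 3 * lnℚ n v  ≡⟨ cong (_* lnℚ n v) (sym (ι-* 8 3)) ⟩
      ι 24 * lnℚ n v  ∎))
    where
    open ℚ.≤-Reasoning
    eq : ∀ a b x → a * x * b ≡ a * b * x
    eq = solve-∀ ring

  -- The search descends from `N` and stops at the first failure. The failing predecessor is what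
  -- later bounds ε from above.
  least : ∀ {P : ℕ → Set} → (∀ k → Dec (P k)) → ∀ N → P N → ∃ λ K → P K × (∀ k → K ≡ suc k → ¬ P k)
  least P? zero    p = 0 , p , λ _ ()
  least P? (suc N) p with P? N
  ... | yes p′ = least P? N p′
  ... | no ¬p  = suc N , p , λ { k refl → ¬p }

  module Precision (ε : ℝ) (0<ε : fromℕ 0 Defs.< seq ε) where

    q : ℚ
    q = proj₁ 0<ε

    0<q : 0ℚ < q
    0<q = proj₁ (proj₂ 0<ε)

    q≤ε : Eventually (λ k → q ≤ seq ε k)
    q≤ε = mapᵉ (λ k → subst (_≤ seq ε k) (ℚ.+-identityˡ q)) (proj₂ (proj₂ 0<ε))

    ½q : ℚ
    ½q = ½ * q

    modulus : ∃ λ N → ∀ m n → N ℕ.≤ m → N ℕ.≤ n → ∣ seq ε m - seq ε n ∣ ≤ ½q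
    modulus = cauchy ε ½q (0<* 0<½ 0<q)

    N₀ : ℕ
    N₀ = proj₁ modulus ℕ.⊔ proj₁ q≤ε

    a : ℚ
    a = seq ε N₀

    q≤a : q ≤ a
    q≤a = proj₂ q≤ε N₀ (ℕ.m≤n⊔m (proj₁ modulus) (proj₁ q≤ε))

    0<a : 0ℚ < a
    0<a = ℚ.<-≤-trans 0<q q≤a

    close : ∀ k → N₀ ℕ.≤ k → ∣ seq ε k - a ∣ ≤ ½ * a
    close k N₀≤k = ℚ.≤-trans (proj₂ modulus k N₀ (ℕ.m⊔n≤o⇒m≤o (proj₁ modulus) (proj₁ q≤ε) N₀≤k) (ℕ.m≤m⊔n (proj₁ modulus) (proj₁ q≤ε))) (*-monoˡ-≤ 0≤½ q≤a)

    ½a≤ε : ∀ k → N₀ ℕ.≤ k → ½ * a ≤ seq ε k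
    ½a≤ε k h = ≤-by (≤⇒0≤- (∣-∣≤⇒≥- {seq ε k} {a} (close k h))) (eq (seq ε k) a)
      where
      eq : ∀ e a → e - ½ * a ≡ e + ½ * a - a
      eq = solve-∀ ring

    ε≤2a : ∀ k → N₀ ℕ.≤ k → seq ε k ≤ 2ℚ * a
    ε≤2a k h = ℚ.≤-trans (∣-∣≤⇒≤+ {seq ε k} {a} (close k h)) (≤-by (0≤* 0≤½ (ℚ.<⇒≤ 0<a)) (eq a))
      where
      eq : ∀ a → (ℤ.+ 2 ℚ./ 1) * a - (a + ½ * a) ≡ ½ * a
      eq = solve-∀ ring

    exists : ∃ λ N → powℚ ½ N ≤ ½ * a
    exists = let (N , h) = ½^-small 1ℚ (½ * a) (0<* 0<½ 0<a) in N , subst (_≤ ½ * a) (ℚ.*-identityʳ (powℚ ½ N)) (h N ℕ.≤-refl)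

    minimal : ∃ λ K → powℚ ½ K ≤ ½ * a × (∀ k → K ≡ suc k → ¬ (powℚ ½ k ≤ ½ * a))
    minimal = least (λ k → powℚ ½ k ℚ.≤? ½ * a) (proj₁ exists) (proj₂ exists)

    -- `2^(-K)` is below ε, and for positive `K` by a factor of at most 8, since eventually ε lies
    -- between `½ a` and `2 a`.
    K : ℕ
    K = proj₁ minimal

    ½^K≤ε : Eventually (λ k → powℚ ½ K ≤ seq ε k)
    ½^K≤ε = N₀ , λ k h → ℚ.≤-trans (proj₁ (proj₂ minimal)) (½a≤ε k h)

    1≤log : ∀ k → 1ℚ ≤ log1/ (seq ε) k
    1≤log k = ℚ.p≤p⊔q 1ℚ (lnℚ k (1ℚ * invℚ (seq ε k)) * invℚ (lnℚ k 2ℚ))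

    -- A minimal K > 7 has ε ≤ 2^(3 - K), so the dyadic bound applies with j = K - 7.
    log-lower : ∀ j → K ≡ 7 ℕ.+ j → ∀ k → N₀ ℕ.⊔ 2 ℕ.^ j ℕ.≤ k → ι j ≤ ι 24 * log1/ (seq ε) k
    log-lower j K≡ k h = ℚ.≤-trans (log₂-lower j k v v-big (ℕ.m⊔n≤o⇒n≤o N₀ (2 ℕ.^ j) h)) (*-monoˡ-≤ (0≤ι 24) (ℚ.p≤q⊔p 1ℚ (lnℚ k v * invℚ (lnℚ k 2ℚ))))
      where
      e v : ℚ
      e = seq ε k
      v = 1ℚ * invℚ e
      N₀≤k : N₀ ℕ.≤ k
      N₀≤k = ℕ.m⊔n≤o⇒m≤o N₀ (2 ℕ.^ j) h
      0<e : 0ℚ < e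
      0<e = ℚ.<-≤-trans (0<* 0<½ 0<a) (½a≤ε k N₀≤k)
      above : ½ * a ≤ powℚ ½ (6 ℕ.+ j)
      above = ℚ.<⇒≤ (ℚ.≰⇒> (proj₂ (proj₂ minimal) (6 ℕ.+ j) K≡))
      e≤ : e ≤ powℚ ½ (4 ℕ.+ j)
      e≤ = ℚ.≤-trans (ε≤2a k N₀≤k) (subst₂ _≤_ (eq₁ a) (trans (cong ((ℤ.+ 4 ℚ./ 1) *_) (pow-+ ½ 2 (4 ℕ.+ j))) (eq₂ (powℚ ½ (4 ℕ.+ j)))) (*-monoˡ-≤ {c = ℤ.+ 4 ℚ./ 1} (ℚ.≤ᵇ⇒≤ _) above))
        where
        eq₁ : ∀ a → (ℤ.+ 4 ℚ./ 1) * (½ * a) ≡ (ℤ.+ 2 ℚ./ 1) * a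
        eq₁ = solve-∀ ring
        eq₂ : ∀ x → (ℤ.+ 4 ℚ./ 1) * (½ * (½ * 1ℚ) * x) ≡ x
        eq₂ = solve-∀ ring
      v-big : ι (2 ℕ.^ (4 ℕ.+ j)) ≤ v
      v-big = ≤*inv 0<e (ℚ.≤-trans (*-monoˡ-≤ (0≤ι (2 ℕ.^ (4 ℕ.+ j))) e≤) (ℚ.≤-reflexive (trans (ℚ.*-comm (ι (2 ℕ.^ (4 ℕ.+ j))) (powℚ ½ (4 ℕ.+ j))) (pow½-2^ (4 ℕ.+ j)))))

    -- `2K + 2` is the index `suc J` of the cap on the number of terms. The constant is 16 + 2 · 24:
    -- with `K = 7 + j` the part 16 is covered by `log1/ ≥ 1`, and `2j` by the factor 24 of
    -- `log₂-lower`.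
    Cost : ℕ → Set
    Cost k = ι (suc (suc (K ℕ.+ K))) ≤ ι 64 * log1/ (seq ε) k

    cost-small : K ℕ.≤ 7 → ∀ k → Cost k
    cost-small K≤7 k = ℚ.≤-trans (ι-mono (ℕ.≤-trans (ℕ.s≤s (ℕ.s≤s (ℕ.+-mono-≤ K≤7 K≤7))) (ℕ.m≤m+n 16 48)))
      (subst (_≤ ι 64 * log1/ (seq ε) k) (ℚ.*-identityʳ (ι 64)) (*-monoˡ-≤ (0≤ι 64) (1≤log k)))

    cost-large : ∀ j → K ≡ 7 ℕ.+ j → ∀ k → N₀ ℕ.⊔ 2 ℕ.^ j ℕ.≤ k → Cost k
    cost-large j K≡ k h = combine (log1/ (seq ε) k) (1≤log k) (log-lower j K≡ k h)
      where
      regroup : ∀ a b c l → a * l + b * (c * l) ≡ (a + b * c) * l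
      regroup = solve-∀ ring
      nat : ∀ j → suc (suc ((7 ℕ.+ j) ℕ.+ (7 ℕ.+ j))) ≡ 16 ℕ.+ 2 ℕ.* j
      nat = ℕ-solve-∀
      2K+2≡ : ι (suc (suc (K ℕ.+ K))) ≡ ι 16 + ι 2 * ι j
      2K+2≡ = trans (cong ι (trans (cong (λ K → suc (suc (K ℕ.+ K))) K≡) (nat j))) (trans (ι-+ 16 (2 ℕ.* j)) (cong (ι 16 +_) (ι-* 2 j)))
      combine : ∀ ℓ → 1ℚ ≤ ℓ → ι j ≤ ι 24 * ℓ → ι (suc (suc (K ℕ.+ K))) ≤ ι 64 * ℓ
      combine ℓ 1≤ℓ j≤ = ℚ.≤-trans (ℚ.≤-reflexive 2K+2≡) (ℚ.≤-trans
        (ℚ.+-mono-≤ (subst (_≤ ι 16 * ℓ) (ℚ.*-identityʳ (ι 16)) (*-monoˡ-≤ (0≤ι 16) 1≤ℓ)) (*-monoˡ-≤ (0≤ι 2) j≤))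
        (ℚ.≤-reflexive (trans (regroup (ι 16) (ι 2) (ι 24) ℓ) (cong (_* ℓ) (sym (trans (ι-+ 16 48) (cong (ι 16 +_) (ι-* 2 24))))))))

    precision-cost : Eventually Cost
    precision-cost = cases (K ℕ.≤? 7)
      where
      cases : Dec (K ℕ.≤ 7) → Eventually Cost
      cases (yes K≤7) = 0 , λ k _ → cost-small K≤7 k
      cases (no K≰7)  = N₀ ℕ.⊔ 2 ℕ.^ (K ℕ.∸ 7) , cost-large (K ℕ.∸ 7) (sym (ℕ.m+[n∸m]≡n (ℕ.<⇒≤ (ℕ.≰⇒> K≰7))))

-- The constant and the final numerical estimate

module Bounds where
  open import Data.Rational using (ℚ; 0ℚ; 1ℚ; ½; _+_; _*_; _-_; -_; _≤_; _<_; ∣_∣; _⊓_)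
  open Rationals
  open Averages
  open SecondMoment
  open Spread
  open Sunflower
  open Sparsify
  open Restrict
  open Event
  open Exponential
  open Logarithm
  open Average

  bounded : ∀ (x : ℝ) → ∃ λ S → 0ℚ ≤ S × Eventually (λ k → ∣ seq x k ∣ ≤ S)
  bounded x = ∣ seq x N ∣ + 1ℚ , 0≤+ (ℚ.0≤∣p∣ (seq x N)) 0≤1 , N , λ k N≤k →
      subst (λ t → ∣ t ∣ ≤ ∣ seq x N ∣ + 1ℚ) (eq (seq x N) (seq x k)) (ℚ.≤-trans (ℚ.∣p+q∣≤∣p∣+∣q∣ (seq x N) (seq x k - seq x N)) (ℚ.+-monoʳ-≤ ∣ seq x N ∣ (proj₂ (cauchy x 1ℚ 0<1) k N N≤k ℕ.≤-refl)))
    where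
    N : ℕ
    N = proj₁ (cauchy x 1ℚ 0<1)
    eq : ∀ a b → a + (b - a) ≡ b
    eq = solve-∀ ring

  -- The weights converge at different rates, but there are finitely many subsets, so a common index
  -- exists.
  all-subsets : ∀ {n} {P : Subset n → ℕ → Set} → (∀ L → Eventually (P L)) → Eventually (λ k → ∀ L → P L k)
  all-subsets {zero}  h = mapᵉ (λ { k p [] → p }) (h [])
  all-subsets {suc n} h = mapᵉ (λ { k (p , q) (outside ∷ L) → p L ; k (p , q) (inside ∷ L) → q L })
    (all-subsets (h ∘ (outside ∷_)) ∧ᵉ all-subsets (h ∘ (inside ∷_)))

  all-list : ∀ {A : Set} {Q : A → Set} {P : A → ℕ → Set} → (∀ x → Q x → Eventually (P x)) → ∀ {xs} → All Q xs → Eventually (λ k → All (λ x → P x k) xs)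
  all-list h []  = 0 , λ _ _ → []
  all-list h (q ∷ qs) = mapᵉ (λ _ (p , ps) → p ∷ ps) (h _ q ∧ᵉ all-list h qs)

  sum-ΣL : ∀ {A : Set} (f : A → Seq) xs k → Defs.sum (map f xs) k ≡ ΣL (λ x → f x k) xs
  sum-ΣL f []  k = refl
  sum-ΣL f (x ∷ xs) k = cong (f x k +_) (sum-ΣL f xs k)

  ΣL-filter : ∀ {A : Set} (f : A → ℚ) p xs → ΣL f (filterᵇ p xs) ≡ ΣL (λ x → f x * ind (p x)) xs
  ΣL-filter f p []  = refl
  ΣL-filter f p (x ∷ xs) with p x
  ... | true  = cong₂ _+_ (sym (ℚ.*-identityʳ (f x))) (ΣL-filter f p xs)
  ... | false = trans (ΣL-filter f p xs) (trans (sym (ℚ.+-identityˡ _)) (cong (_+ ΣL (λ x → f x * ind (p x)) xs) (sym (ℚ.*-zeroʳ (f x)))))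

  ΣL-≥- : ∀ {A : Set} (a g : A → ℚ) η xs → 0ℚ ≤ η → (∀ x → - η ≤ a x) → (∀ x → 0ℚ ≤ g x) → (∀ x → g x ≤ 1ℚ) → - (ι (length xs) * η) ≤ ΣL (λ x → a x * g x) xs
  ΣL-≥- a g η xs 0≤η a≥ g≥0 g≤1 = ℚ.≤-trans (ℚ.≤-reflexive (trans (neg (ι (length xs)) η) (sym (ΣL-const (- η) xs)))) (ΣL-mono pointwise xs)
    where
    neg : ∀ l η → - (l * η) ≡ l * - η
    neg = solve-∀ ring
    eq : ∀ a g η → a * g - - η ≡ (a - - η) * g + η * (1ℚ - g)
    eq = solve-∀ ring
    pointwise : ∀ x → - η ≤ a x * g x
    pointwise x = ≤-by (0≤+ (0≤* (≤⇒0≤- (a≥ x)) (g≥0 x)) (0≤* 0≤η (≤⇒0≤- (g≤1 x)))) (eq (a x) (g x) η)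

  -- Since `y + q ≤ 2`, a further factor at most doubles the coefficient of `q` and adds at most 1
  -- to it; tripling covers both.
  pow-perturb : ∀ {y q} h → 0ℚ ≤ y → y ≤ 1ℚ → 0ℚ ≤ q → q ≤ 1ℚ → powℚ (y + q) h ≤ powℚ y h + q * powℚ (ι 3) h
  pow-perturb {y} {q} zero    0≤y y≤1 0≤q q≤1 = ≤-by (0≤* 0≤q 0≤1) (eq q)
    where
    eq : ∀ q → 1ℚ + q * 1ℚ - 1ℚ ≡ q * 1ℚ
    eq = solve-∀ ring
  pow-perturb {y} {q} (suc h) 0≤y y≤1 0≤q q≤1 = ℚ.≤-trans (*-monoˡ-≤ (0≤+ 0≤y 0≤q) (pow-perturb h 0≤y y≤1 0≤q q≤1))
      (≤-by (0≤+ (0≤* 0≤q (≤⇒0≤- (pow-≤1 h 0≤y y≤1))) (0≤+ (0≤* 0≤q (≤⇒0≤- 1≤T)) (0≤* (0≤* 0≤q 0≤T) (0≤+ (≤⇒0≤- y≤1) (≤⇒0≤- q≤1)))))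
        (trans (cong (λ t → y * powℚ y h + q * (t * T′) - (y + q) * (powℚ y h + q * T′)) (ι-def 3)) (eq y q (powℚ y h) T′)))
    where
    T′ : ℚ
    T′ = powℚ (ι 3) h
    0≤T : 0ℚ ≤ T′
    0≤T = pow-≥0 h (0≤ι 3)
    1≤T : 1ℚ ≤ T′
    1≤T = pow-≥1 h (1≤ι 3)
    eq : ∀ y q p T → y * p + q * ((ℤ.+ 3 ℚ./ 1) * T) - (y + q) * (p + q * T) ≡ q * (1ℚ - p) + (q * (T - 1ℚ) + q * T * (1ℚ - y + (1ℚ - q)))
    eq = solve-∀ ring

  pow-square : ∀ a h → powℚ (a * a) h ≡ powℚ a (h ℕ.+ h)
  pow-square a h = trans (pow-* a a h) (sym (pow-+ a h h))

  -- 8 · 1024 · 64, where 1024 w³ j is the base of cap w j, the factor 8 absorbs the 4 · 2^w of the union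
  -- bound, and 64 is the constant in precision-cost.
  Γ : ℕ
  Γ = 524288

  abstract
    -- The inverse square of `Γ`: the union bound needs `p` below `1/A²`, where `A ≤ Γ w³ log(1/ε)`.
    c₀ : ℚ
    c₀ = invℚ (ι Γ * ι Γ)

    0<ΓΓ : 0ℚ < ι Γ * ι Γ
    0<ΓΓ = 0<* (0<ι Γ) (0<ι Γ)

    0<c₀ : 0ℚ < c₀
    0<c₀ = inv->0 0<ΓΓ

    c₀-inverse : ι Γ * ι Γ * c₀ ≡ 1ℚ
    c₀-inverse = inv-*ʳ 0<ΓΓ

    c₀≤½ : c₀ ≤ ½
    c₀≤½ = subst (_≤ ½) (ℚ.*-identityˡ c₀) (*inv≤ 0<ΓΓ (ℚ.≤-trans (ℚ.≤ᵇ⇒≤ {1ℚ} {½ * (2ℚ * 2ℚ)} _) (*-monoˡ-≤ 0≤½ (*-mono-≤ (0≤ι Γ) 0≤2 2≤Γ 2≤Γ))))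
      where
      2≤Γ : 2ℚ ≤ ι Γ
      2≤Γ = subst (_≤ ι Γ) (ι-def 2) (ι-mono (ℕ.s≤s (ℕ.s≤s ℕ.z≤n)))

  constant : ℝ
  constant = record { seq = fromℚ c₀ ; cauchy = λ q 0<q → 0 , λ _ _ _ _ → subst (λ t → ∣ t ∣ ≤ q) (sym (ℚ.+-inverseʳ c₀)) (ℚ.<⇒≤ 0<q) }

  0<constant : fromℕ 0 Defs.< seq constant
  0<constant = c₀ , 0<c₀ , 0 , λ _ _ → ℚ.≤-reflexive (ℚ.+-identityˡ c₀)

  constant<1 : seq constant Defs.< fromℕ 1
  constant<1 = ½ , 0<½ , 0 , λ _ _ → ℚ.+-monoˡ-≤ ½ c₀≤½

  0<s≤0⇒⊥ : ∀ (s : Seq) → fromℕ 0 Defs.< s → s Defs.≤ fromℕ 0 → ⊥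
  0<s≤0⇒⊥ s (q , 0<q , lo) hi = ℚ.<-irrefl refl (ℚ.<-≤-trans 0<½q (≤-by (≤⇒0≤- q≤½q) (eq q)))
    where
    0<½q : 0ℚ < ½ * q
    0<½q = 0<* 0<½ 0<q
    both = lo ∧ᵉ hi (½ * q) 0<½q
    at = proj₂ both (proj₁ both) ℕ.≤-refl
    q≤½q : 0ℚ + q ≤ 0ℚ + ½ * q
    q≤½q = ℚ.≤-trans (proj₁ at) (proj₂ at)
    eq : ∀ q → 0ℚ - ½ * q ≡ 0ℚ + ½ * q - (0ℚ + q)
    eq = solve-∀ ring

  module Estimate (A w h N : ℕ) .{{_ : ℕ.NonZero A}} (w≤2h : w ℕ.≤ h ℕ.+ h) (N≤ : N ℕ.* 2 ℕ.≤ A ℕ.^ (h ℕ.+ h)) where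

    a β : ℚ
    a = invℚ (ι A)
    β = a * a

    Aa≡1 : ι A * a ≡ 1ℚ
    Aa≡1 = inv-*ʳ (0<ι A)

    0≤a : 0ℚ ≤ a
    0≤a = inv-≥0 (0<ι A)

    0≤β : 0ℚ ≤ β
    0≤β = 0≤* 0≤a 0≤a

    a≤1 : a ≤ 1ℚ
    a≤1 = subst₂ _≤_ (ℚ.*-identityˡ a) Aa≡1 (*-monoʳ-≤ 0≤a (1≤ι A))

    β≤1 : β ≤ 1ℚ
    β≤1 = ℚ.≤-trans (*-mono-≤ 0≤1 0≤a a≤1 a≤1) (ℚ.≤-reflexive (ℚ.*-identityˡ 1ℚ))

    βAA≡1 : β * (ι A * ι A) ≡ 1ℚ
    βAA≡1 = trans (eq a (ι A)) (trans (cong₂ _*_ Aa≡1 Aa≡1) (ℚ.*-identityˡ 1ℚ))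
      where
      eq : ∀ a A → a * a * (A * A) ≡ A * a * (A * a)
      eq = solve-∀ ring

    -- With `p` at most `β x²`, the number of index sets is cancelled exactly by `β ^ h`, and only
    -- the power of `x` is left.
    Nβ≤1 : ι N * (2ℚ * powℚ β h) ≤ 1ℚ
    Nβ≤1 = begin
      ι N * (2ℚ * powℚ β h)  ≡⟨ trans (sym (ℚ.*-assoc (ι N) 2ℚ (powℚ β h))) (cong₂ _*_ (trans (cong (ι N *_) (sym (ι-def 2))) (sym (ι-* N 2))) (pow-square a h)) ⟩
      ι (N ℕ.* 2) * powℚ a (h ℕ.+ h)  ≤⟨ *-monoʳ-≤ (pow-≥0 (h ℕ.+ h) 0≤a) (ι-mono N≤) ⟩
      ι (A ℕ.^ (h ℕ.+ h)) * powℚ a (h ℕ.+ h)  ≡⟨ cong (_* powℚ a (h ℕ.+ h)) (ι-^ A (h ℕ.+ h)) ⟩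
      powℚ (ι A) (h ℕ.+ h) * powℚ a (h ℕ.+ h)  ≡⟨ sym (pow-* (ι A) a (h ℕ.+ h)) ⟩
      powℚ (ι A * a) (h ℕ.+ h)  ≡⟨ trans (cong (λ t → powℚ t (h ℕ.+ h)) Aa≡1) (pow-1 (h ℕ.+ h)) ⟩
      1ℚ  ∎
      where open ℚ.≤-Reasoning

    c₀/D²≤β : ∀ {D} → 0ℚ < D → ι A ≤ ι Γ * D → c₀ * invℚ (powℚ D 2) ≤ β
    c₀/D²≤β {D} 0<D A≤ΓD = *-cancelʳ-≤ (0<* (0<ι A) (0<ι A)) (begin
      Z * (ι A * ι A)  ≤⟨ *-monoˡ-≤ 0≤Z (*-mono-≤ (ℚ.≤-trans (0≤ι A) A≤ΓD) (0≤ι A) A≤ΓD A≤ΓD) ⟩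
      Z * (ι Γ * D * (ι Γ * D))  ≡⟨ eq c₀ (invℚ (powℚ D 2)) (ι Γ) D ⟩
      ι Γ * ι Γ * c₀ * (powℚ D 2 * invℚ (powℚ D 2)) ≡⟨ cong₂ _*_ c₀-inverse (inv-*ʳ (pow->0 2 0<D)) ⟩
      1ℚ * 1ℚ  ≡⟨ sym βAA≡1 ⟩
      β * (ι A * ι A)  ∎)
      where
      open ℚ.≤-Reasoning
      Z : ℚ
      Z = c₀ * invℚ (powℚ D 2)
      0≤Z : 0ℚ ≤ Z
      0≤Z = 0≤* (ℚ.<⇒≤ 0<c₀) (inv-≥0 (pow->0 2 0<D))
      eq : ∀ c i G D → c * i * (G * D * (G * D)) ≡ G * G * c * (D * (D * 1ℚ) * i)
      eq = solve-∀ ring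

    module _ {x E D P t q : ℚ} (0≤q : 0ℚ ≤ q) (2q≤1 : q + q ≤ 1ℚ) (0≤x : 0ℚ ≤ x) (x≤1 : x ≤ 1ℚ) (E≤ : E ≤ powℚ x 2 + q)
             (0<D : 0ℚ < D) (A≤ΓD : ι A ≤ ι Γ * D) (P≤ : P ≤ c₀ * E * invℚ (powℚ D 2) + q) (P≥ : - q ≤ P) (t≥ : powℚ x w ≤ t + q) where

      y Z : ℚ
      y = β * powℚ x 2
      Z = c₀ * invℚ (powℚ D 2)

      0≤x² : 0ℚ ≤ powℚ x 2
      0≤x² = pow-≥0 2 0≤x

      0≤y : 0ℚ ≤ y
      0≤y = 0≤* 0≤β 0≤x²

      y≤1 : y ≤ 1ℚ
      y≤1 = ℚ.≤-trans (*-mono-≤ 0≤1 0≤x² β≤1 (pow-≤1 2 0≤x x≤1)) (ℚ.≤-reflexive (ℚ.*-identityˡ 1ℚ))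

      0≤Z : 0ℚ ≤ Z
      0≤Z = 0≤* (ℚ.<⇒≤ 0<c₀) (inv-≥0 (pow->0 2 0<D))

      P≤y+2q : P ≤ y + (q + q)
      P≤y+2q = begin
        P  ≤⟨ P≤ ⟩
        c₀ * E * invℚ (powℚ D 2) + q  ≡⟨ cong (_+ q) (eq c₀ E (invℚ (powℚ D 2))) ⟩
        Z * E + q  ≤⟨ ℚ.+-monoˡ-≤ q (*-monoˡ-≤ 0≤Z E≤) ⟩
        Z * (powℚ x 2 + q) + q  ≤⟨ ℚ.+-monoˡ-≤ q (*-monoʳ-≤ (0≤+ 0≤x² 0≤q) (c₀/D²≤β 0<D A≤ΓD)) ⟩
        β * (powℚ x 2 + q) + q  ≤⟨ ≤-by (0≤* 0≤q (≤⇒0≤- β≤1)) (eq₂ β (powℚ x 2) q) ⟩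
        y + (q + q)  ∎
        where
        open ℚ.≤-Reasoning
        eq : ∀ c E i → c * E * i ≡ c * i * E
        eq = solve-∀ ring
        eq₂ : ∀ β s q → β * s + (q + q) - (β * (s + q) + q) ≡ q * (1ℚ - β)
        eq₂ = solve-∀ ring

      -- An entry of the sequence for p may be slightly negative, so its powers are estimated
      -- through the absolute value.
      ∣P∣≤ : ∣ P ∣ ≤ y + (q + q)
      ∣P∣≤ = ∣∣≤ P≤y+2q (ℚ.≤-trans (subst (- P ≤_) (neg-involutive q) (ℚ.neg-antimono-≤ P≥)) (≤-by (0≤+ 0≤y 0≤q) (eq y q)))
        where
        eq : ∀ y q → y + (q + q) - q ≡ y + q
        eq = solve-∀ ring

      slack : ℚ
      slack = ι N * (2ℚ * ((q + q) * powℚ (ι 3) h))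

      -- After cancelling `N` by `β ^ h` the main part is `x ^ (2h)`. As `x ≤ 1` and `w ≤ 2h`, it is
      -- at most `x ^ w`, hence close to δ^(s/4) or below.
      estimate : ι N * (2ℚ * powℚ P h) ≤ t + q + slack
      estimate = begin
        ι N * (2ℚ * powℚ P h)  ≤⟨ *-monoˡ-≤ (0≤ι N) (*-monoˡ-≤ 0≤2 power) ⟩
        ι N * (2ℚ * (powℚ β h * powℚ x w + (q + q) * powℚ (ι 3) h))    ≡⟨ eq (ι N) 2ℚ (powℚ β h) (powℚ x w) ((q + q) * powℚ (ι 3) h) ⟩
        ι N * (2ℚ * powℚ β h) * powℚ x w + slack  ≤⟨ ℚ.+-monoˡ-≤ slack (ℚ.≤-trans (*-monoʳ-≤ (pow-≥0 w 0≤x) Nβ≤1) (ℚ.≤-trans (ℚ.≤-reflexive (ℚ.*-identityˡ (powℚ x w))) t≥)) ⟩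
        t + q + slack  ∎
        where
        open ℚ.≤-Reasoning
        eq : ∀ N c b x s → N * (c * (b * x + s)) ≡ N * (c * b) * x + N * (c * s)
        eq = solve-∀ ring
        x²^h : powℚ (powℚ x 2) h ≡ powℚ x (h ℕ.+ h)
        x²^h = trans (cong (λ s → powℚ (x * s) h) (ℚ.*-identityʳ x)) (pow-square x h)
        power : powℚ P h ≤ powℚ β h * powℚ x w + (q + q) * powℚ (ι 3) h
        power = ℚ.≤-trans (ℚ.≤-trans (≤∣∣ (powℚ P h)) (ℚ.≤-reflexive (∣pow∣ P h)))
          (ℚ.≤-trans (pow-mono h (ℚ.0≤∣p∣ P) ∣P∣≤) (ℚ.≤-trans (pow-perturb h 0≤y y≤1 (0≤+ 0≤q 0≤q) 2q≤1)
            (ℚ.+-monoˡ-≤ ((q + q) * powℚ (ι 3) h) (ℚ.≤-trans (ℚ.≤-reflexive (trans (pow-* β (powℚ x 2) h) (cong (powℚ β h *_) x²^h)))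
              (*-monoˡ-≤ (pow-≥0 h 0≤β) (pow-anti 0≤x x≤1 w≤2h))))))

  module Budget (w j : ℕ) .{{_ : ℕ.NonZero w}} where

    b A h : ℕ
    b = 64 ℕ.* (w ℕ.* (16 ℕ.* (w ℕ.* w) ℕ.* j))
    A = 8 ℕ.* b
    h = suc (w ℕ./ 2)

    w≤2h : w ℕ.≤ h ℕ.+ h
    w≤2h = subst (ℕ._≤ h ℕ.+ h) (sym (ℕ.m≡m%n+[m/n]*n w 2)) (ℕ.≤-trans (ℕ.+-monoˡ-≤ (w ℕ./ 2 ℕ.* 2) (ℕ.<⇒≤ (ℕ.m%n<n w 2))) (ℕ.≤-reflexive (eq (w ℕ./ 2))))
      where
      eq : ∀ m → 2 ℕ.+ m ℕ.* 2 ≡ suc m ℕ.+ suc m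
      eq = ℕ-solve-∀

    -- One factor 2 counts the two approximators, the other is the constant in the definition of the
    -- class; `4 ≤ 4 ^ w` moves both into the base.
    count : ∀ N → N ℕ.≤ (b ℕ.^ w ℕ.+ b ℕ.^ w) ℕ.* 2 ℕ.^ w → .{{_ : ℕ.NonZero A}} → N ℕ.* 2 ℕ.≤ A ℕ.^ (h ℕ.+ h)
    count N N≤ = begin
      N ℕ.* 2  ≤⟨ ℕ.*-monoˡ-≤ 2 N≤ ⟩
      (b ℕ.^ w ℕ.+ b ℕ.^ w) ℕ.* 2 ℕ.^ w ℕ.* 2  ≡⟨ eq₁ (b ℕ.^ w) (2 ℕ.^ w) ⟩
      4 ℕ.* (2 ℕ.^ w ℕ.* b ℕ.^ w)  ≤⟨ ℕ.*-monoˡ-≤ (2 ℕ.^ w ℕ.* b ℕ.^ w) (4≤4^w w) ⟩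
      4 ℕ.^ w ℕ.* (2 ℕ.^ w ℕ.* b ℕ.^ w)  ≡⟨ cong (4 ℕ.^ w ℕ.*_) (sym (*-^ 2 b w)) ⟩
      4 ℕ.^ w ℕ.* (2 ℕ.* b) ℕ.^ w  ≡⟨ sym (*-^ 4 (2 ℕ.* b) w) ⟩
      (4 ℕ.* (2 ℕ.* b)) ℕ.^ w  ≡⟨ cong (ℕ._^ w) (eq₂ b) ⟩
      A ℕ.^ w  ≤⟨ ℕ.^-monoʳ-≤ A w≤2h ⟩
      A ℕ.^ (h ℕ.+ h)  ∎
      where
      open ℕ.≤-Reasoning
      eq₁ : ∀ x y → (x ℕ.+ x) ℕ.* y ℕ.* 2 ≡ 4 ℕ.* (y ℕ.* x)
      eq₁ = ℕ-solve-∀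
      eq₂ : ∀ b → 4 ℕ.* (2 ℕ.* b) ≡ 8 ℕ.* b
      eq₂ = ℕ-solve-∀
      4≤4^w : ∀ w .{{_ : ℕ.NonZero w}} → 4 ℕ.≤ 4 ℕ.^ w
      4≤4^w (suc w) = ℕ.m≤m*n 4 (4 ℕ.^ w) {{ℕ.m^n≢0 4 w}}
      *-^ : ∀ x y k → (x ℕ.* y) ℕ.^ k ≡ x ℕ.^ k ℕ.* y ℕ.^ k
      *-^ x y zero    = refl
      *-^ x y (suc k) = trans (cong (x ℕ.* y ℕ.*_) (*-^ x y k)) (eq x y (x ℕ.^ k) (y ℕ.^ k))
        where
        eq : ∀ x y a b → x ℕ.* y ℕ.* (a ℕ.* b) ≡ x ℕ.* a ℕ.* (y ℕ.* b)
        eq = ℕ-solve-∀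

    A≤ : ∀ ℓ → ι j ≤ ι 64 * ℓ → ι A ≤ ι Γ * (powℚ (ι w) 3 * ℓ)
    A≤ ℓ j≤ = begin
      ι A  ≡⟨ trans (cong ι (nat w j)) (ι-* (8192 ℕ.* (w ℕ.* (w ℕ.* (w ℕ.* 1)))) j) ⟩
      ι (8192 ℕ.* (w ℕ.* (w ℕ.* (w ℕ.* 1)))) * ι j  ≡⟨ cong (_* ι j) (trans (ι-* 8192 (w ℕ.^ 3)) (cong (ι 8192 *_) (ι-^ w 3))) ⟩
      ι 8192 * powℚ (ι w) 3 * ι j  ≤⟨ *-monoˡ-≤ (0≤* (0≤ι 8192) (pow-≥0 3 (0≤ι w))) j≤ ⟩
      ι 8192 * powℚ (ι w) 3 * (ι 64 * ℓ)  ≡⟨ eq (ι 8192) (powℚ (ι w) 3) (ι 64) ℓ ⟩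
      ι 8192 * ι 64 * (powℚ (ι w) 3 * ℓ)  ≡⟨ cong (_* (powℚ (ι w) 3 * ℓ)) (sym (ι-* 8192 64)) ⟩
      ι Γ * (powℚ (ι w) 3 * ℓ)  ∎
      where
      open ℚ.≤-Reasoning
      eq : ∀ a w b l → a * w * (b * l) ≡ a * b * (w * l)
      eq = solve-∀ ring
      nat : ∀ w j → 8 ℕ.* (64 ℕ.* (w ℕ.* (16 ℕ.* (w ℕ.* w) ℕ.* j))) ≡ 8192 ℕ.* (w ℕ.* (w ℕ.* (w ℕ.* 1))) ℕ.* j
      nat = ℕ-solve-∀

-- Assembly for real parameters

module Conclusion where
  open import Data.Rational using (ℚ; 0ℚ; 1ℚ; ½; _+_; _*_; _-_; -_; _≤_; _<_; ∣_∣; _⊓_)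
  open Rationals
  open Averages
  open SecondMoment
  open Spread
  open Sunflower
  open Sparsify
  open Restrict
  open Event
  open Exponential
  open Logarithm
  open Bounds
  open Average

  module Proof (δ ε s p : ℝ) (w : ℕ) .{{_ : ℕ.NonZero w}}
               (0<δ : fromℕ 0 Defs.< seq δ) (0<ε : fromℕ 0 Defs.< seq ε)
               (p≤ : seq p Defs.≤ pBound (seq constant) (seq δ) (seq ε) (seq s) w)
               (n : ℕ) (φ : DNF (Fin n)) (width : HasWidth (ℤ.+ w ℚ./ 1) φ)
               (𝒟 : Distribution n) (class : InClass (seq p) w 𝒟) where

    open Precision ε 0<ε using (K; ½^K≤ε; precision-cost; 1≤log)
    open GoodEvent n w K φ width
    open Budget w (suc J) using (b; A; w≤2h; count; A≤)

    instance
      ww≢0 : ℕ.NonZero (w ℕ.* w)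
      ww≢0 = ℕ.m*n≢0 w w

      16ww≢0 : ℕ.NonZero (16 ℕ.* (w ℕ.* w))
      16ww≢0 = ℕ.m*n≢0 16 (w ℕ.* w)

      rounds≢0 : ℕ.NonZero (16 ℕ.* (w ℕ.* w) ℕ.* suc J)
      rounds≢0 = ℕ.m*n≢0 (16 ℕ.* (w ℕ.* w)) (suc J)

      w*rounds≢0 : ℕ.NonZero (w ℕ.* (16 ℕ.* (w ℕ.* w) ℕ.* suc J))
      w*rounds≢0 = ℕ.m*n≢0 w (16 ℕ.* (w ℕ.* w) ℕ.* suc J)

      b≢0 : ℕ.NonZero b
      b≢0 = ℕ.m*n≢0 64 (w ℕ.* (16 ℕ.* (w ℕ.* w) ℕ.* suc J))

      A≢0 : ℕ.NonZero A
      A≢0 = ℕ.m*n≢0 8 b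

    open Estimate A w h (length Is) w≤2h (count (length Is) Is-length)

    S N C : ℚ
    S = ι (length (subsets n))
    N = ι (length Is)
    C = 1ℚ + S + N * (1ℚ + S)

    0≤S : 0ℚ ≤ S
    0≤S = 0≤ι (length (subsets n))

    0≤N : 0ℚ ≤ N
    0≤N = 0≤ι (length Is)

    0<C : 0ℚ < C
    0<C = 0<+ (0<+ 0<1 0≤S) (0≤* 0≤N (0≤+ 0≤1 0≤S))

    S≤C : S ≤ C
    S≤C = ≤-by (0≤+ 0≤1 (0≤* 0≤N (0≤+ 0≤1 0≤S))) (eq S N)
      where
      eq : ∀ S N → 1ℚ + S + N * (1ℚ + S) - S ≡ 1ℚ + N * (1ℚ + S)
      eq = solve-∀ ring

    a-at : ℕ → Subset n → ℚ
    a-at k L = seq (weight 𝒟 L) k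

    R : ℕ → ℚ
    R k = ΣL (λ L → a-at k L * goodPr L) (subsets n)

    R≡ : ∀ k → restrictionPr 𝒟 good k ≡ R k
    R≡ k = sum-ΣL (λ L → seq (weight 𝒟 L) Defs.* fromℚ (goodPr L)) (subsets n) k

    Pr≡ : ∀ P k → Pr 𝒟 P k ≡ ΣL (λ L → a-at k L * ind (P L)) (subsets n)
    Pr≡ P k = trans (sum-ΣL (λ L → seq (weight 𝒟 L)) (filterᵇ P (subsets n)) k) (ΣL-filter (a-at k) P (subsets n))

    weights-≥ : ∀ η → 0ℚ < η → Eventually (λ k → ∀ L → - η ≤ a-at k L)
    weights-≥ η 0<η = all-subsets (λ L → mapᵉ (λ k h → ≤-by (≤⇒0≤- h) (eq (a-at k L) η)) (nonneg 𝒟 L η 0<η))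
      where
      eq : ∀ a η → a - - η ≡ a + η - 0ℚ
      eq = solve-∀ ring

    total-≥ : ∀ η → 0ℚ < η → Eventually (λ k → 1ℚ - η ≤ ΣL (a-at k) (subsets n))
    total-≥ η 0<η = mapᵉ (λ k h → subst (1ℚ - η ≤_) (sum-ΣL (λ L → seq (weight 𝒟 L)) (subsets n) k) (≤-by (≤⇒0≤- h) (eq (Defs.sum (map (λ L → seq (weight 𝒟 L)) (subsets n)) k) η)))
        (proj₂ (total 𝒟) η 0<η)
      where
      eq : ∀ x η → x - (1ℚ - η) ≡ x + η - 1ℚ
      eq = solve-∀ ring

    -- Allows the bound of the class 𝒟_p(w) to be applied to the sets of size `h`.
    h≤w : h ℕ.≤ w
    h≤w = ℕ.m/n<m w 2 (ℕ.s≤s (ℕ.s≤s ℕ.z≤n))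

    hits-≤ : ∀ η → 0ℚ < η → Eventually (λ k → All (λ I → ΣL (λ L → a-at k L * hit I L) (subsets n) ≤ 2ℚ * powℚ (seq p k) h + η) Is)
    hits-≤ η 0<η = all-list (λ I size≡ → mapᵉ (λ k le → subst₂ (λ x m → x ≤ 2ℚ * powℚ (seq p k) m + η) (Pr≡ (λ L → does (I ⊆? L)) k) size≡ le)
      (InClass.bounded class I (ℕ.≤-trans (ℕ.≤-reflexive size≡) h≤w) η 0<η)) Is-size

    index : Fin n
    index = fromℕ< {0} (ℕ.<-≤-trans (ℕ.>-nonZero⁻¹ w) (InClass.k≤n class))

    -- By regularity at any one variable, p is a sum of weights, each of which is nonnegative up to
    -- a tolerance. A variable exists because `1 ≤ w ≤ n`.
    p-≥ : ∀ q → 0ℚ < q → Eventually (λ k → - q ≤ seq p k)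
    p-≥ q 0<q = mapᵉ step (weights-≥ η 0<η ∧ᵉ proj₁ (InClass.regular class index) (½ * q) (0<* 0<½ 0<q))
      where
      0<1+S : 0ℚ < 1ℚ + S
      0<1+S = 0<+ 0<1 0≤S
      η : ℚ
      η = ½ * q * invℚ (1ℚ + S)
      0<η : 0ℚ < η
      0<η = 0<* (0<* 0<½ 0<q) (inv->0 0<1+S)
      Sη≤ : S * η ≤ ½ * q
      Sη≤ = ≤-by (ℚ.<⇒≤ 0<η) (trans (cong (_- S * η) (sym (trans (eq₁ (½ * q) (invℚ (1ℚ + S)) (1ℚ + S)) (trans (cong (½ * q *_) (inv-*ʳ 0<1+S)) (ℚ.*-identityʳ (½ * q)))))) (eq₂ S η))
        where
        eq₁ : ∀ h i x → x * (h * i) ≡ h * (x * i)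
        eq₁ = solve-∀ ring
        eq₂ : ∀ S η → (1ℚ + S) * η - S * η ≡ η
        eq₂ = solve-∀ ring
      step : ∀ k → (∀ L → - η ≤ a-at k L) × (Pr 𝒟 (λ L → does (index ∈? L)) k ≤ seq p k + ½ * q) → - q ≤ seq p k
      step k (a≥ , Pr≤) = ≤-by (0≤+ (≤⇒0≤- Pr≤) (0≤+ (≤⇒0≤- (subst (- (S * η) ≤_) (sym (Pr≡ (λ L → does (index ∈? L)) k))
          (ΣL-≥- (a-at k) (λ L → ind (does (index ∈? L))) η (subsets n) (ℚ.<⇒≤ 0<η) a≥ (λ L → 0≤ind (does (index ∈? L))) (λ L → ind≤1 (does (index ∈? L)))))) (≤⇒0≤- Sη≤)))
          (eq (seq p k) q (Pr 𝒟 (λ L → does (index ∈? L)) k) (S * η))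
        where
        eq : ∀ p q x y → p - - q ≡ p + ½ * q - x + (x - - y + (½ * q - y))
        eq = solve-∀ ring

    -- Entries at index `k`: `x` is the logarithm of δ^(s/2w), `u` that of its square root, `t`
    -- approximates δ^(s/4), and `ℓ` is the logarithmic factor of ε.
    lnδ x u t ℓ : ℕ → ℚ
    lnδ k = lnℚ k (seq δ k)
    x k = seq s k * invℚ (ℤ.+ (2 ℕ.* w) ℚ./ 1) * lnδ k
    u k = ½ * x k
    t k = expℚ k (seq s k * invℚ (ℤ.+ 4 ℚ./ 1) * lnδ k)
    ℓ k = log1/ (seq ε) k

    u+u≡x : ∀ k → u k + u k ≡ x k
    u+u≡x k = eq (x k)
      where
      eq : ∀ x → ½ * x + ½ * x ≡ x
      eq = solve-∀ ring

    instance
      2w≢0 : ℕ.NonZero (2 ℕ.* w)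
      2w≢0 = ℕ.m*n≢0 2 w

    0<2w : 0ℚ < ℤ.+ (2 ℕ.* w) ℚ./ 1
    0<2w = subst (0ℚ <_) (ι-def (2 ℕ.* w)) (0<ι (2 ℕ.* w))

    t≡ : ∀ k → expℚ k (ι w * u k) ≡ t k
    t≡ k = cong (expℚ k) (trans (eq₁ (ι w) (seq s k) i (lnδ k)) (trans (cong (λ y → seq s k * (½ * y) * lnδ k) wi≡½) refl))
      where
      i : ℚ
      i = invℚ (ℤ.+ (2 ℕ.* w) ℚ./ 1)
      eq₁ : ∀ w s i l → w * (½ * (s * i * l)) ≡ s * (½ * (w * i)) * l
      eq₁ = solve-∀ ring
      eq₂ : ∀ w i → w * i ≡ ½ * ((ℤ.+ 2 ℚ./ 1) * w * i)
      eq₂ = solve-∀ ring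
      wi≡½ : ι w * i ≡ ½
      wi≡½ = trans (eq₂ (ι w) i) (trans (cong (λ y → ½ * (y * i)) (trans (cong (_* ι w) (sym (ι-def 2))) (trans (sym (ι-* 2 w)) (ι-def (2 ℕ.* w))))) (trans (cong (½ *_) (inv-*ʳ 0<2w)) (ℚ.*-identityʳ ½)))

    s-bound = bounded s
    δ-bound = bounded δ
    module Ln = LnBounded (proj₁ 0<δ) (proj₁ δ-bound) (proj₁ (proj₂ 0<δ)) (proj₁ (proj₂ δ-bound))

    B : ℚ
    B = ½ * (proj₁ s-bound * invℚ (ℤ.+ (2 ℕ.* w) ℚ./ 1) * Ln.bound)

    0≤B : 0ℚ ≤ B
    0≤B = 0≤* 0≤½ (0≤* (0≤* (proj₁ (proj₂ s-bound)) (inv-≥0 0<2w)) Ln.0≤bound)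

    u-bounded : Eventually (λ k → ∣ u k ∣ ≤ B)
    u-bounded = mapᵉ step (proj₂ (proj₂ s-bound) ∧ᵉ proj₂ (proj₂ δ-bound) ∧ᵉ proj₂ (proj₂ 0<δ))
      where
      i : ℚ
      i = invℚ (ℤ.+ (2 ℕ.* w) ℚ./ 1)
      step : ∀ k → ∣ seq s k ∣ ≤ proj₁ s-bound × ∣ seq δ k ∣ ≤ proj₁ δ-bound × 0ℚ + proj₁ 0<δ ≤ seq δ k → ∣ u k ∣ ≤ B
      step k (s≤ , δ≤ , δ≥) = subst (_≤ B) (sym abs) (*-monoˡ-≤ 0≤½ (*-mono-≤ (0≤* (proj₁ (proj₂ s-bound)) (inv-≥0 0<2w)) (ℚ.0≤∣p∣ (lnδ k))
          (*-monoʳ-≤ (inv-≥0 0<2w) s≤) (Ln.ln-bounded k (seq δ k) (subst (_≤ seq δ k) (ℚ.+-identityˡ (proj₁ 0<δ)) δ≥) (ℚ.≤-trans (≤∣∣ (seq δ k)) δ≤))))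
        where
        abs : ∣ u k ∣ ≡ ½ * (∣ seq s k ∣ * i * ∣ lnδ k ∣)
        abs = trans (ℚ.∣p*q∣≡∣p∣*∣q∣ ½ (x k)) (cong (½ *_) (trans (ℚ.∣p*q∣≡∣p∣*∣q∣ (seq s k * i) (lnδ k))
          (cong (_* ∣ lnδ k ∣) (trans (ℚ.∣p*q∣≡∣p∣*∣q∣ (seq s k) i) (cong (∣ seq s k ∣ *_) (ℚ.0≤p⇒∣p∣≡p (inv-≥0 0<2w)))))))

    open NonPositive B 0≤B using (In; exp-powers; min-pos)

    module _ (q : ℚ) (0<q : 0ℚ < q) where

      -- The tolerance `q` is halved. One half, `C η`, pays for the approximate weights; the other,
      -- at least `C₁ q₁`, for the approximate exponentials and for p.
      C₁ q₁ η : ℚ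
      C₁ = (1ℚ + 1ℚ) + N * (2ℚ * ((1ℚ + 1ℚ) * powℚ (ι 3) h))
      q₁ = (½ * q ⊓ 1ℚ) * invℚ C₁
      η = ½ * q * invℚ C

      0≤rest : 0ℚ ≤ N * (2ℚ * ((1ℚ + 1ℚ) * powℚ (ι 3) h))
      0≤rest = 0≤* 0≤N (0≤* 0≤2 (0≤* (0≤+ 0≤1 0≤1) (pow-≥0 h (0≤ι 3))))

      0<C₁ : 0ℚ < C₁
      0<C₁ = 0<+ (0<+ 0<1 0≤1) 0≤rest

      0<½q : 0ℚ < ½ * q
      0<½q = 0<* 0<½ 0<q

      0<q₁ : 0ℚ < q₁
      0<q₁ = 0<* (min-pos 0<½q) (inv->0 0<C₁)

      0≤q₁ : 0ℚ ≤ q₁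
      0≤q₁ = ℚ.<⇒≤ 0<q₁

      0<η : 0ℚ < η
      0<η = 0<* 0<½q (inv->0 0<C)

      *-inv-cancel : ∀ {a c} → 0ℚ < c → c * (a * invℚ c) ≡ a
      *-inv-cancel {a} {c} 0<c = trans (eq a c (invℚ c)) (trans (cong (a *_) (inv-*ʳ 0<c)) (ℚ.*-identityʳ a))
        where
        eq : ∀ a c i → c * (a * i) ≡ a * (c * i)
        eq = solve-∀ ring

      C₁q₁≡ : C₁ * q₁ ≡ ½ * q ⊓ 1ℚ
      C₁q₁≡ = *-inv-cancel 0<C₁

      Cη≡ : C * η ≡ ½ * q
      Cη≡ = *-inv-cancel 0<C

      2q₁≤1 : q₁ + q₁ ≤ 1ℚ
      2q₁≤1 = ℚ.≤-trans (≤-by (0≤* 0≤rest 0≤q₁) (eq q₁ (N * (2ℚ * ((1ℚ + 1ℚ) * powℚ (ι 3) h))))) (ℚ.≤-trans (ℚ.≤-reflexive C₁q₁≡) (ℚ.p⊓q≤q (½ * q) 1ℚ))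
        where
        eq : ∀ q r → (1ℚ + 1ℚ + r) * q - (q + q) ≡ r * q
        eq = solve-∀ ring

      slack≤ : q₁ + N * (2ℚ * ((q₁ + q₁) * powℚ (ι 3) h)) ≤ ½ * q
      slack≤ = ℚ.≤-trans (≤-by 0≤q₁ (eq q₁ N 2ℚ (powℚ (ι 3) h))) (ℚ.≤-trans (ℚ.≤-reflexive C₁q₁≡) (ℚ.p⊓q≤p (½ * q) 1ℚ))
        where
        eq : ∀ q N c T → (1ℚ + 1ℚ + N * (c * ((1ℚ + 1ℚ) * T))) * q - (q + N * (c * ((q + q) * T))) ≡ q
        eq = solve-∀ ring

      Facts : ℕ → Set
      Facts k = ∣ u k ∣ ≤ B
              × (∀ u → In u → ∃ λ x → 0ℚ ≤ x × x ≤ 1ℚ × expℚ k (u + u) ≤ powℚ x 2 + q₁ × powℚ x w ≤ expℚ k (ι w * u) + q₁)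
              × seq p k ≤ pBound (seq constant) (seq δ) (seq ε) (seq s) w k + q₁
              × - q₁ ≤ seq p k
              × ι (suc J) ≤ ι 64 * ℓ k
              × (∀ L → - η ≤ a-at k L)
              × 1ℚ - η ≤ ΣL (a-at k) (subsets n)
              × All (λ I → ΣL (λ L → a-at k L * hit I L) (subsets n) ≤ 2ℚ * powℚ (seq p k) h + η) Is
              × e ≤ seq ε k

      facts : Eventually Facts
      facts = u-bounded ∧ᵉ exp-powers w q₁ 0<q₁ ∧ᵉ p≤ q₁ 0<q₁ ∧ᵉ p-≥ q₁ 0<q₁ ∧ᵉ precision-cost ∧ᵉ weights-≥ η 0<η ∧ᵉ total-≥ η 0<η ∧ᵉ hits-≤ η 0<η ∧ᵉ ½^K≤ε

      Goal : ℕ → Set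
      Goal k = 1ℚ - t k - seq ε k ≤ R k + q

      -- For nonnegative `u` the entry for δ^(s/4) is at least 1, so the claimed lower bound on the
      -- probability is not positive.
      trivial-case : ∀ k → Facts k → 0ℚ ≤ u k → Goal k
      trivial-case k (_ , _ , _ , _ , _ , a≥ , _ , _ , e≤ε) 0≤u = ≤-by
          (0≤+ (0≤+ (≤⇒0≤- 1≤t) (ℚ.≤-trans 0≤e e≤ε)) (0≤+ (≤⇒0≤- R≥) (0≤+ (≤⇒0≤- Sη≤) (ℚ.<⇒≤ 0<½q))))
          (eq (t k) (seq ε k) (R k) q (S * η))
        where
        1≤t : 1ℚ ≤ t k
        1≤t = subst (1ℚ ≤_) (t≡ k) (exp-≥1 k (0≤* (0≤ι w) 0≤u))
        R≥ : - (S * η) ≤ R k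
        R≥ = ΣL-≥- (a-at k) goodPr η (subsets n) (ℚ.<⇒≤ 0<η) a≥ 0≤goodPr goodPr≤1
        Sη≤ : S * η ≤ ½ * q
        Sη≤ = ℚ.≤-trans (*-monoʳ-≤ (ℚ.<⇒≤ 0<η) S≤C) (ℚ.≤-reflexive Cη≡)
        eq : ∀ t e R q y → R + q - (1ℚ - t - e) ≡ t - 1ℚ + e + (R - - y + (½ * q - y + ½ * q))
        eq = solve-∀ ring

      main-case : ∀ k → Facts k → u k ≤ 0ℚ → Goal k
      main-case k (u≤ , powers , p≤k , p≥k , cost , a≥ , tot , hits , e≤ε) u≤0 = conclude (powers (u k) (-B≤u , u≤0))
        where
        -B≤u : - B ≤ u k
        -B≤u = subst (- B ≤_) (neg-involutive (u k)) (ℚ.neg-antimono-≤ (ℚ.≤-trans (-≤∣∣ (u k)) u≤))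
        D : ℚ
        D = powℚ (ι w) 3 * ℓ k
        0<D : 0ℚ < D
        0<D = 0<* (pow->0 3 (0<ι w)) (ℚ.<-≤-trans 0<1 (1≤log k))
        p≤D : seq p k ≤ c₀ * expℚ k (x k) * invℚ (powℚ D 2) + q₁
        p≤D = subst (λ v → seq p k ≤ c₀ * expℚ k (x k) * invℚ (powℚ (powℚ v 3 * ℓ k) 2) + q₁) (sym (ι-def w)) p≤k
        lower : 1ℚ - e - N * (2ℚ * powℚ (seq p k) h) - C * η ≤ R k
        lower = good-probability (a-at k) η (2ℚ * powℚ (seq p k) h) (ℚ.<⇒≤ 0<η) a≥ tot hits
        finish : N * (2ℚ * powℚ (seq p k) h) ≤ t k + q₁ + N * (2ℚ * ((q₁ + q₁) * powℚ (ι 3) h)) → Goal k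
        finish bad≤ = ≤-by (0≤+ (≤⇒0≤- lower) (0≤+ (≤⇒0≤- bad≤) (0≤+ (≤⇒0≤- slack≤) (0≤+ (≤⇒0≤- e≤ε) (≤⇒0≤- (ℚ.≤-reflexive Cη≡))))))
          (eq (t k) (seq ε k) (R k) q e (N * (2ℚ * powℚ (seq p k) h)) (C * η) q₁ (N * (2ℚ * ((q₁ + q₁) * powℚ (ι 3) h))))
          where
          eq : ∀ t ε R q e P c q₁ s → R + q - (1ℚ - t - ε) ≡ R - (1ℚ - e - P - c) + (t + q₁ + s - P + (½ * q - (q₁ + s) + (ε - e + (½ * q - c))))
          eq = solve-∀ ring
        conclude : (∃ λ y → 0ℚ ≤ y × y ≤ 1ℚ × expℚ k (u k + u k) ≤ powℚ y 2 + q₁ × powℚ y w ≤ expℚ k (ι w * u k) + q₁) → Goal k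
        conclude (y , 0≤y , y≤1 , E≤ , t≥) = finish (estimate {y} {expℚ k (x k)} {D} {seq p k} {t k} {q₁} 0≤q₁ 2q₁≤1 0≤y y≤1
          (subst (λ v → expℚ k v ≤ powℚ y 2 + q₁) (u+u≡x k) E≤) 0<D (A≤ (ℓ k) cost) p≤D p≥k (subst (λ v → powℚ y w ≤ v + q₁) (t≡ k) t≥))

      -- Whether δ is below 1 cannot be decided, but the sign of the rational `u k` can, separately
      -- at every index.
      goal : Eventually Goal
      goal = mapᵉ (λ k fs → [ trivial-case k fs , main-case k fs ]′ (ℚ.≤-total 0ℚ (u k))) facts

    result : ProbAtLeast 𝒟 (HasSandwich (seq ε) (ℤ.+ w ℚ./ 2) (λ z → eval φ (lookup z)))
               (fromℕ 1 Defs.- seq δ Defs.^ᴿ (seq s Defs./ fromℕ 4) Defs.- seq ε)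
    result = good , good⇒sandwich (seq ε) ½^K≤ε , λ q 0<q → mapᵉ (λ k g → subst (λ r → 1ℚ - t k - seq ε k ≤ r + q) (sym (R≡ k)) g) (goal q 0<q)

open import Data.Integer using (+_)
open import Defs

claim5p4 : Σ[ c ∈ ℝ ] (fromℕ 0 < seq c) × (seq c < fromℕ 1) ×
    ((δ ε s p : ℝ) (w : ℕ) →
    fromℕ 0 < seq δ →
    fromℕ 0 < seq ε →
    fromℕ 0 < seq s →
    seq s ≤ fromℕ w →
    seq p ≤ pBound (seq c) (seq δ) (seq ε) (seq s) w →
    (n : ℕ) (φ : DNF (Fin n)) →
    HasWidth (+ w ℚ./ 1) φ →
    (D : Distribution n) →
    InClass (seq p) w D →
    ProbAtLeast D
    (HasSandwich (seq ε) (+ w ℚ./ 2) (λ z → eval φ (lookup z)))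
    (fromℕ 1 - seq δ ^ᴿ (seq s / fromℕ 4) - seq ε))
claim5p4 = Bounds.constant , Bounds.0<constant , Bounds.constant<1 , prove
  where
  prove : (δ ε s p : ℝ) (w : ℕ) → _
  prove δ ε s p zero      0<δ 0<ε 0<s s≤0 = ⊥-elim (Bounds.0<s≤0⇒⊥ (seq s) 0<s s≤0)
  prove δ ε s p w@(suc _) 0<δ 0<ε 0<s s≤w p≤ n φ width D class = Conclusion.Proof.result δ ε s p w 0<δ 0<ε p≤ n φ width D class
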